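{- Let $G$ be a colorable cactus graph. Then $\chi'_{\mathrm{irr}}(G)\le 4$.
   Context: All graphs are simple and finite. A cactus graph is a graph whose cycles are pairwise edge-disjoint. A graph is locally irregular if the two end-vertices of every edge have distinct degrees. A locally irregular $k$-edge coloring ($k$-liec) of $G$ is an edge coloring with at most $k$ colors in which each color class induces a locally irregular subgraph of $G$. A graph is colorable if it admits a liec with some number of colors, and for colorable $G$, the locally irregular chromatic index $\chi'_{\mathrm{irr}}(G)$ is the smallest $k$ such that $G$ admits a $k$-liec. -}

module Defs where

open import Data.Nat using (ℕ; _≤_)
open import Data.Bool using (Bool; true; false; _∧_)
open import Data.Fin using (Fin; _≟_)
open import Data.List using (List; []; _∷_; length; filter; allFin)
open import Data.List.Relation.Unary.Unique.Propositional using (Unique)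
open import Data.Product using (Σ; ∃; ∃-syntax; _×_; _,_)
open import Data.Sum using (_⊎_)
open import Relation.Binary.PropositionalEquality using (_≡_; _≢_)
open import Relation.Nullary.Decidable using (does)
open import Data.Bool using (T?)
open import Data.List.Membership.Propositional using (_∈_)
open import Function.Bundles using (_⇔_)

record Graph : Set where
  field
    n     : ℕ
    adj   : Fin n → Fin n → Bool
    sym   : ∀ u v → adj u v ≡ adj v u
    irref : ∀ v → adj v v ≡ false

open Graph public

Adj : (G : Graph) → Fin (n G) → Fin (n G) → Set
Adj G u v = adj G u v ≡ true

-- An edge colouring with colours in Fin k: a colour for each ordered pair,
-- required to be symmetric on edges (so it is a colour per unordered edge).
-- Values on non-edges are irrelevant.
record EdgeColouring (G : Graph) (k : ℕ) : Set where
  field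
    col    : Fin (n G) → Fin (n G) → Fin k
    colSym : ∀ u v → Adj G u v → col u v ≡ col v u

open EdgeColouring public

colDeg : {G : Graph} {k : ℕ} → EdgeColouring G k → Fin k → Fin (n G) → ℕ
colDeg {G} c i v =
  length (filter (λ u → T? (adj G v u ∧ does (col c v u ≟ i))) (allFin (n G)))

IsLIEC : {G : Graph} {k : ℕ} → EdgeColouring G k → Set
IsLIEC {G} c = ∀ u v → Adj G u v → colDeg c (col c u v) u ≢ colDeg c (col c u v) v

HasLIEC : Graph → ℕ → Set
HasLIEC G k = Σ (EdgeColouring G k) IsLIEC

Colourable : Graph → Set
Colourable G = ∃[ k ] HasLIEC G k

private
  consec : {A : Set} → A → List A → List (A × A)
  consec first []            = []
  consec first (x ∷ [])      = (x , first) ∷ []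
  consec first (x ∷ y ∷ xs)  = (x , y) ∷ consec first (y ∷ xs)

cycPairs : {A : Set} → List A → List (A × A)
cycPairs []       = []
cycPairs (x ∷ xs) = consec x (x ∷ xs)

record Cycle (G : Graph) : Set where
  field
    verts    : List (Fin (n G))
    long     : 3 ≤ length verts
    distinct : Unique verts
    closed   : ∀ {u v} → (u , v) ∈ cycPairs verts → Adj G u v

open Cycle public

EdgeOf : {G : Graph} → Cycle G → Fin (n G) → Fin (n G) → Set
EdgeOf C u v = (u , v) ∈ cycPairs (verts C) ⊎ (v , u) ∈ cycPairs (verts C)

-- cactus: any two cycles sharing an edge are the same cycle (same edge set),
-- i.e. distinct cycles are pairwise edge-disjoint
IsCactus : Graph → Set
IsCactus G = (C D : Cycle G) →
  (∃[ u ] ∃[ v ] (EdgeOf C u v × EdgeOf D u v)) →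
  ∀ u v → EdgeOf C u v ⇔ EdgeOf D u v

{-# OPTIONS --safe #-}

-- Root every component and let each edge be taken by one of its ends, so that a vertex takes
-- either no edge or at least two, in principle all of one colour. Bottom-up, a vertex takes all
-- edges to its children that were not taken below, and also the edge to its parent if exactly
-- one was left; a cycle is cut at an edge of its top vertex, which takes that edge. Then colours
-- are chosen top-down: seen from above, a branch is either free (its edge is taken above) or
-- light (its edge is taken below, where it has degree two), and since a vertex receives at most
-- two colours from above, four colours are enough.
-- The only obstruction is a root to which exactly one edge is left. Most branches can be
-- recoloured so as to change from free to light or conversely, which repairs the root. For all
-- other branches the degree below is forced in every locally irregular colouring, with any
-- number of colours, so an obstruction that cannot be repaired contradicts colourability.
-- The rooted structure comes from depth-first search: in a cactus no tree edge is spanned by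
-- two back edges.

module Submission where

open import Defs renaming (sym to adj-sym)
open import Data.Bool using (Bool; true; false; if_then_else_; _∧_; T?)
open import Data.Empty using (⊥; ⊥-elim)
open import Data.Fin using (Fin; zero; suc; _≟_)
open import Data.Fin.Properties using (all?; any?)
open import Data.List using (List; []; _∷_; _++_; length; filter; allFin; drop)
open import Data.List.Membership.Propositional using (_∈_)
open import Data.List.Membership.Propositional.Properties using (∈-allFin; ∈-∃++; ∈-++⁺ˡ; ∈-++⁺ʳ)
open import Data.List.Properties using (++-assoc; length-++)
open import Data.List.Relation.Unary.All using (All; []; _∷_)
import Data.List.Relation.Unary.All as All
open import Data.List.Relation.Unary.All.Properties using (++⁺; ++⁻)
open import Data.List.Relation.Unary.AllPairs using ([]; _∷_)
open import Data.List.Relation.Unary.Any using (here; there)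
open import Data.List.Relation.Unary.Linked using (Linked; []; [-]; _∷_)
open import Data.List.Relation.Unary.Unique.Propositional using (Unique)
open import Data.List.Relation.Unary.Unique.Propositional.Properties using (allFin⁺)
open import Data.Nat using (ℕ; zero; suc; _+_; _*_; _≤_; z≤n; s≤s; pred; _≤?_) renaming (_≟_ to _≟ℕ_)
open import Data.Nat.Properties hiding (_≟_)
open import Data.Nat.Tactic.RingSolver using (solve-∀)
open import Data.Product using (Σ; ∃; _×_; _,_; proj₁; proj₂)
open import Data.Sum using (_⊎_; inj₁; inj₂)
open import Data.Unit using (⊤; tt)
open import Function.Bundles using (Equivalence)
open import Relation.Binary.PropositionalEquality hiding (J)
open import Relation.Nullary using (¬_; Dec; yes; no; ¬?)
open import Relation.Nullary.Decidable using (does; from-yes; _×-dec_; decidable-stable)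

-- Degree two is the one to avoid: a light edge is bad only if its colour has degree two above. When
-- all light edges at a vertex share a fresh colour, this occurs only if there are exactly two of
-- them, and then each gets a fresh colour of its own. Below a tree edge this makes four colours:
-- the incoming one, one for the taken edges and two for the light ones. On a cycle two colours come
-- in, so one may be missing. Then light branches receive the colour of the taken edges, whose
-- degree becomes at least three, and a single configuration is left to be treated by hand.
--
-- Triangles are the exceptional cycles. In any other odd cycle some vertex can choose the next
-- colour different from that of the bottom edge, so that both edges at the top vertex may even have
-- the same colour. In a triangle both of whose lower corners carry nothing or a single forced light
-- branch this choice is missing, and the degrees there are nearly determined by the colours.

abstract
  -- Abstract, so that the many rewrites by `δ-refl` and `δ-≢` meet a stable term and not an
  -- unfolded decision.
  δ : ∀ {k} → Fin k → Fin k → ℕ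
  δ c x = if does (c ≟ x) then 1 else 0

  δ-def : ∀ {k} (c x : Fin k) → δ c x ≡ (if does (c ≟ x) then 1 else 0)
  δ-def c x = refl

  δ-refl : ∀ {k} (c : Fin k) → δ c c ≡ 1
  δ-refl c with c ≟ c
  ... | yes _ = refl
  ... | no ¬p = ⊥-elim (¬p refl)

  δ-≢ : ∀ {k} {c x : Fin k} → c ≢ x → δ c x ≡ 0
  δ-≢ {c = c} {x} ne with c ≟ x
  ... | yes p = ⊥-elim (ne p)
  ... | no _ = refl

δ-sym : ∀ {k} (c x : Fin k) → δ c x ≡ δ x c
δ-sym c x with c ≟ x
... | yes refl = refl
... | no ne = trans (δ-≢ ne) (sym (δ-≢ (≢-sym ne)))

abstract
  -- Checked by exhaustion; abstract so that the search is never unfolded. Callers with fewer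
  -- colours to exclude repeat an argument.
  pick : (a b c : Fin 4) → ∃ λ d → d ≢ a × d ≢ b × d ≢ c
  pick = from-yes pick?
    where
    pick? : Dec ((a b c : Fin 4) → ∃ λ d → d ≢ a × d ≢ b × d ≢ c)
    pick? = all? λ a → all? λ b → all? λ c → any? λ d →
      ¬? (d ≟ a) ×-dec ¬? (d ≟ b) ×-dec ¬? (d ≟ c)

-- Assigning colours at one vertex

-- How a branch or cycle looks from the vertex it hangs from: a branch whose edge is taken by that
-- vertex (free) or below (light), a cycle both of whose edges there are free (pair), and one with
-- a free and a light edge (odd).
data Kind : Set where
  free light pair odd : Kind

-- `avail` is the number of edges taken at the vertex itself, `lights` the number taken below. The
-- latter splits into `ords` and `odds` because only the light edge of a branch may share the colour
-- of the taken edges: an odd cycle needs two colours.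
avail lights ords odds : List Kind → ℕ
avail [] = 0
avail (free ∷ ks) = suc (avail ks)
avail (light ∷ ks) = avail ks
avail (pair ∷ ks) = suc (suc (avail ks))
avail (odd ∷ ks) = suc (avail ks)
lights [] = 0
lights (free ∷ ks) = lights ks
lights (light ∷ ks) = suc (lights ks)
lights (pair ∷ ks) = lights ks
lights (odd ∷ ks) = suc (lights ks)
ords [] = 0
ords (free ∷ ks) = ords ks
ords (light ∷ ks) = suc (ords ks)
ords (pair ∷ ks) = ords ks
ords (odd ∷ ks) = ords ks
odds [] = 0
odds (free ∷ ks) = odds ks
odds (light ∷ ks) = odds ks
odds (pair ∷ ks) = odds ks
odds (odd ∷ ks) = suc (odds ks)

-- Together with `pred` this divides the light edges as `std` does: the first one, and the rest.
first : ℕ → ℕ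
first zero = 0
first (suc _) = 1

-- The rule that a vertex takes no edge or at least two; `d` also counts edges from above that have
-- the colour of the taken ones.
Enough : List Kind → ℕ → Set
Enough ks d = avail ks ≡ 0 ⊎ 2 ≤ d

≥3⇒≢2 : ∀ {d} → 3 ≤ d → d ≢ 2
≥3⇒≢2 (s≤s (s≤s ())) refl

module _ {k : ℕ} where
  private C = Fin k

  -- A pair has one colour on both edges. In `oddA` the colour of the free edge comes first, that of
  -- the light edge second.
  data Asg : Kind → Set where
    freeA  : C → Asg free
    lightA : C → Asg light
    pairA  : C → Asg pair
    oddA   : C → C → Asg odd

  cntA : ∀ {ks} → All Asg ks → C → ℕ
  cntA [] x = 0
  cntA (freeA c ∷ as) x = δ c x + cntA as x
  cntA (lightA c ∷ as) x = δ c x + cntA as x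
  cntA (pairA c ∷ as) x = δ c x + δ c x + cntA as x
  cntA (oddA c c′ ∷ as) x = δ c x + δ c′ x + cntA as x

  -- At a free edge degree two or more is enough, since what hangs there can avoid any such degree.
  -- At a light edge the lower end has degree two, so two is the only forbidden value.
  Ok : ∀ {ks} → (C → ℕ) → All Asg ks → Set
  Ok D [] = ⊤
  Ok D (freeA c ∷ as) = 2 ≤ D c × Ok D as
  Ok D (lightA c ∷ as) = D c ≢ 2 × Ok D as
  Ok D (pairA c ∷ as) = 2 ≤ D c × Ok D as
  Ok D (oddA c c′ ∷ as) = (c ≢ c′ × 2 ≤ D c × D c′ ≢ 2) × Ok D as

  uni : (A Z : C) → ∀ ks → All Asg ks
  uni A Z [] = []
  uni A Z (free ∷ ks) = freeA A ∷ uni A Z ks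
  uni A Z (light ∷ ks) = lightA Z ∷ uni A Z ks
  uni A Z (pair ∷ ks) = pairA A ∷ uni A Z ks
  uni A Z (odd ∷ ks) = oddA A Z ∷ uni A Z ks

  -- The extra colour `Z` separates the first light edge from the others, for the case of exactly
  -- two light edges.
  std : (A X Z : C) → ∀ ks → All Asg ks
  std A X Z [] = []
  std A X Z (free ∷ ks) = freeA A ∷ std A X Z ks
  std A X Z (light ∷ ks) = lightA X ∷ uni A Z ks
  std A X Z (pair ∷ ks) = pairA A ∷ std A X Z ks
  std A X Z (odd ∷ ks) = oddA A X ∷ uni A Z ks

  -- Light branches may have the colour `A` of the taken edges once its degree is at least three.
  -- Two odd cycles would then give their light edges degree two in `X`; `swapped` exchanges the
  -- roles of the colours there, since degree two is harmless for free edges.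
  merged swapped : (A X : C) → ∀ ks → All Asg ks
  merged A X [] = []
  merged A X (free ∷ ks) = freeA A ∷ merged A X ks
  merged A X (light ∷ ks) = lightA A ∷ merged A X ks
  merged A X (pair ∷ ks) = pairA A ∷ merged A X ks
  merged A X (odd ∷ ks) = oddA A X ∷ merged A X ks
  swapped A X [] = []
  swapped A X (free ∷ ks) = freeA A ∷ swapped A X ks
  swapped A X (light ∷ ks) = lightA A ∷ swapped A X ks
  swapped A X (pair ∷ ks) = pairA A ∷ swapped A X ks
  swapped A X (odd ∷ ks) = oddA X A ∷ swapped A X ks

  private
    e1 : ∀ a p q → a + (p + q) ≡ a + p + q
    e1 = solve-∀
    e2 : ∀ z p q → z + (p + q) ≡ p + (z + q)
    e2 = solve-∀
    e3 : ∀ a p q → a + a + (p + q) ≡ a + (a + p) + q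
    e3 = solve-∀
    e4 : ∀ a z p q → a + z + (p + q) ≡ a + p + (z + q)
    e4 = solve-∀
    e5 : ∀ z p q → z + (p + q) ≡ p + (z + 0 + q)
    e5 = solve-∀
    e6 : ∀ a z p q → a + z + (p + q) ≡ a + p + (z + 0 + q)
    e6 = solve-∀

  cnt-uni : ∀ A Z ks x → cntA (uni A Z ks) x ≡ avail ks * δ A x + lights ks * δ Z x
  cnt-uni A Z [] x = refl
  cnt-uni A Z (free ∷ ks) x rewrite cnt-uni A Z ks x = e1 (δ A x) _ _
  cnt-uni A Z (light ∷ ks) x rewrite cnt-uni A Z ks x = e2 (δ Z x) (avail ks * δ A x) _
  cnt-uni A Z (pair ∷ ks) x rewrite cnt-uni A Z ks x = e3 (δ A x) _ _
  cnt-uni A Z (odd ∷ ks) x rewrite cnt-uni A Z ks x = e4 (δ A x) (δ Z x) _ _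

  cnt-std : ∀ A X Z ks x → cntA (std A X Z ks) x ≡
    avail ks * δ A x + (first (lights ks) * δ X x + pred (lights ks) * δ Z x)
  cnt-std A X Z [] x = refl
  cnt-std A X Z (free ∷ ks) x rewrite cnt-std A X Z ks x = e1 (δ A x) (avail ks * δ A x) _
  cnt-std A X Z (light ∷ ks) x rewrite cnt-uni A Z ks x = e5 (δ X x) (avail ks * δ A x) _
  cnt-std A X Z (pair ∷ ks) x rewrite cnt-std A X Z ks x = e3 (δ A x) (avail ks * δ A x) _
  cnt-std A X Z (odd ∷ ks) x rewrite cnt-uni A Z ks x = e6 (δ A x) (δ X x) (avail ks * δ A x) _

  private
    e7 : ∀ d a l o → d + ((a + l) * d + o) ≡ (a + suc l) * d + o
    e7 = solve-∀
    e8 : ∀ z a l o → z + a + (l + o) ≡ (z + l) + (a + o)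
    e8 = solve-∀
    e9 : ∀ z a l o → z + a + (l + o) ≡ (a + l) + (z + o)
    e9 = solve-∀

  cnt-merged : ∀ A X ks x → cntA (merged A X ks) x ≡ (avail ks + ords ks) * δ A x + odds ks * δ X x
  cnt-merged A X [] x = refl
  cnt-merged A X (free ∷ ks) x rewrite cnt-merged A X ks x = e1 (δ A x) _ _
  cnt-merged A X (light ∷ ks) x rewrite cnt-merged A X ks x = e7 (δ A x) (avail ks) _ _
  cnt-merged A X (pair ∷ ks) x rewrite cnt-merged A X ks x = e3 (δ A x) _ _
  cnt-merged A X (odd ∷ ks) x rewrite cnt-merged A X ks x = e8 (δ A x) (δ X x) ((avail ks + ords ks) * δ A x) _

  cnt-swapped : ∀ A X ks x → cntA (swapped A X ks) x ≡ (avail ks + ords ks) * δ A x + odds ks * δ X x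
  cnt-swapped A X [] x = refl
  cnt-swapped A X (free ∷ ks) x rewrite cnt-swapped A X ks x = e1 (δ A x) _ _
  cnt-swapped A X (light ∷ ks) x rewrite cnt-swapped A X ks x = e7 (δ A x) (avail ks) _ _
  cnt-swapped A X (pair ∷ ks) x rewrite cnt-swapped A X ks x = e3 (δ A x) _ _
  cnt-swapped A X (odd ∷ ks) x rewrite cnt-swapped A X ks x = e9 (δ X x) (δ A x) ((avail ks + ords ks) * δ A x) _

  ok-uni : ∀ ks {D A Z} → Enough ks (D A) → D Z ≢ 2 → A ≢ Z → Ok D (uni A Z ks)
  ok-uni [] h z ne = tt
  ok-uni (free ∷ ks) (inj₂ h) z ne = h , ok-uni ks (inj₂ h) z ne
  ok-uni (light ∷ ks) h z ne = z , ok-uni ks h z ne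
  ok-uni (pair ∷ ks) (inj₂ h) z ne = h , ok-uni ks (inj₂ h) z ne
  ok-uni (odd ∷ ks) (inj₂ h) z ne = (ne , h , z) , ok-uni ks (inj₂ h) z ne

  ok-std : ∀ ks {D A X Z} → Enough ks (D A) → D X ≢ 2 → D Z ≢ 2 → A ≢ X → A ≢ Z → Ok D (std A X Z ks)
  ok-std [] h x z ne ne′ = tt
  ok-std (free ∷ ks) (inj₂ h) x z ne ne′ = h , ok-std ks (inj₂ h) x z ne ne′
  ok-std (light ∷ ks) h x z ne ne′ = x , ok-uni ks h z ne′
  ok-std (pair ∷ ks) (inj₂ h) x z ne ne′ = h , ok-std ks (inj₂ h) x z ne ne′
  ok-std (odd ∷ ks) (inj₂ h) x z ne ne′ = (ne , h , x) , ok-uni ks (inj₂ h) z ne′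

  ok-merged : ∀ ks {D A X} → 3 ≤ D A → D X ≢ 2 → A ≢ X → Ok D (merged A X ks)
  ok-merged [] h x ne = tt
  ok-merged (free ∷ ks) h x ne = <⇒≤ h , ok-merged ks h x ne
  ok-merged (light ∷ ks) h x ne = ≥3⇒≢2 h , ok-merged ks h x ne
  ok-merged (pair ∷ ks) h x ne = <⇒≤ h , ok-merged ks h x ne
  ok-merged (odd ∷ ks) h x ne = (ne , <⇒≤ h , x) , ok-merged ks h x ne

  ok-swapped : ∀ ks {D A X} → 3 ≤ D A → 2 ≤ D X → A ≢ X → Ok D (swapped A X ks)
  ok-swapped [] h x ne = tt
  ok-swapped (free ∷ ks) h x ne = <⇒≤ h , ok-swapped ks h x ne
  ok-swapped (light ∷ ks) h x ne = ≥3⇒≢2 h , ok-swapped ks h x ne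
  ok-swapped (pair ∷ ks) h x ne = <⇒≤ h , ok-swapped ks h x ne
  ok-swapped (odd ∷ ks) h x ne = ((λ p → ne (sym p)) , x , ≥3⇒≢2 h) , ok-swapped ks h x ne

  -- The vertex has inc further edges of each colour, and the assignment uses A exactly a times
  -- and no colour in Off.
  data Reach (ks : List Kind) (inc : C → ℕ) (A : C) (a : ℕ) (Off : C → Set) : All Asg ks → Set where
    reach : ∀ {as} → Ok (λ x → inc x + cntA as x) as → cntA as A ≡ a →
            (∀ c → Off c → cntA as c ≡ 0) → Reach ks inc A a Off as

  private
    z1 : ∀ a b → a * 1 + b * 0 ≡ a
    z1 = solve-∀
    z2 : ∀ a b → a * 0 + b * 1 ≡ b
    z2 = solve-∀
    z3 : ∀ a b c → a * 1 + (b * 0 + c * 0) ≡ a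
    z3 = solve-∀
    z4 : ∀ a b → a * 0 + b * 0 ≡ 0
    z4 = solve-∀
    z5 : ∀ a b c → a * 0 + (b * 0 + c * 0) ≡ 0
    z5 = solve-∀
    z6 : ∀ a b c → a * 0 + (b * 1 + c * 1) ≡ b + c
    z6 = solve-∀
    z7 : ∀ a b c → a * 0 + (b * 1 + c * 0) ≡ b
    z7 = solve-∀
    z8 : ∀ a b c → a * 0 + (b * 0 + c * 1) ≡ c
    z8 = solve-∀
    first+pred : ∀ n → first n + pred n ≡ n
    first+pred zero = refl
    first+pred (suc n) = refl

  -- Light edges of one new colour fail only if there are two of them; in that case `X` and `Y` get
  -- one each and have degree one.
  std-lights-≢ : ∀ ks {A X Y} inc → A ≢ X → A ≢ Y → X ≢ Y → inc X ≡ 0 → inc Y ≡ 0 →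
    Enough ks (inc A + avail ks) →
    ∃ λ Z → Reach ks inc A (avail ks) (λ c → c ≢ A × c ≢ X × c ≢ Y) (std A X Z ks)
  std-lights-≢ ks {A} {X} {Y} inc A≢X A≢Y X≢Y iX iY en with lights ks ≟ℕ 2
  ... | no n≢2 = X , reach (ok-std ks en′ nX nX A≢X A≢X) cA off
    where
    cA : cntA (std A X X ks) A ≡ avail ks
    cA rewrite cnt-std A X X ks A | δ-refl A | δ-≢ (≢-sym A≢X) = z3 (avail ks) (first (lights ks)) (pred (lights ks))
    cX : cntA (std A X X ks) X ≡ lights ks
    cX rewrite cnt-std A X X ks X | δ-refl X | δ-≢ A≢X =
      trans (z6 (avail ks) (first (lights ks)) (pred (lights ks))) (first+pred (lights ks))
    nX : inc X + cntA (std A X X ks) X ≢ 2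
    nX rewrite iX | cX = n≢2
    en′ : Enough ks (inc A + cntA (std A X X ks) A)
    en′ rewrite cA = en
    off : ∀ c → c ≢ A × c ≢ X × c ≢ Y → cntA (std A X X ks) c ≡ 0
    off c (p , q , r) rewrite cnt-std A X X ks c | δ-≢ (≢-sym p) | δ-≢ (≢-sym q) = z5 (avail ks) (first (lights ks)) (pred (lights ks))
  ... | yes n≡2 = Y , reach (ok-std ks en′ nX nY A≢X A≢Y) cA off
    where
    cA : cntA (std A X Y ks) A ≡ avail ks
    cA rewrite cnt-std A X Y ks A | δ-refl A | δ-≢ (≢-sym A≢X) | δ-≢ (≢-sym A≢Y) = z3 (avail ks) (first (lights ks)) (pred (lights ks))
    nX : inc X + cntA (std A X Y ks) X ≢ 2
    nX rewrite iX | cnt-std A X Y ks X | δ-refl X | δ-≢ A≢X | δ-≢ (≢-sym X≢Y) | n≡2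
             | z7 (avail ks) 1 1 = λ ()
    nY : inc Y + cntA (std A X Y ks) Y ≢ 2
    nY rewrite iY | cnt-std A X Y ks Y | δ-refl Y | δ-≢ A≢Y | δ-≢ X≢Y | n≡2
             | z8 (avail ks) 1 1 = λ ()
    en′ : Enough ks (inc A + cntA (std A X Y ks) A)
    en′ rewrite cA = en
    off : ∀ c → c ≢ A × c ≢ X × c ≢ Y → cntA (std A X Y ks) c ≡ 0
    off c (p , q , r) rewrite cnt-std A X Y ks c | δ-≢ (≢-sym p) | δ-≢ (≢-sym q) | δ-≢ (≢-sym r) =
      z5 (avail ks) (first (lights ks)) (pred (lights ks))

  uni-lights : ∀ ks {A X} inc → A ≢ X → inc X ≡ 0 → lights ks ≢ 2 → Enough ks (inc A + avail ks) →
    Reach ks inc A (avail ks) (λ c → c ≢ A × c ≢ X) (uni A X ks)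
  uni-lights ks {A} {X} inc A≢X iX n≢2 en = reach (ok-uni ks en′ nX A≢X) cA off
    where
    cA : cntA (uni A X ks) A ≡ avail ks
    cA rewrite cnt-uni A X ks A | δ-refl A | δ-≢ (≢-sym A≢X) = z1 (avail ks) (lights ks)
    nX : inc X + cntA (uni A X ks) X ≢ 2
    nX rewrite iX | cnt-uni A X ks X | δ-refl X | δ-≢ A≢X | z2 (avail ks) (lights ks) = n≢2
    en′ : Enough ks (inc A + cntA (uni A X ks) A)
    en′ rewrite cA = en
    off : ∀ c → c ≢ A × c ≢ X → cntA (uni A X ks) c ≡ 0
    off c (p , q) rewrite cnt-uni A X ks c | δ-≢ (≢-sym p) | δ-≢ (≢-sym q) = z4 (avail ks) (lights ks)

  -- The cheaper alternative to `std-lights-≢`: a single new colour `X` suffices, at the price of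
  -- degree three in `A`.
  merge-lights : ∀ ks {A X} inc → A ≢ X → inc X ≡ 0 → 3 ≤ inc A + (avail ks + ords ks) →
    ∃ (Reach ks inc A (avail ks + ords ks) (λ c → c ≢ A × c ≢ X))
  merge-lights ks {A} {X} inc A≢X iX h with odds ks ≟ℕ 2
  ... | no n≢2 = merged A X ks , reach (ok-merged ks h′ nX A≢X) cA off
    where
    cA : cntA (merged A X ks) A ≡ avail ks + ords ks
    cA rewrite cnt-merged A X ks A | δ-refl A | δ-≢ (≢-sym A≢X) = z1 (avail ks + ords ks) (odds ks)
    nX : inc X + cntA (merged A X ks) X ≢ 2
    nX rewrite iX | cnt-merged A X ks X | δ-refl X | δ-≢ A≢X | z2 (avail ks + ords ks) (odds ks) = n≢2
    h′ : 3 ≤ inc A + cntA (merged A X ks) A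
    h′ rewrite cA = h
    off : ∀ c → c ≢ A × c ≢ X → cntA (merged A X ks) c ≡ 0
    off c (p , q) rewrite cnt-merged A X ks c | δ-≢ (≢-sym p) | δ-≢ (≢-sym q) = z4 (avail ks + ords ks) (odds ks)
  ... | yes n≡2 = swapped A X ks , reach (ok-swapped ks h′ nX A≢X) cA off
    where
    cA : cntA (swapped A X ks) A ≡ avail ks + ords ks
    cA rewrite cnt-swapped A X ks A | δ-refl A | δ-≢ (≢-sym A≢X) = z1 (avail ks + ords ks) (odds ks)
    nX : 2 ≤ inc X + cntA (swapped A X ks) X
    nX rewrite iX | cnt-swapped A X ks X | δ-refl X | δ-≢ A≢X | z2 (avail ks + ords ks) (odds ks) | n≡2 =
      ≤-refl
    h′ : 3 ≤ inc A + cntA (swapped A X ks) A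
    h′ rewrite cA = h
    off : ∀ c → c ≢ A × c ≢ X → cntA (swapped A X ks) c ≡ 0
    off c (p , q) rewrite cnt-swapped A X ks c | δ-≢ (≢-sym p) | δ-≢ (≢-sym q) = z4 (avail ks + ords ks) (odds ks)

lights≤ : ∀ ks → lights ks ≤ avail ks + ords ks
lights≤ [] = z≤n
lights≤ (free ∷ ks) = m≤n⇒m≤1+n (lights≤ ks)
lights≤ (light ∷ ks) = subst (suc (lights ks) ≤_) (sym (+-suc (avail ks) (ords ks))) (s≤s (lights≤ ks))
lights≤ (pair ∷ ks) = m≤n⇒m≤1+n (m≤n⇒m≤1+n (lights≤ ks))
lights≤ (odd ∷ ks) = s≤s (lights≤ ks)

-- The only configuration at the bottom vertex of a cycle in which one spare colour gives the light
-- edges degree two and there are too few edges for merging.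
two-odds : ∀ ks → lights ks ≡ 2 → 2 ≤ avail ks → avail ks + ords ks ≤ 2 → ks ≡ odd ∷ odd ∷ []
two-odds (light ∷ ks) n a h =
  ⊥-elim (<-irrefl refl (≤-trans (s≤s a) (≤-trans (s≤s (m≤m+n (avail ks) (ords ks)))
    (≤-trans (≤-reflexive (sym (+-suc (avail ks) (ords ks)))) h))))
two-odds (free ∷ ks) n a h =
  ⊥-elim (<-irrefl n (≤-trans (s≤s (lights≤ ks)) h))
two-odds (pair ∷ ks) n a h =
  ⊥-elim (<-irrefl n (≤-trans (s≤s (lights≤ ks)) (<⇒≤ h)))
two-odds (odd ∷ []) () a h
two-odds (odd ∷ light ∷ ks) n (s≤s a) h =
  ⊥-elim (<-irrefl refl (≤-trans (s≤s a) (≤-trans (s≤s (m≤m+n (avail ks) (ords ks)))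
    (≤-trans (≤-reflexive (sym (+-suc (avail ks) (ords ks)))) (≤-pred h)))))
two-odds (odd ∷ free ∷ ks) n a h =
  ⊥-elim (<-irrefl n (≤-trans (s≤s (s≤s (lights≤ ks))) h))
two-odds (odd ∷ pair ∷ ks) n a (s≤s (s≤s ()))
two-odds (odd ∷ odd ∷ []) n a h = refl
two-odds (odd ∷ odd ∷ free ∷ ks) n a (s≤s (s≤s ()))
two-odds (odd ∷ odd ∷ light ∷ ks) () a h
two-odds (odd ∷ odd ∷ pair ∷ ks) n a (s≤s (s≤s ()))
two-odds (odd ∷ odd ∷ odd ∷ ks) n a (s≤s (s≤s ()))

≤1-split : ∀ {a b} → a + b ≤ 1 → 1 ≤ a → b ≡ 0
≤1-split {suc zero} {zero} h p = refl
≤1-split {suc zero} {suc b} (s≤s ()) p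
≤1-split {suc (suc a)} (s≤s ()) p

-- Cycles from paths

linked-prefix : ∀ {A : Set} {R : A → A → Set} xs {ys} → Linked R (xs ++ ys) → Linked R xs
linked-prefix [] _ = []
linked-prefix (x ∷ []) _ = [-]
linked-prefix (x ∷ y ∷ xs) (r ∷ l) = r ∷ linked-prefix (y ∷ xs) l

module _ {A : Set} where

  -- The local function of cycPairs is private in Defs, hence this copy.
  closing : A → List A → List (A × A)
  closing f [] = []
  closing f (x ∷ []) = (x , f) ∷ []
  closing f (x ∷ y ∷ xs) = (x , y) ∷ closing f (y ∷ xs)

  cycPairs-closing : ∀ x xs → cycPairs (x ∷ xs) ≡ closing x (x ∷ xs)
  cycPairs-closing x [] = refl
  cycPairs-closing x (y ∷ xs) = cong ((x , y) ∷_) (tail x y xs)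
    where
    tail : ∀ f z zs → drop 1 (cycPairs (f ∷ z ∷ zs)) ≡ closing f (z ∷ zs)
    tail f z [] = refl
    tail f z (y ∷ zs) = cong ((z , y) ∷_) (tail f y zs)

  firstOr : A → List A → A
  firstOr v [] = v
  firstOr v (x ∷ _) = x

  cycPairs-from : ∀ l v rest → cycPairs (l ++ v ∷ rest) ≡ closing (firstOr v l) (l ++ v ∷ rest)
  cycPairs-from [] v rest = cycPairs-closing v rest
  cycPairs-from (x ∷ l) v rest = cycPairs-closing x (l ++ v ∷ rest)

  closing-linked : ∀ {R : A → A → Set} f xs z {a b} → Linked R (xs ++ z ∷ []) → R z f →
    (a , b) ∈ closing f (xs ++ z ∷ []) → R a b
  closing-linked f [] z _ r (here refl) = r
  closing-linked f (x ∷ []) z (q ∷ _) r (here refl) = q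
  closing-linked f (x ∷ []) z (q ∷ _) r (there (here refl)) = r
  closing-linked f (x ∷ y ∷ xs) z (q ∷ _) r (here refl) = q
  closing-linked f (x ∷ y ∷ xs) z (_ ∷ l) r (there p) = closing-linked f (y ∷ xs) z l r p

  closing-step : ∀ f l v p q → (v , p) ∈ closing f (l ++ v ∷ p ∷ q)
  closing-step f [] v p q = here refl
  closing-step f (x ∷ []) v p q = there (here refl)
  closing-step f (x ∷ y ∷ l) v p q = there (closing-step f (y ∷ l) v p q)

  closing-last : ∀ f xs z → (z , f) ∈ closing f (xs ++ z ∷ [])
  closing-last f [] z = here refl
  closing-last f (x ∷ []) z = there (here refl)
  closing-last f (x ∷ y ∷ xs) z = there (closing-last f (y ∷ xs) z)

  closing-inside : ∀ f xs z {a b} → (a , b) ∈ closing f (xs ++ z ∷ []) →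
    (a ∈ xs ++ z ∷ [] × b ∈ xs ++ z ∷ []) ⊎ (a ≡ z × b ≡ f)
  closing-inside f [] z (here refl) = inj₂ (refl , refl)
  closing-inside f (x ∷ []) z (here refl) = inj₁ (here refl , there (here refl))
  closing-inside f (x ∷ []) z (there (here refl)) = inj₂ (refl , refl)
  closing-inside f (x ∷ y ∷ xs) z (here refl) = inj₁ (here refl , there (here refl))
  closing-inside f (x ∷ y ∷ xs) z (there p) with closing-inside f (y ∷ xs) z p
  ... | inj₁ (a , b) = inj₁ (there a , there b)
  ... | inj₂ e = inj₂ e

  -- A fundamental cycle crosses between the vertices up to `v` and those from `p` on only twice: by
  -- the tree edge from `v` to `p` and by the back edge between `z` and `f`.
  data Pass (f v p z : A) (low up : List A) (a b : A) : Set where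
    below  : a ∈ low → b ∈ low → Pass f v p z low up a b
    across : a ≡ v → b ≡ p → Pass f v p z low up a b
    above  : a ∈ up → b ∈ up → Pass f v p z low up a b
    back   : a ≡ z → b ≡ f → Pass f v p z low up a b

  closing-pass : ∀ f l v p q xs z {a b} → p ∷ q ≡ xs ++ z ∷ [] →
    (a , b) ∈ closing f (l ++ v ∷ p ∷ q) → Pass f v p z (l ++ v ∷ []) (p ∷ q) a b
  closing-pass f [] v p q xs z e (here refl) = across refl refl
  closing-pass f [] v p q xs z {a} {b} e (there m)
    with closing-inside f xs z (subst (λ l → (a , b) ∈ closing f l) e m)
  ... | inj₁ (i , j) = above (subst (a ∈_) (sym e) i) (subst (b ∈_) (sym e) j)
  ... | inj₂ (i , j) = back i j
  closing-pass f (x ∷ []) v p q xs z e (here refl) = below (here refl) (there (here refl))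
  closing-pass f (x ∷ []) v p q xs z e (there m) with closing-pass f [] v p q xs z e m
  ... | below i j = below (there i) (there j)
  ... | across i j = across i j
  ... | above i j = above i j
  ... | back i j = back i j
  closing-pass f (x ∷ y ∷ l) v p q xs z e (here refl) = below (here refl) (there (here refl))
  closing-pass f (x ∷ y ∷ l) v p q xs z e (there m) with closing-pass f (y ∷ l) v p q xs z e m
  ... | below i j = below (there i) (there j)
  ... | across i j = across i j
  ... | above i j = above i j
  ... | back i j = back i j

data OthersZero (a b c d e : ℕ) : Set where
  others-zero : b ≡ 0 → c ≡ 0 → d ≡ 0 → e ≡ 0 → OthersZero a b c d e

alone : ∀ {a b c d e} → a + b + (c + (d + e)) ≤ 1 → 1 ≤ a → OthersZero a b c d e
alone {a} {b} {c} {d} {e} h p =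
  let z = ≤1-split (subst (_≤ 1) (assoc a b c d e) h) p
      z′ = m+n≡0⇒n≡0 b z
      z″ = m+n≡0⇒n≡0 c z′ in
  others-zero (m+n≡0⇒m≡0 b z) (m+n≡0⇒m≡0 c z′) (m+n≡0⇒m≡0 d z″) (m+n≡0⇒n≡0 d z″)
  where
  assoc : ∀ a b c d e → a + b + (c + (d + e)) ≡ a + (b + (c + (d + e)))
  assoc = solve-∀

module Cactus (G : Graph) where
  private
    V : Set
    V = Fin (n G)

  -- Rooted cacti and their colourings

  mutual
    data Tree : Set where
      node : V → Items → Tree

    -- cyc t ch is a cycle through the current vertex whose other vertices are, in order, the
    -- root of t and the roots along ch; its bottom vertex, the last one, is adjacent to the
    -- current vertex again.
    data Items : Set where
      []  : Items
      br  : Tree → Items → Items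
      cyc : Tree → Chain → Items → Items

    data Chain : Set where
      base : Tree → Chain
      step : Tree → Chain → Chain

  -- In cyc c c₀ the colours belong to the edges from the current vertex to the first and to the
  -- bottom vertex of the cycle; step carries the colour of the edge between two consecutive ones.
  module _ (k : ℕ) where
    mutual
      data ColT : Tree → Set where
        node : ∀ {v is} → ColI is → ColT (node v is)

      data ColI : Items → Set where
        []  : ColI []
        br  : ∀ {t is} → Fin k → ColT t → ColI is → ColI (br t is)
        cyc : ∀ {t ch is} → (top bottom : Fin k) → ColC (step t ch) → ColI is → ColI (cyc t ch is)

      data ColC : Chain → Set where
        base : ∀ {t} → ColT t → ColC (base t)
        step : ∀ {t ch} → Fin k → ColT t → ColC ch → ColC (step t ch)

  module _ {k : ℕ} where
    cntI : ∀ {is} → ColI k is → Fin k → ℕ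
    cntI [] x = 0
    cntI (br c _ r) x = δ c x + cntI r x
    cntI (cyc c c₀ _ r) x = δ c x + δ c₀ x + cntI r x

    degT : ∀ {t} → (Fin k → ℕ) → ColT k t → Fin k → ℕ
    degT inc (node col) x = inc x + cntI col x

    degC : ∀ {ch} → Fin k → Fin k → ColC k ch → Fin k → ℕ
    degC c₀ c (base ct) = degT (λ x → δ c x + δ c₀ x) ct
    degC c₀ c (step c′ ct _) = degT (λ x → δ c x + δ c′ x) ct

    -- VT inc: every edge of the tree has distinct degrees in its colour at its ends, when the
    -- root lies on inc x further edges of each colour x. In VI, D gives the degrees of the current
    -- vertex. In VC, the chain hangs from a vertex whose degree in c₀ is d: the edge to its top
    -- vertex has colour c and the edge to its bottom vertex has colour c₀; the condition on the
    -- former is left to the caller.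
    mutual
      VT : ∀ {t} → (Fin k → ℕ) → ColT k t → Set
      VT inc (node col) = VI (λ x → inc x + cntI col x) col

      VI : ∀ {is} → (Fin k → ℕ) → ColI k is → Set
      VI D [] = ⊤
      VI D (br c ct r) = VT (δ c) ct × D c ≢ degT (δ c) ct c × VI D r
      VI D (cyc c c₀ cc r) = VC (D c₀) c₀ c cc × D c ≢ degC c₀ c cc c × VI D r

      VC : ∀ {ch} → ℕ → Fin k → Fin k → ColC k ch → Set
      VC d c₀ c (base ct) = VT (λ x → δ c x + δ c₀ x) ct × d ≢ degT (λ x → δ c x + δ c₀ x) ct c₀
      VC d c₀ c (step c′ ct cc) =
        VT (λ x → δ c x + δ c′ x) ct ×
        degT (λ x → δ c x + δ c′ x) ct c′ ≢ degC c₀ c′ cc c′ ×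
        VC d c₀ c′ cc

    VI-ext : ∀ {is} {D D′ : Fin k → ℕ} → (∀ x → D x ≡ D′ x) → (col : ColI k is) → VI D col → VI D′ col
    VI-ext e [] v = tt
    VI-ext e (br c ct r) (v , ne , vr) = v , (λ q → ne (trans (e c) q)) , VI-ext e r vr
    VI-ext e (cyc c c₀ cc r) (v , ne , vr) =
      subst (λ d → VC d c₀ c cc) (e c₀) v , (λ q → ne (trans (e c) q)) , VI-ext e r vr

    degT-ext : ∀ {t} {i i′ : Fin k → ℕ} → (∀ x → i x ≡ i′ x) → (ct : ColT k t) → ∀ x → degT i ct x ≡ degT i′ ct x
    degT-ext e (node col) x = cong (_+ cntI col x) (e x)

    VT-ext : ∀ {t} {i i′ : Fin k → ℕ} → (∀ x → i x ≡ i′ x) → (ct : ColT k t) → VT i ct → VT i′ ct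
    VT-ext e (node col) v = VI-ext (λ x → cong (_+ cntI col x) (e x)) col v

  -- Classification of branches and cycles

  -- What can be achieved for a branch whose edge to its parent has colour P: FreeT copes with any
  -- degree d ≥ 2 of the parent, UpT fixes the degree of the root of the branch instead.
  FreeT : Tree → Set
  FreeT t = ∀ (P : Fin 4) d → 2 ≤ d → Σ (ColT 4 t) λ ct → VT (δ P) ct × d ≢ degT (δ P) ct P

  UpT : Tree → ℕ → Set
  UpT t d = ∀ (P : Fin 4) → Σ (ColT 4 t) λ ct → VT (δ P) ct × degT (δ P) ct P ≡ d

  ForcedT : Tree → ℕ → Set
  ForcedT t d = ∀ {k} (c : Fin k) (ct : ColT k t) → VT (δ c) ct → degT (δ c) ct c ≡ d

  -- `P` colours the edge that closes the cycle at the bottom vertex. It is taken by the top vertex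
  -- of the cycle, whose degree in `P` is `d`, hence `2 ≤ d`. Free and light refer to the edge of
  -- colour `Q` above the chain.
  FreeAt LightAt : Chain → Fin 4 → Fin 4 → Set
  FreeAt ch P Q = ∀ d e → 2 ≤ d → 2 ≤ e → Σ (ColC 4 ch) λ cc → VC d P Q cc × e ≢ degC P Q cc Q
  LightAt ch P Q = ∀ d → 2 ≤ d → Σ (ColC 4 ch) λ cc → VC d P Q cc × degC P Q cc Q ≡ 2

  -- The same colour `A` on both edges, so that the pair alone gives its vertex degree two.
  PairC : Tree → Chain → Set
  PairC t ch = ∀ A d → 2 ≤ d → Σ (ColC 4 (step t ch)) λ cc → VC d A A cc × d ≢ degC A A cc A

  -- The rigidity behind tight triangles: such a vertex cannot add to either cycle edge if these
  -- differ in colour, and can add at most one edge if they agree.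
  Corner : Tree → Set
  Corner t = ∀ {k} (c c′ : Fin k) (ct : ColT k t) → let inc = λ x → δ c x + δ c′ x in
    VT inc ct →
    (c ≢ c′ → degT inc ct c ≡ 1 × degT inc ct c′ ≡ 1) × (c ≡ c′ → degT inc ct c ≡ 2 ⊎ degT inc ct c ≡ 3)

  data ClassT (t : Tree) : Set where
    flex   : FreeT t → ∀ d → 2 ≤ d → UpT t d → ClassT t
    pfree  : FreeT t → ForcedT t 1 → ClassT t
    plight : UpT t 2 → ForcedT t 2 → ClassT t

  -- loose and tight cycles are odd; only a loose one can have equal colours at its top vertex.
  data ClassC (t : Tree) : Chain → Set where
    even  : ∀ {ch} → PairC t ch → ClassC t ch
    loose : ∀ {ch} → (∀ P Q → LightAt (step t ch) P Q) → ClassC t ch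
    tight : ∀ {t₁} → (∀ P Q → P ≢ Q → LightAt (step t (base t₁)) P Q) →
            Corner t → Corner t₁ → ClassC t (base t₁)

  kindT : ∀ {t} → ClassT t → Kind
  kindT (flex _ _ _ _) = free
  kindT (pfree _ _) = free
  kindT (plight _ _) = light

  kindC : ∀ {t ch} → ClassC t ch → Kind
  kindC (even _) = pair
  kindC (loose _) = odd
  kindC (tight _ _ _) = odd

  data ClassI : Items → List Kind → Set where
    []  : ClassI [] []
    br  : ∀ {t is ks} (c : ClassT t) → ClassI is ks → ClassI (br t is) (kindT c ∷ ks)
    cyc : ∀ {t ch is ks} (c : ClassC t ch) → ClassI is ks → ClassI (cyc t ch is) (kindC c ∷ ks)

  -- The top-down step: each clause of `Ok` is exactly what the class of the item asks of the degree
  -- above. A flexible branch is used as a free one here; its other mode is needed only for repairs.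
  realize : ∀ {is ks} → ClassI is ks → (as : All Asg ks) (D : Fin 4 → ℕ) → Ok D as →
    Σ (ColI 4 is) λ col → VI D col × (∀ x → cntI col x ≡ cntA as x)
  realize [] [] D ok = [] , tt , λ _ → refl
  realize (br (flex f _ _ _) cs) (freeA P ∷ as) D (o , ok) with f P (D P) o | realize cs as D ok
  ... | ct , v , ne | col , vs , e = br P ct col , (v , ne , vs) , λ x → cong (δ P x +_) (e x)
  realize (br (pfree f _) cs) (freeA P ∷ as) D (o , ok) with f P (D P) o | realize cs as D ok
  ... | ct , v , ne | col , vs , e = br P ct col , (v , ne , vs) , λ x → cong (δ P x +_) (e x)
  realize (br (plight u _) cs) (lightA P ∷ as) D (o , ok) with u P | realize cs as D ok
  ... | ct , v , d2 | col , vs , e =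
    br P ct col , (v , (λ q → o (trans q d2)) , vs) , λ x → cong (δ P x +_) (e x)
  realize (cyc (even p) cs) (pairA A ∷ as) D (o , ok) with p A (D A) o | realize cs as D ok
  ... | cc , v , ne | col , vs , e = cyc A A cc col , (v , ne , vs) , λ x → cong (δ A x + δ A x +_) (e x)
  realize (cyc (loose l) cs) (oddA P Q ∷ as) D ((ne , o , o′) , ok) with l P Q (D P) o | realize cs as D ok
  ... | cc , v , d2 | col , vs , e =
    -- The free edge of an odd cycle is the one to its bottom vertex, so the two colours change
    -- places.
    cyc Q P cc col , (v , (λ q → o′ (trans q d2)) , vs) , λ x → cong₂ _+_ (+-comm (δ Q x) (δ P x)) (e x)
  realize (cyc (tight l _ _) cs) (oddA P Q ∷ as) D ((ne , o , o′) , ok)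
    with l P Q ne (D P) o | realize cs as D ok
  ... | cc , v , d2 | col , vs , e =
    cyc Q P cc col , (v , (λ q → o′ (trans q d2)) , vs) , λ x → cong₂ _+_ (+-comm (δ Q x) (δ P x)) (e x)

  module _ {v : V} {is : Items} {ks : List Kind} (cls : ClassI is ks) where

    solve : (inc D : Fin 4 → ℕ) (as : All Asg ks) → (∀ x → D x ≡ inc x + cntA as x) → Ok D as →
      Σ (ColT 4 (node v is)) λ ct → VT inc ct × (∀ x → degT inc ct x ≡ D x)
    solve inc D as e ok with realize cls as D ok
    ... | col , vi , c = node col , VI-ext (λ x → sym (e′ x)) col vi , e′
      where
      e′ : ∀ x → inc x + cntI col x ≡ D x
      e′ x = trans (cong (inc x +_) (c x)) (sym (e x))

    -- No edge below has colour `P`, so the edge above has degree one here, less than `d`.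
    node-free : avail ks ≢ 1 → FreeT (node v is)
    node-free a≢1 P d 2≤d with pick P P P
    ... | X , X≢P , _ with pick P X X
    ... | A , A≢P , A≢X , _ with pick P A X
    ... | Y , Y≢P , Y≢A , Y≢X
      with std-lights-≢ ks (δ P) A≢X (≢-sym Y≢A) (≢-sym Y≢X) (δ-≢ (≢-sym X≢P)) (δ-≢ (≢-sym Y≢P)) en
      where
      en : Enough ks (δ P A + avail ks)
      en with avail ks
      ... | 0 = inj₁ refl
      ... | 1 = ⊥-elim (a≢1 refl)
      ... | suc (suc a) = inj₂ (≤-trans (s≤s (s≤s z≤n)) (m≤n+m (suc (suc a)) (δ P A)))
    ... | Z , reach {as} ok cA off with solve (δ P) _ as (λ _ → refl) ok
    ... | ct , vt , dg = ct , vt , λ q → <⇒≢ 2≤d (sym (trans q (trans (dg P) D≡1)))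
      where
      D≡1 : δ P P + cntA as P ≡ 1
      D≡1 rewrite δ-refl P | off P (≢-sym A≢P , ≢-sym X≢P , ≢-sym Y≢P) = refl

    -- The taken edges get colour `P`; as the edge above counts among them, one further edge is
    -- enough.
    node-up : 1 ≤ avail ks → UpT (node v is) (suc (avail ks))
    node-up 1≤a P with pick P P P
    ... | X , X≢P , _ with pick P X X
    ... | Y , Y≢P , Y≢X , _
      with std-lights-≢ ks (δ P) (≢-sym X≢P) (≢-sym Y≢P) (≢-sym Y≢X) (δ-≢ (≢-sym X≢P)) (δ-≢ (≢-sym Y≢P))
             (inj₂ (subst (λ z → 2 ≤ z + avail ks) (sym (δ-refl P)) (s≤s 1≤a)))
    ... | Z , reach {as} ok cA off with solve (δ P) _ as (λ _ → refl) ok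
    ... | ct , vt , dg = ct , vt , trans (dg P) (cong₂ _+_ (δ-refl P) cA)

    -- A repair: the vertex takes the edge above by giving its light branches the colour `P` as
    -- well. The degree is then at least three, so these branches remain correct.
    node-merge : 2 ≤ avail ks + ords ks → UpT (node v is) (suc (avail ks + ords ks))
    node-merge h P with pick P P P
    ... | X , X≢P , _
      with merge-lights ks (δ P) (≢-sym X≢P) (δ-≢ (≢-sym X≢P))
             (subst (λ z → 3 ≤ z + (avail ks + ords ks)) (sym (δ-refl P)) (s≤s h))
    ... | as , reach ok cA off with solve (δ P) _ as (λ _ → refl) ok
    ... | ct , vt , dg = ct , vt , trans (dg P) (cong₂ _+_ (δ-refl P) cA)

    -- Two different degrees are within reach: two by taking the edge above with the single own
    -- edge, and at least three by merging the light branches. One of them differs from `d`.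
    node-free-merge : avail ks ≡ 1 → 1 ≤ ords ks → FreeT (node v is)
    node-free-merge a≡1 h P d 2≤d with d ≟ℕ 2
    ... | no d≢2 with node-up (≤-reflexive (sym a≡1)) P
    ... | ct , vt , dg = ct , vt , λ q → d≢2 (trans q (trans dg (cong suc a≡1)))
    node-free-merge a≡1 h P d 2≤d | yes refl
      with node-merge (subst (λ a → 2 ≤ a + ords ks) (sym a≡1) (s≤s h)) P
    ... | ct , vt , dg = ct , vt ,
      λ q → <⇒≢ (subst (λ a → 2 ≤ a + ords ks) (sym a≡1) (s≤s h)) (suc-injective (trans q dg))

  -- The branch is switched to the mode in which its edge is taken below. The vertex then takes
  -- nothing and has degree one in both colours.
  lone-flex-free : ∀ {v t d} → 2 ≤ d → UpT t d → FreeT (node v (br t []))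
  lone-flex-free 2≤d u P e 2≤e with pick P P P
  ... | X , X≢P , _ with u X
  ... | ct , vt , dg = node (br X ct []) , (vt , ne , tt) , ne′
    where
    ne : δ P X + (δ X X + 0) ≢ degT (δ X) ct X
    ne rewrite δ-≢ (≢-sym X≢P) | δ-refl X | dg = <⇒≢ 2≤d
    ne′ : e ≢ δ P P + (δ X P + 0)
    ne′ rewrite δ-refl P | δ-≢ X≢P = ≢-sym (<⇒≢ 2≤e)

  -- Degree two comes from `node-up`. If that is the forbidden value, all three edges get the colour
  -- `P` and the degree is three; this is where a loose cycle must allow equal colours.
  lone-loose-free : ∀ {v t ch} (l : ∀ P Q → LightAt (step t ch) P Q) → FreeT (node v (cyc t ch []))
  lone-loose-free l P d 2≤d with d ≟ℕ 2
  ... | no d≢2 with node-up (cyc (loose l) []) ≤-refl P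
  ... | ct , vt , dg = ct , vt , λ q → d≢2 (trans q dg)
  lone-loose-free l P d 2≤d | yes refl with l P P 3 (s≤s (s≤s z≤n))
  ... | cc , vc , dg = node (cyc P P cc []) ,
        (subst (λ d → VC d P P cc) (sym e3) vc , ne , tt) , ne′
    where
    e3 : δ P P + (δ P P + δ P P + 0) ≡ 3
    e3 rewrite δ-refl P = refl
    ne : δ P P + (δ P P + δ P P + 0) ≢ degC P P cc P
    ne rewrite e3 | dg = λ ()
    ne′ : 2 ≢ δ P P + (δ P P + δ P P + 0)
    ne′ rewrite e3 = λ ()

  forced-[] : ∀ {v} → ForcedT (node v []) 1
  forced-[] c (node []) vt rewrite δ-refl c = refl

  -- Different colours would leave the lower edge with degree one at both ends.
  forced-free : ∀ {v t} → ForcedT t 1 → ForcedT (node v (br t [])) 2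
  forced-free f c (node (br c′ ct [])) (vt , ne , tt) with c ≟ c′
  ... | yes refl rewrite δ-refl c = refl
  ... | no c≢c′ rewrite f c′ ct vt | δ-≢ c≢c′ | δ-refl c′ = ⊥-elim (ne refl)

  -- Equal colours would leave the lower edge with degree two at both ends.
  forced-light : ∀ {v t} → ForcedT t 2 → ForcedT (node v (br t [])) 1
  forced-light f c (node (br c′ ct [])) (vt , ne , tt) with c ≟ c′
  ... | yes refl rewrite f c ct vt | δ-refl c = ⊥-elim (ne refl)
  ... | no c≢c′ rewrite δ-refl c | δ-≢ (≢-sym c≢c′) = refl

  -- Excludes a monochromatic tight triangle whose vertices would need three distinct degrees among
  -- two and three.
  three-values : ∀ {W : Set} {a b d : ℕ} → a ≡ 2 ⊎ a ≡ 3 → b ≡ 2 ⊎ b ≡ 3 → d ≡ 2 ⊎ d ≡ 3 →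
    a ≢ b → d ≢ a → d ≢ b → W
  three-values (inj₁ refl) (inj₁ refl) _ p q r = ⊥-elim (p refl)
  three-values (inj₁ refl) (inj₂ refl) (inj₁ refl) p q r = ⊥-elim (q refl)
  three-values (inj₁ refl) (inj₂ refl) (inj₂ refl) p q r = ⊥-elim (r refl)
  three-values (inj₂ refl) (inj₁ refl) (inj₁ refl) p q r = ⊥-elim (r refl)
  three-values (inj₂ refl) (inj₁ refl) (inj₂ refl) p q r = ⊥-elim (q refl)
  three-values (inj₂ refl) (inj₂ refl) _ p q r = ⊥-elim (p refl)

  -- A tight triangle at a vertex with exactly one more edge, of colour u.
  tight-degree : ∀ {k t t₁} → Corner t → Corner t₁ → (u c c₀ : Fin k) (D : Fin k → ℕ) →
    (∀ x → D x ≡ δ u x + δ c x + δ c₀ x) →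
    (cc : ColC k (step t (base t₁))) → VC (D c₀) c₀ c cc → D c ≢ degC c₀ c cc c → D u ≡ 2
  tight-degree kt kt₁ u c c₀ D eD (step c₁ ct (base ct₁)) (vt , ne₁ , vt₁ , ne₀) ne
    with c ≟ c₁ | c₁ ≟ c₀
  ... | no c≢c₁ | no c₁≢c₀ =
    ⊥-elim (ne₁ (trans (proj₂ (proj₁ (kt c c₁ ct vt) c≢c₁)) (sym (proj₁ (proj₁ (kt₁ c₁ c₀ ct₁ vt₁) c₁≢c₀)))))
  -- The bottom edge has degree one at its lower end, so it needs a companion of its colour at the
  -- top vertex, and only the edge of colour `u` can be that.
  ... | yes refl | no c≢c₀ with u ≟ c₀
  ... | yes refl rewrite eD u | δ-refl u | δ-≢ c≢c₀ = refl
  ... | no u≢c₀ rewrite eD c₀ | δ-≢ u≢c₀ | δ-≢ c≢c₀ | δ-refl c₀ =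
    ⊥-elim (ne₀ (sym (proj₂ (proj₁ (kt₁ c c₀ ct₁ vt₁) c≢c₀))))
  tight-degree kt kt₁ u c c₀ D eD (step c₁ ct (base ct₁)) (vt , ne₁ , vt₁ , ne₀) ne
      | no c≢c₀ | yes refl with u ≟ c
  ... | yes refl rewrite eD u | δ-refl u | δ-≢ (≢-sym c≢c₀) = refl
  ... | no u≢c rewrite eD c | δ-≢ u≢c | δ-≢ (≢-sym c≢c₀) | δ-refl c =
    ⊥-elim (ne (sym (proj₁ (proj₁ (kt c c₀ ct vt) c≢c₀))))
  tight-degree kt kt₁ u c c₀ D eD (step c₁ ct (base ct₁)) (vt , ne₁ , vt₁ , ne₀) ne
      | yes refl | yes refl with u ≟ c
  ... | no u≢c = three-values (proj₂ (kt c c ct vt) refl) (proj₂ (kt₁ c c ct₁ vt₁) refl) (inj₁ Dc) ne₁ ne ne₀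
    where
    Dc : D c ≡ 2
    Dc rewrite eD c | δ-≢ u≢c | δ-refl c = refl
  ... | yes refl = three-values (proj₂ (kt c c ct vt) refl) (proj₂ (kt₁ c c ct₁ vt₁) refl) (inj₂ Dc) ne₁ ne ne₀
    where
    Dc : D c ≡ 3
    Dc rewrite eD c | δ-refl c = refl

  tight-forced : ∀ {v t t₁} → Corner t → Corner t₁ → ForcedT (node v (cyc t (base t₁) [])) 2
  tight-forced kt kt₁ u (node (cyc c c₀ cc [])) (vc , ne , tt) =
    tight-degree kt kt₁ u c c₀ _ (λ x → e (δ u x) (δ c x) (δ c₀ x)) cc vc ne
    where
    e : ∀ a b c → a + (b + c + 0) ≡ a + b + c
    e = solve-∀

  empty-items : ∀ {is ks} → ClassI is ks → avail ks ≡ 0 → ords ks ≡ 0 → is ≡ []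
  empty-items [] _ _ = refl
  empty-items (br (flex _ _ _ _) _) () _
  empty-items (br (pfree _ _) _) () _
  empty-items (br (plight _ _) _) _ ()
  empty-items (cyc (even _) _) () _
  empty-items (cyc (loose _) _) () _
  empty-items (cyc (tight _ _ _) _) () _

  data OneLight : Items → Set where
    one-light : ∀ {t} → UpT t 2 → ForcedT t 2 → OneLight (br t [])

  single-light : ∀ {is ks} → ClassI is ks → avail ks ≡ 0 → ords ks ≡ 1 → OneLight is
  single-light (br (plight u f) cs) a o with empty-items cs a (suc-injective o)
  ... | refl = one-light u f
  single-light (br (flex _ _ _ _) _) () _
  single-light (br (pfree _ _) _) () _
  single-light (cyc (even _) _) () _
  single-light (cyc (loose _) _) () _
  single-light (cyc (tight _ _ _) _) () _

  data OneAvail : Items → Set where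
    one-flex  : ∀ {t d} → FreeT t → 2 ≤ d → UpT t d → OneAvail (br t [])
    one-pfree : ∀ {t} → FreeT t → ForcedT t 1 → OneAvail (br t [])
    one-loose : ∀ {t ch} → (∀ P Q → LightAt (step t ch) P Q) → OneAvail (cyc t ch [])
    one-tight : ∀ {t t₁} → (∀ P Q → P ≢ Q → LightAt (step t (base t₁)) P Q) →
                Corner t → Corner t₁ → OneAvail (cyc t (base t₁) [])

  single-avail : ∀ {is ks} → ClassI is ks → avail ks ≡ 1 → ords ks ≡ 0 → OneAvail is
  single-avail (br (flex f d h u) cs) a o with empty-items cs (suc-injective a) o
  ... | refl = one-flex f h u
  single-avail (br (pfree f g) cs) a o with empty-items cs (suc-injective a) o
  ... | refl = one-pfree f g
  single-avail (br (plight _ _) _) _ ()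
  single-avail (cyc (even _) _) () _
  single-avail (cyc (loose l) cs) a o with empty-items cs (suc-injective a) o
  ... | refl = one-loose l
  single-avail (cyc (tight l k k₁) cs) a o with empty-items cs (suc-injective a) o
  ... | refl = one-tight l k k₁

  classify-one : ∀ {v is} → OneAvail is → ClassT (node v is)
  classify-one (one-flex f h u) =
    flex (lone-flex-free h u) 2 ≤-refl (node-up (br (flex f _ h u) []) ≤-refl)
  classify-one (one-pfree f g) = plight (node-up (br (pfree f g) []) ≤-refl) (forced-free g)
  classify-one (one-loose l) = flex (lone-loose-free l) 2 ≤-refl (node-up (cyc (loose l) []) ≤-refl)
  classify-one (one-tight l k k₁) = plight (node-up (cyc (tight l k k₁) []) ≤-refl) (tight-forced k k₁)

  -- Rigid classes arise only from counts that leave no choice: nothing taken and at most one light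
  -- branch, or one taken edge without a light branch. In the last case the single item decides.
  classify-node : ∀ {v is ks} → ClassI is ks → ClassT (node v is)
  classify-node {v} {is} {ks} cls with avail ks in ea | ords ks in eo
  ... | 0 | 0 with empty-items cls ea eo
  ... | refl = pfree (node-free cls (λ q → 0≢1+n (trans (sym ea) q))) forced-[]
  classify-node {v} {is} {ks} cls | 0 | 1 with single-light cls ea eo
  ... | one-light u f = pfree (node-free cls (λ q → 0≢1+n (trans (sym ea) q))) (forced-light f)
  classify-node {v} {is} {ks} cls | 0 | suc (suc o) =
    flex (node-free cls (λ q → 0≢1+n (trans (sym ea) q))) _ (s≤s (≤-trans (s≤s z≤n) h)) (node-merge cls h)
    where
    h : 2 ≤ avail ks + ords ks
    h rewrite ea | eo = s≤s (s≤s z≤n)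
  classify-node {v} {is} {ks} cls | 1 | 0 = classify-one (single-avail cls ea eo)
  classify-node {v} {is} {ks} cls | 1 | suc o =
    flex (node-free-merge cls ea (subst (1 ≤_) (sym eo) (s≤s z≤n))) _ (s≤s 1≤a) (node-up cls 1≤a)
    where
    1≤a : 1 ≤ avail ks
    1≤a rewrite ea = ≤-refl
  classify-node {v} {is} {ks} cls | suc (suc a) | _ =
    flex (node-free cls (λ q → h (trans (sym ea) q))) _ (s≤s 1≤a) (node-up cls 1≤a)
    where
    h : suc (suc a) ≢ 1
    h ()
    1≤a : 1 ≤ avail ks
    1≤a rewrite ea = s≤s z≤n

  -- Vertices of a cycle

  δ₂ : ∀ {k} → Fin k → Fin k → Fin k → ℕ
  δ₂ c c′ x = δ c x + δ c′ x

  module _ {v : V} {is : Items} {ks : List Kind} (cls : ClassI is ks) where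

    private
      two-in : ∀ {P Q : Fin 4} → P ≢ Q → (as : All Asg ks) → cntA as P ≡ 0 → cntA as Q ≡ 0 →
        Ok (λ x → δ₂ Q P x + cntA as x) as →
        Σ (ColT 4 (node v is)) λ ct → VT (δ₂ Q P) ct × degT (δ₂ Q P) ct P ≡ 1 × degT (δ₂ Q P) ct Q ≡ 1
      two-in {P} {Q} P≢Q as p q ok with solve {v = v} cls (δ₂ Q P) _ as (λ _ → refl) ok
      ... | ct , vt , dg = ct , vt , trans (dg P) dP , trans (dg Q) dQ
        where
        dP : δ₂ Q P P + cntA as P ≡ 1
        dP rewrite p | δ-refl P | δ-≢ (≢-sym P≢Q) = refl
        dQ : δ₂ Q P Q + cntA as Q ≡ 1
        dQ rewrite q | δ-refl Q | δ-≢ P≢Q = refl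

      close : ∀ {P Q d e} → 2 ≤ d → 2 ≤ e →
        (Σ (ColT 4 (node v is)) λ ct → VT (δ₂ Q P) ct × degT (δ₂ Q P) ct P ≡ 1 × degT (δ₂ Q P) ct Q ≡ 1) →
        Σ (ColC 4 (base (node v is))) λ cc → VC d P Q cc × e ≢ degC P Q cc Q
      close 2≤d 2≤e (ct , vt , p , q) = base ct , (vt , λ z → <⇒≢ 2≤d (sym (trans z p))) , λ z → <⇒≢ 2≤e (sym (trans z q))

      in-≡0 : ∀ {P Q X : Fin 4} → X ≢ P → X ≢ Q → δ₂ Q P X ≡ 0
      in-≡0 p q rewrite δ-≢ (≢-sym p) | δ-≢ (≢-sym q) = refl

      in-Q : ∀ {P Q : Fin 4} → P ≢ Q → δ₂ Q P Q ≡ 1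
      in-Q {P} {Q} p rewrite δ-≢ p | δ-refl Q = refl

    -- Here P and Q come in from above, and taking one colour for the edges taken and another
    -- for the light ones fails: the latter would have degree two.
    bow-tie : ks ≡ odd ∷ odd ∷ [] → ∀ {P Q} → P ≢ Q → FreeAt (base (node v is)) P Q
    bow-tie refl {P} {Q} P≢Q d e 2≤d 2≤e with pick P Q Q
    ... | X , X≢P , X≢Q , _ with pick P Q X
    ... | Y , Y≢P , Y≢Q , Y≢X = go (e ≟ℕ 3) (d ≟ℕ 3)
      where
      finish : (as : All Asg ks) → Ok (λ x → δ₂ Q P x + cntA as x) as →
        d ≢ δ₂ Q P P + cntA as P → e ≢ δ₂ Q P Q + cntA as Q →
        Σ (ColC 4 (base (node v is))) λ cc → VC d P Q cc × e ≢ degC P Q cc Q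
      finish as ok dP dQ with solve {v = v} cls (δ₂ Q P) _ as (λ _ → refl) ok
      ... | ct , vt , dg = base ct , (vt , λ z → dP (trans z (dg P))) , λ z → dQ (trans z (dg Q))
      go : Dec (e ≡ 3) → Dec (d ≡ 3) → Σ (ColC 4 (base (node v is))) λ cc → VC d P Q cc × e ≢ degC P Q cc Q
      -- Both taken edges have colour `Q`, of degree three; `P` keeps degree one.
      go (no e≢3) _ = finish as ok dP dQ
        where
        as : All Asg (odd ∷ odd ∷ [])
        as = oddA Q X ∷ oddA Q Y ∷ []
        ok : Ok (λ x → δ₂ Q P x + cntA as x) as
        ok rewrite δ-refl Q | δ-refl X | δ-refl Y | δ-≢ P≢Q | δ-≢ X≢Q | δ-≢ Y≢Q | δ-≢ (≢-sym X≢Q) | δ-≢ (≢-sym Y≢Q)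
             | δ-≢ (≢-sym X≢P) | δ-≢ (≢-sym Y≢P) | δ-≢ Y≢X | δ-≢ (≢-sym Y≢X) =
           (≢-sym X≢Q , s≤s (s≤s z≤n) , λ ()) , (≢-sym Y≢Q , s≤s (s≤s z≤n) , λ ()) , tt
        dP : d ≢ δ₂ Q P P + cntA as P
        dP rewrite δ-refl P | δ-≢ (≢-sym P≢Q) | δ-≢ X≢P | δ-≢ Y≢P = ≢-sym (<⇒≢ 2≤d)
        dQ : e ≢ δ₂ Q P Q + cntA as Q
        dQ rewrite δ-refl Q | δ-≢ P≢Q | δ-≢ X≢Q | δ-≢ Y≢Q = e≢3
      go (yes refl) (no d≢3) = finish as ok dP dQ
        where
        as : All Asg (odd ∷ odd ∷ [])
        as = oddA P X ∷ oddA P Y ∷ []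
        ok : Ok (λ x → δ₂ Q P x + cntA as x) as
        ok rewrite δ-refl P | δ-refl X | δ-refl Y | δ-≢ (≢-sym P≢Q) | δ-≢ X≢P | δ-≢ Y≢P | δ-≢ (≢-sym X≢Q) | δ-≢ (≢-sym Y≢Q)
             | δ-≢ (≢-sym X≢P) | δ-≢ (≢-sym Y≢P) | δ-≢ Y≢X | δ-≢ (≢-sym Y≢X) =
           (≢-sym X≢P , s≤s (s≤s z≤n) , λ ()) , (≢-sym Y≢P , s≤s (s≤s z≤n) , λ ()) , tt
        dP : d ≢ δ₂ Q P P + cntA as P
        dP rewrite δ-refl P | δ-≢ (≢-sym P≢Q) | δ-≢ X≢P | δ-≢ Y≢P = d≢3
        dQ : 3 ≢ δ₂ Q P Q + cntA as Q
        dQ rewrite δ-refl Q | δ-≢ P≢Q | δ-≢ X≢Q | δ-≢ Y≢Q = λ ()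
      -- Here each of `P` and `Q` takes one of the free edges: both have degree two, which is enough
      -- at this vertex and differs from three.
      go (yes refl) (yes refl) = finish as ok dP dQ
        where
        as : All Asg (odd ∷ odd ∷ [])
        as = oddA Q X ∷ oddA P Y ∷ []
        ok : Ok (λ x → δ₂ Q P x + cntA as x) as
        ok rewrite δ-refl P | δ-refl Q | δ-refl X | δ-refl Y | δ-≢ P≢Q | δ-≢ (≢-sym P≢Q) | δ-≢ X≢P | δ-≢ Y≢P
             | δ-≢ X≢Q | δ-≢ Y≢Q | δ-≢ (≢-sym X≢Q) | δ-≢ (≢-sym Y≢Q)
             | δ-≢ (≢-sym X≢P) | δ-≢ (≢-sym Y≢P) | δ-≢ Y≢X | δ-≢ (≢-sym Y≢X) =
           (≢-sym X≢Q , s≤s (s≤s z≤n) , λ ()) , (≢-sym Y≢P , s≤s (s≤s z≤n) , λ ()) , tt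
        dP : 3 ≢ δ₂ Q P P + cntA as P
        dP rewrite δ-refl P | δ-≢ (≢-sym P≢Q) | δ-≢ X≢P | δ-≢ Y≢P = λ ()
        dQ : 3 ≢ δ₂ Q P Q + cntA as Q
        dQ rewrite δ-refl Q | δ-≢ P≢Q | δ-≢ X≢Q | δ-≢ Y≢Q = λ ()

    -- In general both cycle edges are to keep degree one here. If edges are taken, they need a
    -- third colour and only one is left for light edges; hence merging when there are exactly two
    -- of these, and `bow-tie` when merging gives too small a degree.
    base-free : avail ks ≢ 1 → ∀ {P Q} → P ≢ Q → FreeAt (base (node v is)) P Q
    base-free a≢1 {P} {Q} P≢Q d e 2≤d 2≤e with avail ks in ea
    ... | 1 = ⊥-elim (a≢1 refl)
    ... | 0 with pick P Q Q
    ... | X , X≢P , X≢Q , _ with pick P Q X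
    ... | Y , Y≢P , Y≢Q , Y≢X
      -- As nothing is taken, `Q` serves nominally as the colour of the taken edges, and both
      -- remaining colours are available for light ones.
      with std-lights-≢ ks (δ₂ Q P) (≢-sym X≢Q) (≢-sym Y≢Q) (≢-sym Y≢X) (in-≡0 X≢P X≢Q) (in-≡0 Y≢P Y≢Q) (inj₁ ea)
    ... | Z , reach {as} ok cA off =
      close 2≤d 2≤e (two-in P≢Q as (off P (P≢Q , ≢-sym X≢P , ≢-sym Y≢P)) (trans cA ea) ok)
    base-free a≢1 {P} {Q} P≢Q d e 2≤d 2≤e | suc (suc a) with pick P Q Q
    ... | A , A≢P , A≢Q , _ with pick P Q A
    ... | X , X≢P , X≢Q , X≢A with lights ks ≟ℕ 2
    ... | no n≢2 with uni-lights ks (δ₂ Q P) (≢-sym X≢A) (in-≡0 X≢P X≢Q) n≢2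
                        (inj₂ (subst (λ z → 2 ≤ δ₂ Q P A + z) (sym ea) (≤-trans (s≤s (s≤s z≤n)) (m≤n+m _ (δ₂ Q P A)))))
    ... | reach {as} ok cA off =
      close 2≤d 2≤e (two-in P≢Q as (off P (≢-sym A≢P , ≢-sym X≢P)) (off Q (≢-sym A≢Q , ≢-sym X≢Q)) ok)
    base-free a≢1 {P} {Q} P≢Q d e 2≤d 2≤e | suc (suc a) | A , A≢P , A≢Q , _ | X , X≢P , X≢Q , X≢A | yes n≡2
      with 3 ≤? avail ks + ords ks
    ... | no h = bow-tie (two-odds ks n≡2 (subst (2 ≤_) (sym ea) (s≤s (s≤s z≤n))) (≤-pred (≰⇒> h))) P≢Q d e 2≤d 2≤e
    ... | yes h with merge-lights ks (δ₂ Q P) (≢-sym X≢A) (in-≡0 X≢P X≢Q) (≤-trans h (m≤n+m _ (δ₂ Q P A)))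
    ... | as , reach ok cA off =
      close 2≤d 2≤e (two-in P≢Q as (off P (≢-sym A≢P , ≢-sym X≢P)) (off Q (≢-sym A≢Q , ≢-sym X≢Q)) ok)

    base-light : avail ks ≡ 1 → ∀ {P Q} → P ≢ Q → LightAt (base (node v is)) P Q
    base-light a≡1 {P} {Q} P≢Q d 2≤d with pick P Q Q
    ... | X , X≢P , X≢Q , _ with pick P Q X
    ... | Y , Y≢P , Y≢Q , Y≢X
      with std-lights-≢ ks (δ₂ Q P) (≢-sym X≢Q) (≢-sym Y≢Q) (≢-sym Y≢X) (in-≡0 X≢P X≢Q) (in-≡0 Y≢P Y≢Q)
             (inj₂ (≤-reflexive (sym (cong₂ _+_ (in-Q P≢Q) a≡1))))
    ... | Z , reach {as} ok cA off with solve {v = v} cls (δ₂ Q P) _ as (λ _ → refl) ok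
    ... | ct , vt , dg =
      base ct , (vt , λ z → <⇒≢ 2≤d (sym (trans z (trans (dg P) dP)))) ,
      trans (dg Q) (cong₂ _+_ (in-Q P≢Q) (trans cA a≡1))
      where
      dP : δ₂ Q P P + cntA as P ≡ 1
      dP rewrite off P (P≢Q , ≢-sym X≢P , ≢-sym Y≢P) | δ-refl P | δ-≢ (≢-sym P≢Q) = refl

    -- For triangles: this corner takes the edge of colour `B` to the other corner together with
    -- edges of its own, while its other cycle edge keeps degree one.
    corner-heavy : 2 ≤ avail ks ⊎ (avail ks ≡ 0 × 2 ≤ ords ks) → ∀ {P B} → P ≢ B →
      Σ (ColT 4 (node v is)) λ ct → VT (δ₂ B P) ct × degT (δ₂ B P) ct P ≡ 1 × 2 ≤ degT (δ₂ B P) ct B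
    corner-heavy h {P} {B} P≢B with pick P B B
    ... | X , X≢P , X≢B , _ = go h
      where
      fin : (as : All Asg ks) → cntA as P ≡ 0 → 1 ≤ cntA as B → Ok (λ x → δ₂ B P x + cntA as x) as →
        Σ (ColT 4 (node v is)) λ ct → VT (δ₂ B P) ct × degT (δ₂ B P) ct P ≡ 1 × 2 ≤ degT (δ₂ B P) ct B
      fin as p b ok with solve {v = v} cls (δ₂ B P) _ as (λ _ → refl) ok
      ... | ct , vt , dg = ct , vt , trans (dg P) dP , subst (2 ≤_) (sym (dg B)) dB
        where
        dP : δ₂ B P P + cntA as P ≡ 1
        dP rewrite p | δ-refl P | δ-≢ (≢-sym P≢B) = refl
        dB : 2 ≤ δ₂ B P B + cntA as B
        dB rewrite in-Q P≢B = s≤s b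
      go : 2 ≤ avail ks ⊎ (avail ks ≡ 0 × 2 ≤ ords ks) →
        Σ (ColT 4 (node v is)) λ ct → VT (δ₂ B P) ct × degT (δ₂ B P) ct P ≡ 1 × 2 ≤ degT (δ₂ B P) ct B
      go (inj₁ 2≤a) with pick P B X
      ... | Y , Y≢P , Y≢B , Y≢X
        with std-lights-≢ ks (δ₂ B P) (≢-sym X≢B) (≢-sym Y≢B) (≢-sym Y≢X) (in-≡0 X≢P X≢B) (in-≡0 Y≢P Y≢B)
               (inj₂ (≤-trans 2≤a (m≤n+m _ (δ₂ B P B))))
      ... | Z , reach {as} ok cA off =
        fin as (off P (P≢B , ≢-sym X≢P , ≢-sym Y≢P)) (≤-trans (s≤s z≤n) (subst (2 ≤_) (sym cA) 2≤a)) ok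
      go (inj₂ (a≡0 , 2≤o))
        with merge-lights ks (δ₂ B P) (≢-sym X≢B) (in-≡0 X≢P X≢B)
               (+-mono-≤ (≤-reflexive (sym (in-Q P≢B))) (≤-trans 2≤o (m≤n+m _ (avail ks))))
      ... | as , reach ok cA off =
        fin as (off P (P≢B , ≢-sym X≢P)) (subst (1 ≤_) (sym cA) (≤-trans (≤-trans (s≤s z≤n) 2≤o) (m≤n+m _ (avail ks)))) ok

    private
      assoc-in : ∀ (c q : Fin 4) (n : ℕ) x → δ c x + (δ q x + n) ≡ δ₂ c q x + n
      assoc-in c q n x = sym (+-assoc (δ c x) (δ q x) n)

      step-col : ∀ {ch} P Q q d (as : All Asg ks) (D : Fin 4 → ℕ) →
        (∀ x → D x ≡ δ Q x + (δ q x + cntA as x)) → Ok D as →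
        (Σ (ColC 4 ch) λ cc → VC d P q cc × D q ≢ degC P q cc q) →
        Σ (ColC 4 (step (node v is) ch)) λ cc → VC d P Q cc × degC P Q cc Q ≡ D Q
      step-col P Q q d as D e ok (cc , vc , ne)
        with solve {v = v} cls (δ₂ Q q) D as (λ x → trans (e x) (assoc-in Q q (cntA as x) x)) ok
      ... | ct , vt , dg = step q ct cc , (vt , (λ z → ne (trans (sym (dg q)) z)) , vc) , dg Q

    -- The edge to the next vertex of the cycle is treated as one more branch, hence `free ∷ ks`
    -- inside. Its colour `A` avoids `P`, as the chain below may require, and `Q`, whose degree
    -- stays one.
    step-free-over-free : ∀ {ch} → (∀ {P Q} → P ≢ Q → FreeAt ch P Q) → avail ks ≢ 0 →
      ∀ {P Q} → FreeAt (step (node v is) ch) P Q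
    step-free-over-free f a≢0 {P} {Q} d e 2≤d 2≤e with pick P Q Q
    ... | A , A≢P , A≢Q , _ with pick Q A A
    ... | X , X≢Q , X≢A , _ with pick Q A X
    ... | Y , Y≢Q , Y≢A , Y≢X
      with std-lights-≢ (free ∷ ks) (δ Q) (≢-sym X≢A) (≢-sym Y≢A) (≢-sym Y≢X) (δ-≢ (≢-sym X≢Q)) (δ-≢ (≢-sym Y≢Q))
             (inj₂ (≤-trans (s≤s (n≢0⇒n>0 a≢0)) (m≤n+m _ (δ Q A))))
    ... | Z , reach (2≤DA , ok) cA off
      with step-col P Q A d (std A X Z ks) _ (λ _ → refl) ok (f (≢-sym A≢P) d _ 2≤d 2≤DA)
    ... | cc , vc , dg = cc , vc , λ z → <⇒≢ 2≤e (sym (trans z (trans dg D≡1)))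
      where
      D≡1 : δ Q Q + cntA (freeA A ∷ std A X Z ks) Q ≡ 1
      D≡1 = cong₂ _+_ (δ-refl Q) (off Q (≢-sym A≢Q , ≢-sym X≢Q , ≢-sym Y≢Q))

    step-free-over-light : ∀ {ch} → (∀ {P Q} → P ≢ Q → LightAt ch P Q) → avail ks ≢ 1 →
      ∀ {P Q} → FreeAt (step (node v is) ch) P Q
    step-free-over-light f a≢1 {P} {Q} d e 2≤d 2≤e with pick P Q Q
    ... | X , X≢P , X≢Q , _ with pick Q X X
    ... | A , A≢Q , A≢X , _ with pick Q X A
    ... | Y , Y≢Q , Y≢X , Y≢A
      with std-lights-≢ (light ∷ ks) (δ Q) A≢X (≢-sym Y≢A) (≢-sym Y≢X) (δ-≢ (≢-sym X≢Q)) (δ-≢ (≢-sym Y≢Q)) en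
      where
      en : Enough (light ∷ ks) (δ Q A + avail ks)
      en with avail ks
      ... | 0 = inj₁ refl
      ... | 1 = ⊥-elim (a≢1 refl)
      ... | suc (suc a) = inj₂ (≤-trans (s≤s (s≤s z≤n)) (m≤n+m (suc (suc a)) (δ Q A)))
    ... | Z , reach (DX≢2 , ok) cA off with f (≢-sym X≢P) d 2≤d
    ... | cc′ , vc′ , d2
      with step-col P Q X d (uni A Z ks) _ (λ _ → refl) ok (cc′ , vc′ , λ z → DX≢2 (trans z d2))
    ... | cc , vc , dg = cc , vc , λ z → <⇒≢ 2≤e (sym (trans z (trans dg D≡1)))
      where
      D≡1 : δ Q Q + cntA (lightA X ∷ uni A Z ks) Q ≡ 1
      D≡1 = cong₂ _+_ (δ-refl Q) (off Q (≢-sym A≢Q , ≢-sym X≢Q , ≢-sym Y≢Q))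

    -- The edge below would be the only taken one, so the edge above joins it in the colour `Q`.
    -- Since `Q` is passed on unchanged, a condition `P ≢ Q` on the chain survives; this is what
    -- singles out triangles.
    step-light-over-free : ∀ {ch P Q} → FreeAt ch P Q → avail ks ≡ 0 → LightAt (step (node v is) ch) P Q
    step-light-over-free {ch} {P} {Q} f a≡0 d 2≤d with pick Q Q Q
    ... | X , X≢Q , _ with pick Q X X
    ... | Y , Y≢Q , Y≢X , _
      with std-lights-≢ (free ∷ ks) (δ Q) (≢-sym X≢Q) (≢-sym Y≢Q) (≢-sym Y≢X) (δ-≢ (≢-sym X≢Q)) (δ-≢ (≢-sym Y≢Q))
             (inj₂ (subst (λ z → 2 ≤ z + suc (avail ks)) (sym (δ-refl Q)) (s≤s (s≤s z≤n))))
    ... | Z , reach (2≤DQ , ok) cA off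
      with step-col P Q Q d (std Q X Z ks) _ (λ _ → refl) ok (f d _ 2≤d 2≤DQ)
    ... | cc , vc , dg = cc , vc , trans dg (cong₂ _+_ (δ-refl Q) (trans cA (cong suc a≡0)))

    step-light-over-light : ∀ {ch} → (∀ {P Q} → P ≢ Q → LightAt ch P Q) → avail ks ≡ 1 →
      ∀ {P Q} → LightAt (step (node v is) ch) P Q
    step-light-over-light f a≡1 {P} {Q} d 2≤d with pick P Q Q
    ... | X , X≢P , X≢Q , _ with pick Q X X
    ... | Y , Y≢Q , Y≢X , _
      with std-lights-≢ (light ∷ ks) (δ Q) (≢-sym X≢Q) (≢-sym Y≢Q) (≢-sym Y≢X) (δ-≢ (≢-sym X≢Q)) (δ-≢ (≢-sym Y≢Q))
             (inj₂ (≤-reflexive (sym (cong₂ _+_ (δ-refl Q) a≡1))))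
    ... | Z , reach (DX≢2 , ok) cA off with f (≢-sym X≢P) d 2≤d
    ... | cc′ , vc′ , d2
      with step-col P Q X d (uni Q Z ks) _ (λ _ → refl) ok (cc′ , vc′ , λ z → DX≢2 (trans z d2))
    ... | cc , vc , dg = cc , vc , trans dg (cong₂ _+_ (δ-refl Q) (trans cA a≡1))

  -- Only a single vertex needs distinct colours in order to be free: on longer chains the first
  -- vertex chooses a colour other than `P`. For light chains distinct colours are all that the next
  -- step asks for.
  data ClassCh : Chain → Set where
    free-base : ∀ {t} → (∀ {P Q} → P ≢ Q → FreeAt (base t) P Q) → ClassCh (base t)
    free-step : ∀ {t ch} → (∀ {P Q} → FreeAt (step t ch) P Q) → ClassCh (step t ch)
    light     : ∀ {ch} → (∀ {P Q} → P ≢ Q → LightAt ch P Q) → ClassCh ch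

  corner-[] : ∀ {v} → Corner (node v [])
  corner-[] {v} {k} c c′ (node []) _ = distinct-colours , same
    where
    distinct-colours : c ≢ c′ → δ c c + δ c′ c + 0 ≡ 1 × δ c c′ + δ c′ c′ + 0 ≡ 1
    distinct-colours ne rewrite δ-refl c | δ-refl c′ | δ-≢ ne | δ-≢ (≢-sym ne) = refl , refl
    same : c ≡ c′ → δ c c + δ c′ c + 0 ≡ 2 ⊎ δ c c + δ c′ c + 0 ≡ 3
    same refl rewrite δ-refl c = inj₁ refl

  -- If the cycle edges differ in colour, a branch sharing one of these colours would have degree
  -- two at both ends. If they agree, sharing their colour gives three and not sharing it gives two.
  corner-light : ∀ {v t} → ForcedT t 2 → Corner (node v (br t []))
  corner-light f {k} c c′ (node (br x ct [])) (vt , ne , tt) = distinct-colours , same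
    where
    D : Fin k → ℕ
    D y = δ c y + δ c′ y + (δ x y + 0)
    D≢2 : D x ≢ 2
    D≢2 q = ne (trans q (sym (f x ct vt)))
    distinct-colours : c ≢ c′ → D c ≡ 1 × D c′ ≡ 1
    distinct-colours c≢c′ = left , right
      where
      left : D c ≡ 1
      left with x ≟ c
      ... | yes refl = ⊥-elim (D≢2 two)
        where
        two : D x ≡ 2
        two rewrite δ-refl x | δ-≢ (≢-sym c≢c′) = refl
      ... | no x≢c rewrite δ-refl c | δ-≢ (≢-sym c≢c′) | δ-≢ x≢c = refl
      right : D c′ ≡ 1
      right with x ≟ c′
      ... | yes refl = ⊥-elim (D≢2 two)
        where
        two : D x ≡ 2
        two rewrite δ-refl x | δ-≢ c≢c′ = refl
      ... | no x≢c′ rewrite δ-refl c′ | δ-≢ c≢c′ | δ-≢ x≢c′ = refl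
    same : c ≡ c′ → D c ≡ 2 ⊎ D c ≡ 3
    same refl with x ≟ c
    ... | yes refl rewrite δ-refl c = inj₂ refl
    ... | no x≢c rewrite δ-refl c | δ-≢ x≢c = inj₁ refl

  corner : ∀ {v is ks} → ClassI is ks → avail ks ≡ 0 → ords ks ≤ 1 → Corner (node v is)
  corner {ks = ks} cls a o with ords ks in eo
  ... | 0 with empty-items cls a eo
  ... | refl = corner-[]
  corner {ks = ks} cls a o | 1 with single-light cls a eo
  ... | one-light u f = corner-light f
  corner {ks = ks} cls a (s≤s ()) | suc (suc _)

  classify-base : ∀ {v is ks} → ClassI is ks → ClassCh (base (node v is))
  classify-base {ks = ks} cls with avail ks ≟ℕ 1
  ... | yes a≡1 = light (base-light cls a≡1)
  ... | no a≢1 = free-base (base-free cls a≢1)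

  classify-step : ∀ {v is ks ch} → ClassI is ks → ClassCh ch → ClassCh (step (node v is) ch)
  classify-step {ks = ks} cls (light l) with avail ks ≟ℕ 1
  ... | yes a≡1 = light (λ _ → step-light-over-light cls l a≡1)
  ... | no a≢1 = free-step (step-free-over-light cls l a≢1)
  classify-step {ks = ks} cls (free-base f) with avail ks ≟ℕ 0
  ... | yes a≡0 = light (λ P≢Q → step-light-over-free cls (f P≢Q) a≡0)
  ... | no a≢0 = free-step (step-free-over-free cls f a≢0)
  classify-step {ks = ks} cls (free-step f) with avail ks ≟ℕ 0
  ... | yes a≡0 = light (λ P≢Q → step-light-over-free cls f a≡0)
  ... | no a≢0 = free-step (step-free-over-free cls (λ _ → f) a≢0)

  Heavy : List Kind → Set
  Heavy ks = 2 ≤ avail ks ⊎ (avail ks ≡ 0 × 2 ≤ ords ks)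

  module _ {v w : V} {is js : Items} {ks ls : List Kind} (cls : ClassI is ks) (cls₁ : ClassI js ls) where

    private
      t t₁ : Tree
      t = node v is
      t₁ = node w js

    -- The edge between the corners is taken at the lower one, so the upper corner can be treated
    -- like a bottom vertex and both edges at the vertex above are free. This turns a triangle that
    -- would count as odd into an even one.
    heavy-bottom : avail ks ≢ 1 → Heavy ls → PairC t (base t₁)
    heavy-bottom a≢1 h A d 2≤d with pick A A A
    ... | B , B≢A , _ with corner-heavy {v = w} cls₁ h (≢-sym B≢A)
    ... | ct₁ , vt₁ , dA , 2≤dB with base-free {v = v} cls a≢1 B≢A _ d 2≤dB 2≤d
    ... | base ct , (vt , ne) , ne′ =
      step B ct (base ct₁) ,
      (vt , ≢-sym ne , vt₁ , λ z → <⇒≢ 2≤d (sym (trans z dA))) , ne′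

    heavy-top : avail ls ≢ 1 → Heavy ks → PairC t (base t₁)
    heavy-top a≢1 h A d 2≤d with pick A A A
    ... | B , B≢A , _ with corner-heavy {v = v} cls h (≢-sym B≢A)
    ... | ct , vt , dA , 2≤dB with base-free {v = w} cls₁ a≢1 (≢-sym B≢A) d _ 2≤d 2≤dB
    ... | base ct₁ , (vt₁ , ne) , ne′ =
      step B ct (base ct₁) ,
      (VT-ext comm ct vt , (λ z → ne′ (trans (degT-ext comm ct B) z)) , vt₁ , ne) ,
      λ z → <⇒≢ 2≤d (sym (trans z (trans (sym (degT-ext comm ct A)) dA)))
      where
      comm : ∀ x → δ₂ B A x ≡ δ₂ A B x
      comm x = +-comm (δ B x) (δ A x)

    -- A triangle obtained from `step-light-over-free` excludes equal colours at its top vertex. It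
    -- becomes even if one of its corners is heavy; otherwise both corners are poor enough for
    -- `Corner`.
    classify-triangle : ClassC t (base t₁)
    classify-triangle with avail ls in el
    ... | 1 = go (avail ks ≟ℕ 1)
      where
      go : Dec (avail ks ≡ 1) → ClassC t (base t₁)
      go (yes a≡1) = loose (λ P Q → step-light-over-light cls (base-light cls₁ el) a≡1)
      go (no a≢1) = even (λ A d 2≤d → step-free-over-light cls (base-light cls₁ el) a≢1 d d 2≤d 2≤d)
    ... | suc (suc l) = go (avail ks ≟ℕ 0)
      where
      l≢1 : avail ls ≢ 1
      l≢1 q with trans (sym el) q
      ... | ()
      go : Dec (avail ks ≡ 0) → ClassC t (base t₁)
      go (no a≢0) = even (λ A d 2≤d → step-free-over-free cls (base-free cls₁ l≢1) a≢0 d d 2≤d 2≤d)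
      go (yes a≡0) = even (heavy-bottom (λ q → 0≢1+n (trans (sym a≡0) q)) (inj₁ (subst (2 ≤_) (sym el) (s≤s (s≤s z≤n)))))
    ... | 0 = go (avail ks ≟ℕ 0)
      where
      l≢1 : avail ls ≢ 1
      l≢1 q = 0≢1+n (trans (sym el) q)
      go : Dec (avail ks ≡ 0) → ClassC t (base t₁)
      go (no a≢0) = even (λ A d 2≤d → step-free-over-free cls (base-free cls₁ l≢1) a≢0 d d 2≤d 2≤d)
      go (yes a≡0) with 2 ≤? ords ls | 2 ≤? ords ks
      ... | yes h | _ = even (heavy-bottom (λ q → 0≢1+n (trans (sym a≡0) q)) (inj₂ (el , h)))
      ... | no _ | yes h = even (heavy-top l≢1 (inj₂ (a≡0 , h)))
      ... | no h₁ | no h =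
        tight (λ P Q P≢Q → step-light-over-free cls (base-free cls₁ l≢1 P≢Q) a≡0)
          (corner cls a≡0 (≤-pred (≰⇒> h))) (corner cls₁ el (≤-pred (≰⇒> h₁)))

  -- From length four on there is a vertex between top and bottom of the chain to change the colour,
  -- so odd cycles are loose.
  classify-long : ∀ {v is ks t ch} → ClassI is ks → ClassCh (step t ch) → ClassC (node v is) (step t ch)
  classify-long {ks = ks} cls (light l) with avail ks ≟ℕ 1
  ... | yes a≡1 = loose (λ P Q → step-light-over-light cls l a≡1)
  ... | no a≢1 = even (λ A d 2≤d → step-free-over-light cls l a≢1 d d 2≤d 2≤d)
  classify-long {ks = ks} cls (free-step f) with avail ks ≟ℕ 0
  ... | yes a≡0 = loose (λ P Q → step-light-over-free cls f a≡0)
  ... | no a≢0 = even (λ A d 2≤d → step-free-over-free cls (λ _ → f) a≢0 d d 2≤d 2≤d)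

  mutual
    classify-items : ∀ is → ∃ λ ks → ClassI is ks
    classify-items [] = [] , []
    classify-items (br t is) = _ , br (classify-tree t) (proj₂ (classify-items is))
    classify-items (cyc (node v is) (base (node w js)) ks) =
      _ , cyc (classify-triangle (proj₂ (classify-items is)) (proj₂ (classify-items js))) (proj₂ (classify-items ks))
    classify-items (cyc (node v is) (step t ch) ks) =
      _ , cyc (classify-long (proj₂ (classify-items is)) (classify-chain (step t ch))) (proj₂ (classify-items ks))

    classify-tree : ∀ t → ClassT t
    classify-tree (node v is) = classify-node (proj₂ (classify-items is))

    classify-chain : ∀ ch → ClassCh ch
    classify-chain (base (node v is)) = classify-base (proj₂ (classify-items is))
    classify-chain (step (node v is) ch) = classify-step (proj₂ (classify-items is)) (classify-chain ch)

  -- The root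

  data Bare : Tree → Set where
    bare : ∀ {v} → Bare (node v [])

  data BareC : Chain → Set where
    base : ∀ {t} → Bare t → BareC (base t)
    step : ∀ {t ch} → Bare t → BareC ch → BareC (step t ch)

  bottomDeg : ∀ {k ch} → Fin k → Fin k → ColC k ch → ℕ
  bottomDeg c₀ c (base ct) = degT (δ₂ c c₀) ct c₀
  bottomDeg c₀ c (step c′ _ cc) = bottomDeg c₀ c′ cc

  VC-bottom : ∀ {k ch d} (c₀ c : Fin k) (cc : ColC k ch) → VC d c₀ c cc → d ≢ bottomDeg c₀ c cc
  VC-bottom c₀ c (base ct) (_ , ne) = ne
  VC-bottom c₀ c (step c′ _ cc) (_ , _ , vc) = VC-bottom c₀ c′ cc vc

  OneTwo : ℕ → Set
  OneTwo d = d ≡ 1 ⊎ d ≡ 2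

  δ-01 : ∀ {k} (c x : Fin k) → δ c x ≡ 0 ⊎ δ c x ≡ 1
  δ-01 c x with c ≟ x
  ... | yes refl = inj₂ (δ-refl c)
  ... | no ne = inj₁ (δ-≢ ne)

  -- A vertex with just two edges shows the same degree in the colours of both: one if the colours
  -- differ, two if they agree.
  meet : ∀ {k} (c c′ : Fin k) → δ₂ c c′ c′ + 0 ≡ δ₂ c c′ c + 0 × OneTwo (δ₂ c c′ c + 0)
  meet c c′ rewrite δ-refl c | δ-refl c′ | δ-sym c c′ with δ-01 c′ c
  ... | inj₁ e rewrite e = refl , inj₁ refl
  ... | inj₂ e rewrite e = refl , inj₂ refl

  -- Along a bare path the degrees one and two alternate, so these are the cases of an odd and of an
  -- even number of vertices.
  Same Diff : Chain → Set
  Same ch = ∀ {k d} (c₀ c : Fin k) (cc : ColC k ch) → VC d c₀ c cc →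
    OneTwo (degC c₀ c cc c) × bottomDeg c₀ c cc ≡ degC c₀ c cc c
  Diff ch = ∀ {k d} (c₀ c : Fin k) (cc : ColC k ch) → VC d c₀ c cc →
    OneTwo (degC c₀ c cc c) × OneTwo (bottomDeg c₀ c cc) × bottomDeg c₀ c cc ≢ degC c₀ c cc c

  one-two : ∀ {a b c} → OneTwo a → OneTwo b → OneTwo c → a ≢ b → a ≢ c → b ≡ c
  one-two (inj₁ refl) (inj₁ refl) _ p q = ⊥-elim (p refl)
  one-two (inj₁ refl) (inj₂ refl) (inj₁ refl) p q = ⊥-elim (q refl)
  one-two (inj₁ refl) (inj₂ refl) (inj₂ refl) p q = refl
  one-two (inj₂ refl) (inj₁ refl) (inj₁ refl) p q = refl
  one-two (inj₂ refl) (inj₁ refl) (inj₂ refl) p q = ⊥-elim (q refl)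
  one-two (inj₂ refl) (inj₂ refl) _ p q = ⊥-elim (p refl)

  same-step : ∀ {t ch} → Bare t → Same ch → Diff (step t ch)
  same-step bare s c₀ c (step c′ (node []) cc) (vt , ne , vc) with s c₀ c′ cc vc | meet c c′
  ... | o , e | m , o′ = o′ , subst OneTwo (sym e) o , λ z → ne (trans m (trans (sym z) e))

  diff-step : ∀ {t ch} → Bare t → Diff ch → Same (step t ch)
  diff-step bare s c₀ c (step c′ (node []) cc) (vt , ne , vc) with s c₀ c′ cc vc | meet c c′
  ... | o , o₀ , e | m , o′ = o′ , one-two o o₀ o′ (≢-sym e) (λ z → ne (trans m (sym z)))

  data Parity (ch : Chain) : Set where
    odd-chain  : (∀ {P Q} → P ≢ Q → FreeAt ch P Q) → Same ch → Parity ch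
    even-chain : (∀ {P Q} → P ≢ Q → LightAt ch P Q) → Diff ch → Parity ch

  parity : ∀ {ch} → BareC ch → Parity ch
  parity (base (bare {v})) =
    odd-chain (base-free {v = v} [] (λ ())) λ { c₀ c (base (node [])) _ → proj₂ (meet c c₀) , proj₁ (meet c c₀) }
  parity (step (bare {v}) b) with parity b
  ... | odd-chain f s = even-chain (λ P≢Q → step-light-over-free [] (f P≢Q) refl) (same-step bare s)
  ... | even-chain l s = odd-chain (λ _ → step-free-over-light [] l (λ ())) (diff-step bare s)

  none : ∀ {k} → Fin k → ℕ
  none _ = 0

  Colourable₀ : ℕ → Tree → Set
  Colourable₀ k t = Σ (ColT k t) (VT none)

  -- The alternation of degrees closes up only around a cycle of even length, and there the general
  -- construction for a free chain applies.
  bare-cycle : ∀ {v t ch k} → Bare t → BareC ch → Colourable₀ k (node v (cyc t ch [])) →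
    Colourable₀ 4 (node v (cyc t ch []))
  bare-cycle b bs (node (cyc c c₀ cc []) , vc , ne , tt) with parity bs
  bare-cycle {v} (bare {u}) bs _ | even-chain l s
    with step-free-over-light {v = u} [] l (λ ()) {zero} {zero} 2 2 ≤-refl ≤-refl
  ... | cc′ , vc′ , ne′ = node (cyc zero zero cc′ []) , subst (λ d → VC d zero zero cc′) (sym e) vc′ ,
        (λ z → ne′ (trans (sym e) z)) , tt
    where
    e : δ {4} zero zero + δ {4} zero zero + 0 ≡ 2
    e rewrite δ-refl {4} zero = refl
  bare-cycle b bs (node (cyc c c₀ cc []) , vc , ne , tt) | odd-chain f s
    with same-step b s c₀ c cc vc | meet c c₀
  ... | o , o₀ , e | m , o′ =
    ⊥-elim (e (one-two o′ o₀ o (λ z → VC-bottom c₀ c cc vc (trans m z)) ne))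

  colour-node : ∀ {v is ks} → ClassI is ks → (as : All Asg ks) → Ok (cntA as) as → Colourable₀ 4 (node v is)
  colour-node {v} cls as ok with solve {v = v} cls none _ as (λ _ → refl) ok
  ... | ct , vt , _ = ct , vt

  colour-avail : ∀ {v is ks} → ClassI is ks → avail ks ≢ 1 → Colourable₀ 4 (node v is)
  colour-avail {ks = ks} cls a≢1
    with std-lights-≢ ks {zero} {suc zero} {suc (suc zero)} none (λ ()) (λ ()) (λ ()) refl refl en
    where
    en : Enough ks (avail ks)
    en with avail ks
    ... | 0 = inj₁ refl
    ... | 1 = ⊥-elim (a≢1 refl)
    ... | suc (suc a) = inj₂ (s≤s (s≤s z≤n))
  ... | Z , reach ok _ _ = colour-node cls _ ok

  colour-merge : ∀ {v is ks} → ClassI is ks → 3 ≤ avail ks + ords ks → Colourable₀ 4 (node v is)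
  colour-merge {ks = ks} cls h with merge-lights ks {zero} {suc zero} none (λ ()) refl h
  ... | as , reach ok _ _ = colour-node cls as ok

  data AvailLight : Items → Set where
    light-first : ∀ {t is} → UpT t 2 → ForcedT t 2 → OneAvail is → AvailLight (br t is)
    flex-light  : ∀ {t d is} → FreeT t → 2 ≤ d → UpT t d → OneLight is → AvailLight (br t is)
    pfree-light : ∀ {t is} → FreeT t → ForcedT t 1 → OneLight is → AvailLight (br t is)
    loose-light : ∀ {t ch is} → (∀ P Q → LightAt (step t ch) P Q) → OneLight is → AvailLight (cyc t ch is)
    tight-light : ∀ {t t₁ is} → Corner t → Corner t₁ → OneLight is → AvailLight (cyc t (base t₁) is)

  avail-light : ∀ {is ks} → ClassI is ks → avail ks ≡ 1 → ords ks ≡ 1 → AvailLight is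
  avail-light (br (flex f d h u) cs) a o = flex-light f h u (single-light cs (suc-injective a) o)
  avail-light (br (pfree f g) cs) a o = pfree-light f g (single-light cs (suc-injective a) o)
  avail-light (br (plight u f) cs) a o = light-first u f (single-avail cs a (suc-injective o))
  avail-light (cyc (even _) cs) () o
  avail-light (cyc (loose l) cs) a o = loose-light l (single-light cs (suc-injective a) o)
  avail-light (cyc (tight l k k₁) cs) a o = tight-light k k₁ (single-light cs (suc-injective a) o)

  private
    ab : ∀ a b → a + (b + 0) ≡ b + (a + 0)
    ab = solve-∀
    abc : ∀ a b c → a + (b + c + 0) ≡ b + c + (a + 0)
    abc = solve-∀

  swap-br : ∀ {k v t t′} → Colourable₀ k (node v (br t (br t′ []))) → Colourable₀ k (node v (br t′ (br t [])))
  swap-br (node (br c ct (br c′ ct′ [])) , v , ne , v′ , ne′ , tt) =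
    node (br c′ ct′ (br c ct [])) ,
    v′ , (λ z → ne′ (trans (ab (δ c c′) (δ c′ c′)) z)) , v , (λ z → ne (trans (ab (δ c c) (δ c′ c)) z)) , tt

  cyc-br : ∀ {k v t t′ ch} → Colourable₀ k (node v (cyc t′ ch (br t []))) → Colourable₀ k (node v (br t (cyc t′ ch [])))
  cyc-br (node (cyc d d₀ cc (br c ct [])) , vc , ne′ , v , ne , tt) =
    node (br c ct (cyc d d₀ cc [])) ,
    v , (λ z → ne (trans (sym (abc (δ c c) (δ d c) (δ d₀ c))) z)) ,
    subst (λ z → VC z d₀ d cc) (sym (abc (δ c d₀) (δ d d₀) (δ d₀ d₀))) vc ,
    (λ z → ne′ (trans (sym (abc (δ c d) (δ d d) (δ d₀ d))) z)) , tt

  -- The root takes nothing: in two different colours it has degree one, and both branches offer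
  -- degree at least two.
  flex-and-light : ∀ {v t t′ d} → 2 ≤ d → UpT t d → UpT t′ 2 → Colourable₀ 4 (node v (br t (br t′ [])))
  flex-and-light 2≤d u u′ with u zero | u′ (suc zero)
  ... | ct , vt , e | ct′ , vt′ , e′ =
    node (br zero ct (br (suc zero) ct′ [])) ,
    vt , (λ z → <⇒≢ 2≤d (trans (trans (sym d0) z) e)) ,
    vt′ , (λ z → 1≢2 (trans (trans (sym d1) z) e′)) , tt
    where
    1≢2 : 1 ≢ 2
    1≢2 ()
    d0 : δ {4} zero zero + (δ {4} (suc zero) zero + 0) ≡ 1
    d0 rewrite δ-refl {4} zero | δ-≢ {4} {suc zero} {zero} (λ ()) = refl
    d1 : δ {4} zero (suc zero) + (δ {4} (suc zero) (suc zero) + 0) ≡ 1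
    d1 rewrite δ-refl {4} (suc zero) | δ-≢ {4} {zero} {suc zero} (λ ()) = refl

  -- The root takes all three edges in one colour; degree three suits the bottom edge of the cycle
  -- and differs from the degree two at the other two edges.
  loose-and-light : ∀ {v t ch t′} → (∀ P Q → LightAt (step t ch) P Q) → UpT t′ 2 →
    Colourable₀ 4 (node v (cyc t ch (br t′ [])))
  loose-and-light l u with l zero zero 3 (s≤s (s≤s z≤n)) | u zero
  ... | cc , vc , e | ct , vt , e′ =
    node (cyc zero zero cc (br zero ct [])) ,
    subst (λ z → VC z zero zero cc) (sym d3) vc , (λ z → 3≢2 (trans (trans (sym d3) z) e)) ,
    vt , (λ z → 3≢2 (trans (trans (sym d3) z) e′)) , tt
    where
    3≢2 : 3 ≢ 2
    3≢2 ()
    d3 : δ {4} zero zero + δ {4} zero zero + (δ {4} zero zero + 0) ≡ 3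
    d3 rewrite δ-refl {4} zero = refl

  -- Equal colours give the root degree two, as in the light branch; different colours give it
  -- degree one, as in the free branch.
  not-pfree-and-light : ∀ {v t t′ k} → ForcedT t 1 → ForcedT t′ 2 → ¬ Colourable₀ k (node v (br t (br t′ [])))
  not-pfree-and-light f f′ (node (br c ct (br c′ ct′ [])) , v , ne , v′ , ne′ , tt)
    rewrite f c ct v | f′ c′ ct′ v′ with c ≟ c′
  ... | yes refl rewrite δ-refl c = ne′ refl
  ... | no c≢c′ rewrite δ-refl c | δ-≢ (≢-sym c≢c′) = ne refl

  not-tight-and-light : ∀ {v t t₁ t′ k} → Corner t → Corner t₁ → ForcedT t′ 2 →
    ¬ Colourable₀ k (node v (br t′ (cyc t (base t₁) [])))
  not-tight-and-light h h₁ f (node (br u ct (cyc c c₀ cc [])) , v , ne , vc , ne′ , tt) =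
    ne (trans (tight-degree h h₁ u c c₀ _ (λ x → e (δ u x) (δ c x) (δ c₀ x)) cc vc ne′) (sym (f u ct v)))
    where
    e : ∀ a b c → a + (b + c + 0) ≡ a + b + c
    e = solve-∀

  -- A single cycle at the root is accepted only if it is the whole component; the choice of the
  -- root guarantees this.
  LoneCycleBare : Items → Set
  LoneCycleBare is = ∀ {t ch} → is ≡ cyc t ch [] → Bare t × BareC ch

  colour-one : ∀ {v is k} → OneAvail is → LoneCycleBare is → Colourable₀ k (node v is) → Colourable₀ 4 (node v is)
  colour-one (one-flex {d = d} f h u) _ _ with u zero
  ... | ct , vt , e = node (br zero ct []) , vt , (λ z → <⇒≢ h (trans (trans (sym d0) z) e)) , tt
    where
    d0 : δ {4} zero zero + 0 ≡ 1
    d0 rewrite δ-refl {4} zero = refl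
  colour-one (one-pfree f g) _ (node (br c ct []) , v , ne , tt)
    rewrite g c ct v | δ-refl c = ⊥-elim (ne refl)
  colour-one (one-loose l) b c = bare-cycle (proj₁ (b refl)) (proj₂ (b refl)) c
  colour-one (one-tight l _ _) b c = bare-cycle (proj₁ (b refl)) (proj₂ (b refl)) c

  colour-two : ∀ {v is k} → AvailLight is → Colourable₀ k (node v is) → Colourable₀ 4 (node v is)
  colour-two (flex-light f h u (one-light u′ _)) _ = flex-and-light h u u′
  colour-two (pfree-light f g (one-light _ g′)) c = ⊥-elim (not-pfree-and-light g g′ c)
  colour-two (loose-light l (one-light u′ _)) _ = loose-and-light l u′
  colour-two (tight-light h h₁ (one-light _ g)) c = ⊥-elim (not-tight-and-light h h₁ g (cyc-br c))
  colour-two (light-first u′ g′ (one-flex f h u)) _ = swap-br (flex-and-light h u u′)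
  colour-two (light-first u′ g′ (one-pfree f g)) c = ⊥-elim (not-pfree-and-light g g′ (swap-br c))
  colour-two (light-first u′ g′ (one-loose l)) _ = cyc-br (loose-and-light l u′)
  colour-two (light-first u′ g′ (one-tight l h h₁)) c = ⊥-elim (not-tight-and-light h h₁ g′ c)

  -- With one taken edge and at least two light branches, merging gives degree three. So only one
  -- taken edge with at most one light branch makes use of the given colouring.
  four-colours : ∀ {v is k} → LoneCycleBare is → Colourable₀ k (node v is) → Colourable₀ 4 (node v is)
  four-colours {is = is} b c with classify-items is
  ... | ks , cls with avail ks in ea | ords ks in eo
  ... | 1 | 0 = colour-one (single-avail cls ea eo) b c
  ... | 1 | 1 = colour-two (avail-light cls ea eo) c
  ... | 1 | suc (suc o) = colour-merge cls h
    where
    h : 3 ≤ avail ks + ords ks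
    h rewrite ea | eo = s≤s (s≤s (s≤s z≤n))
  ... | 0 | _ = colour-avail cls (λ q → 0≢1+n (trans (sym ea) q))
  ... | suc (suc a) | _ = colour-avail cls (λ q → h (trans (sym ea) q))
    where
    h : suc (suc a) ≢ 1
    h ()

  -- From rooted cacti to graphs

  -- Counting occurrences turns membership, disjointness and absence of repetitions into arithmetic
  -- with natural numbers.
  occ : List V → V → ℕ
  occ [] x = 0
  occ (y ∷ ys) x = δ y x + occ ys x

  occ-++ : ∀ xs ys x → occ (xs ++ ys) x ≡ occ xs x + occ ys x
  occ-++ [] ys x = refl
  occ-++ (z ∷ xs) ys x rewrite occ-++ xs ys x = sym (+-assoc (δ z x) _ _)

  lab : Tree → V
  top bot : Chain → V
  lab (node v _) = v
  top (base t) = lab t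
  top (step t ch) = lab t
  bot (base t) = lab t
  bot (step t ch) = bot ch

  mutual
    vT : Tree → List V
    vT (node v is) = v ∷ vI is

    vI : Items → List V
    vI [] = []
    vI (br t is) = vT t ++ vI is
    vI (cyc t ch is) = (vT t ++ vC ch) ++ vI is

    vC : Chain → List V
    vC (base t) = vT t
    vC (step t ch) = vT t ++ vC ch

  mutual
    eT : Tree → List (V × V)
    eT (node v is) = eI v is

    eI : V → Items → List (V × V)
    eI v [] = []
    eI v (br t is) = (v , lab t) ∷ eT t ++ eI v is
    eI v (cyc t ch is) = (v , lab t) ∷ (v , bot ch) ∷ ((lab t , top ch) ∷ eT t ++ eC ch) ++ eI v is

    eC : Chain → List (V × V)
    eC (base t) = eT t
    eC (step t ch) = (lab t , top ch) ∷ eT t ++ eC ch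

  -- For distinct ends, the indicator of an unordered pair. Written as a polynomial in `δ`, it sums
  -- over `y` to the contribution of the edge to the degree of `x`.
  joins : V × V → V → V → ℕ
  joins (u , w) x y = δ u x * δ w y + δ w x * δ u y

  mult : List (V × V) → V → V → ℕ
  mult [] x y = 0
  mult (e ∷ es) x y = joins e x y + mult es x y

  mult-++ : ∀ es fs x y → mult (es ++ fs) x y ≡ mult es x y + mult fs x y
  mult-++ [] fs x y = refl
  mult-++ (e ∷ es) fs x y rewrite mult-++ es fs x y = sym (+-assoc (joins e x y) _ _)

  joins-sym : ∀ e x y → joins e x y ≡ joins e y x
  joins-sym (u , w) x y = h (δ u x) (δ w y) (δ w x) (δ u y)
    where
    h : ∀ a b c d → a * b + c * d ≡ d * c + b * a
    h = solve-∀

  mult-sym : ∀ es x y → mult es x y ≡ mult es y x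
  mult-sym [] x y = refl
  mult-sym (e ∷ es) x y = cong₂ _+_ (joins-sym e x y) (mult-sym es x y)

  module _ {k : ℕ} where
    Entry : Set
    Entry = V × V × Fin k

    mutual
      xT : ∀ {t} → ColT k t → List Entry
      xT (node {v} col) = xI v col

      xI : ∀ {is} → V → ColI k is → List Entry
      xI v [] = []
      xI v (br {t} c ct r) = (v , lab t , c) ∷ xT ct ++ xI v r
      xI v (cyc {t} {ch} c c₀ cc r) = (v , lab t , c) ∷ (v , bot ch , c₀) ∷ xC cc ++ xI v r

      xC : ∀ {ch} → ColC k ch → List Entry
      xC (base ct) = xT ct
      xC (step {t} {ch} c ct cc) = (lab t , top ch , c) ∷ xT ct ++ xC cc

    ends : List Entry → List (V × V)
    ends [] = []
    ends ((u , w , _) ∷ E) = (u , w) ∷ ends E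

    ends-++ : ∀ E F → ends (E ++ F) ≡ ends E ++ ends F
    ends-++ [] F = refl
    ends-++ (_ ∷ E) F = cong (_ ∷_) (ends-++ E F)

    mutual
      ends-xT : ∀ {t} (ct : ColT k t) → ends (xT ct) ≡ eT t
      ends-xT (node {v} col) = ends-xI v col

      ends-xI : ∀ {is} v (col : ColI k is) → ends (xI v col) ≡ eI v is
      ends-xI v [] = refl
      ends-xI v (br {t} c ct r) =
        cong (_ ∷_) (trans (ends-++ (xT ct) _) (cong₂ _++_ (ends-xT ct) (ends-xI v r)))
      ends-xI v (cyc c c₀ cc r) =
        cong (λ l → _ ∷ _ ∷ l) (trans (ends-++ (xC cc) _) (cong₂ _++_ (ends-xC cc) (ends-xI v r)))

      ends-xC : ∀ {ch} (cc : ColC k ch) → ends (xC cc) ≡ eC ch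
      ends-xC (base ct) = ends-xT ct
      ends-xC (step c ct cc) =
        cong (_ ∷_) (trans (ends-++ (xT ct) _) (cong₂ _++_ (ends-xT ct) (ends-xC cc)))

    degE : List Entry → V → Fin k → ℕ
    degE [] x i = 0
    degE ((u , w , c) ∷ E) x i = δ c i * (δ u x + δ w x) + degE E x i

    degE-++ : ∀ E F x i → degE (E ++ F) x i ≡ degE E x i + degE F x i
    degE-++ [] F x i = refl
    degE-++ ((u , w , c) ∷ E) F x i rewrite degE-++ E F x i = sym (+-assoc (δ c i * (δ u x + δ w x)) _ _)

  absent-++ : ∀ xs {ys x} → occ (xs ++ ys) x ≡ 0 → occ xs x ≡ 0 × occ ys x ≡ 0
  absent-++ xs {ys} {x} h = m+n≡0⇒m≡0 _ h′ , m+n≡0⇒n≡0 (occ xs x) h′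
    where
    h′ : occ xs x + occ ys x ≡ 0
    h′ = trans (sym (occ-++ xs ys x)) h

  absent-lab : ∀ t {x} → occ (vT t) x ≡ 0 → δ (lab t) x ≡ 0
  absent-lab (node v is) {x} h = m+n≡0⇒m≡0 (δ v x) h

  absent-top : ∀ ch {x} → occ (vC ch) x ≡ 0 → δ (top ch) x ≡ 0
  absent-top (base t) h = absent-lab t h
  absent-top (step t ch) h = absent-lab t (proj₁ (absent-++ (vT t) h))

  absent-bot : ∀ ch {x} → occ (vC ch) x ≡ 0 → δ (bot ch) x ≡ 0
  absent-bot (base t) h = absent-lab t h
  absent-bot (step t ch) h = absent-bot ch (proj₂ (absent-++ (vT t) h))

  Avoids : V → List (V × V) → Set
  Avoids x = All (λ e → δ (proj₁ e) x ≡ 0 × δ (proj₂ e) x ≡ 0)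

  mutual
    avoids-T : ∀ t {x} → occ (vT t) x ≡ 0 → Avoids x (eT t)
    avoids-T (node v is) {x} h = avoids-I is (m+n≡0⇒m≡0 (δ v x) h) (m+n≡0⇒n≡0 (δ v x) h)

    avoids-I : ∀ {v} is {x} → δ v x ≡ 0 → occ (vI is) x ≡ 0 → Avoids x (eI v is)
    avoids-I [] p h = []
    avoids-I (br t is) p h =
      let (ht , hr) = absent-++ (vT t) h in
      (p , absent-lab t ht) ∷ ++⁺ (avoids-T t ht) (avoids-I is p hr)
    avoids-I (cyc t ch is) p h =
      let (hc , hr) = absent-++ (vT t ++ vC ch) h
          (ht , hch) = absent-++ (vT t) hc in
      (p , absent-lab t ht) ∷ (p , absent-bot ch hch) ∷
      ++⁺ ((absent-lab t ht , absent-top ch hch) ∷ ++⁺ (avoids-T t ht) (avoids-C ch hch)) (avoids-I is p hr)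

    avoids-C : ∀ ch {x} → occ (vC ch) x ≡ 0 → Avoids x (eC ch)
    avoids-C (base t) h = avoids-T t h
    avoids-C (step t ch) h =
      let (ht , hch) = absent-++ (vT t) h in
      (absent-lab t ht , absent-top ch hch) ∷ ++⁺ (avoids-T t ht) (avoids-C ch hch)

  mult-avoids : ∀ {es x} → Avoids x es → ∀ y → mult es x y ≡ 0
  mult-avoids [] y = refl
  mult-avoids ((p , q) ∷ a) y rewrite p | q = mult-avoids a y

  degE-avoids : ∀ {k} (E : List (Entry {k})) {x} i → Avoids x (ends E) → degE E x i ≡ 0
  degE-avoids [] i [] = refl
  degE-avoids ((u , w , c) ∷ E) i ((p , q) ∷ a) rewrite p | q | *-zeroʳ (δ c i) = degE-avoids E i a

  Simple : List V → Set
  Simple vs = ∀ x → occ vs x ≤ 1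

  simple-split : ∀ xs {ys} → Simple (xs ++ ys) → ∀ x →
    (1 ≤ occ xs x → occ ys x ≡ 0) × (1 ≤ occ ys x → occ xs x ≡ 0)
  simple-split xs {ys} s x = ≤1-split h , ≤1-split (≤-trans (≤-reflexive (+-comm (occ ys x) (occ xs x))) h)
    where
    h : occ xs x + occ ys x ≤ 1
    h = subst (_≤ 1) (occ-++ xs ys x) (s x)

  simple-++ : ∀ xs {ys} → Simple (xs ++ ys) → Simple xs × Simple ys
  simple-++ xs {ys} s = (λ x → ≤-trans (m≤m+n _ (occ ys x)) (h x)) , (λ x → ≤-trans (m≤n+m _ (occ xs x)) (h x))
    where
    h : ∀ x → occ xs x + occ ys x ≤ 1
    h x = subst (_≤ 1) (occ-++ xs ys x) (s x)

  inˡ : ∀ xs {ys x} → 1 ≤ occ xs x → 1 ≤ occ (xs ++ ys) x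
  inˡ xs {ys} {x} h = subst (1 ≤_) (sym (occ-++ xs ys x)) (≤-trans h (m≤m+n _ _))

  inʳ : ∀ xs {ys x} → 1 ≤ occ ys x → 1 ≤ occ (xs ++ ys) x
  inʳ xs {ys} {x} h = subst (1 ≤_) (sym (occ-++ xs ys x)) (≤-trans h (m≤n+m _ _))

  module _ {k : ℕ} where
    degE-absentT : ∀ {t} (ct : ColT k t) {x} i → occ (vT t) x ≡ 0 → degE (xT ct) x i ≡ 0
    degE-absentT {t} ct i h = degE-avoids (xT ct) i (subst (Avoids _) (sym (ends-xT ct)) (avoids-T t h))

    degE-absentI : ∀ {v is} (col : ColI k is) {x} i → δ v x ≡ 0 → occ (vI is) x ≡ 0 → degE (xI v col) x i ≡ 0
    degE-absentI {v} {is} col i p h =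
      degE-avoids (xI v col) i (subst (Avoids _) (sym (ends-xI v col)) (avoids-I is p h))

    degE-absentC : ∀ {ch} (cc : ColC k ch) {x} i → occ (vC ch) x ≡ 0 → degE (xC cc) x i ≡ 0
    degE-absentC {ch} cc i h = degE-avoids (xC cc) i (subst (Avoids _) (sym (ends-xC cc)) (avoids-C ch h))

    root-degree : ∀ {is} v (col : ColI k is) i → occ (vI is) v ≡ 0 → degE (xI v col) v i ≡ cntI col i
    root-degree v [] i h = refl
    root-degree v (br {t} c ct r) i h with absent-++ (vT t) h
    ... | ht , hr rewrite degE-++ (xT ct) (xI v r) v i | degE-absentT ct i ht | absent-lab t ht | δ-refl v
                        | root-degree v r i hr | *-identityʳ (δ c i) = refl
    root-degree v (cyc {t} {ch} c c₀ cc r) i h with absent-++ (vT t ++ vC ch) h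
    ... | hc , hr with absent-++ (vT t) hc
    ... | ht , hch rewrite degE-++ (xC cc) (xI v r) v i | degE-absentC cc i hc | absent-lab t ht
                         | absent-bot ch hch | δ-refl v
                         | root-degree v r i hr | *-identityʳ (δ c i) | *-identityʳ (δ c₀ i) =
                           sym (+-assoc (δ c i) (δ c₀ i) (cntI r i))

    module Degrees (Δ : V → Fin k → ℕ) where

      -- A degree function of the whole splits at a subtree into the edges inside and, at the root
      -- only, the edges from outside. `Δ` is kept general to serve both the given colouring of the
      -- graph and the newly built list of edges.
      HypT : ∀ {t} → (Fin k → ℕ) → ColT k t → Set
      HypT {t} inc ct = ∀ x i → 1 ≤ occ (vT t) x → Δ x i ≡ degE (xT ct) x i + δ (lab t) x * inc i

      HypI : ∀ {is} → V → ColI k is → Set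
      HypI {is} v col = ∀ x i → 1 ≤ occ (vI is) x → Δ x i ≡ degE (xI v col) x i

      HypC : ∀ {ch} → Fin k → Fin k → ColC k ch → Set
      HypC {ch} c₀ c cc = ∀ x i → 1 ≤ occ (vC ch) x →
        Δ x i ≡ degE (xC cc) x i + (δ (top ch) x * δ c i + δ (bot ch) x * δ c₀ i)

      LI : List Entry → Set
      LI = All (λ { (u , w , c) → Δ u c ≢ Δ w c })

      private
        r1 : ∀ {dc dv dl T R} → dv ≡ 0 → R ≡ 0 → dc * (dv + dl) + (T + R) ≡ T + dl * dc
        r1 {dc} {_} {dl} {T} refl refl = h dc dl T
          where
          h : ∀ dc dl T → dc * dl + (T + 0) ≡ T + dl * dc
          h = solve-∀
        r2 : ∀ {dc dv dl T R} → dv ≡ 0 → dl ≡ 0 → T ≡ 0 → dc * (dv + dl) + (T + R) ≡ R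
        r2 {dc} refl refl refl rewrite *-zeroʳ dc = refl
        r3 : ∀ {dc d₀ dv dl db X R} → dv ≡ 0 → R ≡ 0 →
             dc * (dv + dl) + (d₀ * (dv + db) + (X + R)) ≡ X + (dl * dc + db * d₀)
        r3 {dc} {d₀} {_} {dl} {db} {X} refl refl = h dc d₀ dl db X
          where
          h : ∀ dc d₀ dl db X → dc * dl + (d₀ * db + (X + 0)) ≡ X + (dl * dc + db * d₀)
          h = solve-∀
        r4 : ∀ {dc d₀ dv dl db X R} → dv ≡ 0 → dl ≡ 0 → db ≡ 0 → X ≡ 0 →
             dc * (dv + dl) + (d₀ * (dv + db) + (X + R)) ≡ R
        r4 {dc} {d₀} refl refl refl refl rewrite *-zeroʳ dc | *-zeroʳ d₀ = refl
        r5 : ∀ {dc dl dt T C a db d₀} → dt ≡ 0 → C ≡ 0 → db ≡ 0 →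
             dc * (dl + dt) + (T + C) + (dl * a + db * d₀) ≡ T + dl * (a + dc)
        r5 {dc} {dl} {_} {T} {_} {a} refl refl refl = h dc dl T a
          where
          h : ∀ dc dl T a → dc * (dl + 0) + (T + 0) + (dl * a + 0) ≡ T + dl * (a + dc)
          h = solve-∀
        r6 : ∀ {dc dl dt T C a db d₀} → dl ≡ 0 → T ≡ 0 →
             dc * (dl + dt) + (T + C) + (dl * a + db * d₀) ≡ C + (dt * dc + db * d₀)
        r6 {dc} {_} {dt} {_} {C} {a} {db} {d₀} refl refl = h dc dt C db d₀
          where
          h : ∀ dc dt C db d₀ → dc * dt + C + db * d₀ ≡ C + (dt * dc + db * d₀)
          h = solve-∀
        r7 : ∀ T l a b → T + (l * a + l * b) ≡ T + l * (a + b)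
        r7 = solve-∀

      hyp-node : ∀ {v is inc} (col : ColI k is) → Simple (v ∷ vI is) → HypT {node v is} inc (node col) →
        HypI v col × (∀ i → Δ v i ≡ inc i + cntI col i)
      hyp-node {v} {is} {inc} col s h = hi , hv
        where
        hi : HypI v col
        hi x i p with h x i (≤-trans p (m≤n+m _ (δ v x)))
        ... | e rewrite ≤1-split (subst (_≤ 1) (+-comm (δ v x) (occ (vI is) x)) (s x)) p = trans e (+-identityʳ _)
        hv : ∀ i → Δ v i ≡ inc i + cntI col i
        hv i = trans (h v i v∈) e
          where
          v∈ : 1 ≤ δ v v + occ (vI is) v
          v∈ rewrite δ-refl v = s≤s z≤n
          e : degE (xI v col) v i + δ v v * inc i ≡ inc i + cntI col i
          e rewrite root-degree v col i (≤1-split (s v) (≤-reflexive (sym (δ-refl v)))) | δ-refl v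
                  | +-identityʳ (inc i) = +-comm (cntI col i) (inc i)

      hyp-br : ∀ {v t is c} (ct : ColT k t) (r : ColI k is) → Simple (v ∷ vT t ++ vI is) →
        HypI v (br c ct r) → HypT (δ c) ct × HypI v r
      hyp-br {v} {t} {is} {c} ct r s h = ht , hr
        where
        at : ∀ {x} → 1 ≤ occ (vT t ++ vI is) x → δ v x ≡ 0
        at {x} p = ≤1-split (subst (_≤ 1) (+-comm (δ v x) _) (s x)) p
        s′ : Simple (vT t ++ vI is)
        s′ x = ≤-trans (m≤n+m _ (δ v x)) (s x)
        e : ∀ x i → degE (xI v (br c ct r)) x i ≡ δ c i * (δ v x + δ (lab t) x) + (degE (xT ct) x i + degE (xI v r) x i)
        e x i = cong (δ c i * (δ v x + δ (lab t) x) +_) (degE-++ (xT ct) (xI v r) x i)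
        ht : HypT (δ c) ct
        ht x i p = trans (h x i (inˡ (vT t) p)) (trans (e x i)
          (r1 {dc = δ c i} (at (inˡ (vT t) p)) (degE-absentI r i (at (inˡ (vT t) p)) (proj₁ (simple-split (vT t) s′ x) p))))
        hr : HypI v r
        hr x i p = trans (h x i (inʳ (vT t) p)) (trans (e x i)
          (r2 {dc = δ c i} (at (inʳ (vT t) p)) (absent-lab t t∌) (degE-absentT ct i t∌)))
          where
          t∌ : occ (vT t) x ≡ 0
          t∌ = proj₂ (simple-split (vT t) s′ x) p

      hyp-cyc : ∀ {v t ch is c c₀} (cc : ColC k (step t ch)) (r : ColI k is) →
        Simple (v ∷ (vT t ++ vC ch) ++ vI is) → HypI v (cyc c c₀ cc r) → HypC c₀ c cc × HypI v r
      hyp-cyc {v} {t} {ch} {is} {c} {c₀} cc r s h = hc , hr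
        where
        vs : List V
        vs = vT t ++ vC ch
        at : ∀ {x} → 1 ≤ occ (vs ++ vI is) x → δ v x ≡ 0
        at {x} p = ≤1-split (subst (_≤ 1) (+-comm (δ v x) _) (s x)) p
        s′ : Simple (vs ++ vI is)
        s′ x = ≤-trans (m≤n+m _ (δ v x)) (s x)
        e : ∀ x i → degE (xI v (cyc c c₀ cc r)) x i ≡
          δ c i * (δ v x + δ (lab t) x) + (δ c₀ i * (δ v x + δ (bot ch) x) + (degE (xC cc) x i + degE (xI v r) x i))
        e x i rewrite degE-++ (xC cc) (xI v r) x i = refl
        hc : HypC c₀ c cc
        hc x i p = trans (h x i (inˡ vs p)) (trans (e x i)
          (r3 {dc = δ c i} {d₀ = δ c₀ i} (at (inˡ vs p)) (degE-absentI r i (at (inˡ vs p)) (proj₁ (simple-split vs s′ x) p))))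
        hr : HypI v r
        hr x i p = trans (h x i (inʳ vs p)) (trans (e x i)
          (r4 {dc = δ c i} {d₀ = δ c₀ i} (at (inʳ vs p)) (absent-lab t (proj₁ (absent-++ (vT t) c∌)))
              (absent-bot ch (proj₂ (absent-++ (vT t) c∌))) (degE-absentC cc i c∌)))
          where
          c∌ : occ vs x ≡ 0
          c∌ = proj₂ (simple-split vs s′ x) p

      hyp-base : ∀ {t c c₀} (ct : ColT k t) → HypC c₀ c (base ct) → HypT (λ x → δ c x + δ c₀ x) ct
      hyp-base {t} {c} {c₀} ct h x i p = trans (h x i p) (r7 (degE (xT ct) x i) (δ (lab t) x) (δ c i) (δ c₀ i))

      hyp-step : ∀ {t ch c c₀ c′} (ct : ColT k t) (cc : ColC k ch) → Simple (vT t ++ vC ch) →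
        HypC c₀ c (step c′ ct cc) → HypT (λ x → δ c x + δ c′ x) ct × HypC c₀ c′ cc
      hyp-step {t} {ch} {c} {c₀} {c′} ct cc s h = ht , hc
        where
        rest : V → Fin k → ℕ
        rest x i = δ (lab t) x * δ c i + δ (bot ch) x * δ c₀ i
        e : ∀ x i → degE (xC (step c′ ct cc)) x i ≡
          δ c′ i * (δ (lab t) x + δ (top ch) x) + (degE (xT ct) x i + degE (xC cc) x i)
        e x i rewrite degE-++ (xT ct) (xC cc) x i = refl
        ht : HypT (λ x → δ c x + δ c′ x) ct
        ht x i p = trans (h x i (inˡ (vT t) p)) (trans (cong (_+ rest x i) (e x i))
          (r5 {dc = δ c′ i} {dl = δ (lab t) x} {a = δ c i} {db = δ (bot ch) x} {d₀ = δ c₀ i} (absent-top ch c∌) (degE-absentC cc i c∌) (absent-bot ch c∌)))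
          where
          c∌ : occ (vC ch) x ≡ 0
          c∌ = proj₁ (simple-split (vT t) s x) p
        hc : HypC c₀ c′ cc
        hc x i p = trans (h x i (inʳ (vT t) p)) (trans (cong (_+ rest x i) (e x i))
          (r6 {dc = δ c′ i} {a = δ c i} {db = δ (bot ch) x} {d₀ = δ c₀ i} (absent-lab t t∌) (degE-absentT ct i t∌)))
          where
          t∌ : occ (vT t) x ≡ 0
          t∌ = proj₂ (simple-split (vT t) s x) p

  simple-drop : ∀ v xs {ys} → Simple (v ∷ xs ++ ys) → Simple (xs ++ ys) × Simple (v ∷ ys)
  simple-drop v xs {ys} s = (λ x → ≤-trans (m≤n+m _ (δ v x)) (s x)) ,
    λ x → ≤-trans (+-monoʳ-≤ (δ v x) (≤-trans (m≤n+m _ (occ xs x)) (≤-reflexive (sym (occ-++ xs ys x))))) (s x)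

  module _ {k : ℕ} (Δ : V → Fin k → ℕ) where
    open Degrees Δ

    lab-degree : ∀ t {inc} (ct : ColT k t) → Simple (vT t) → HypT inc ct → ∀ i → Δ (lab t) i ≡ degT inc ct i
    lab-degree (node v is) (node col) s h i = proj₂ (hyp-node col s h) i

    top-degree : ∀ ch {c₀ c} (cc : ColC k ch) → Simple (vC ch) → HypC c₀ c cc →
      ∀ i → Δ (top ch) i ≡ degC c₀ c cc i
    top-degree (base t) (base ct) s h i = lab-degree t ct s (hyp-base ct h) i
    top-degree (step t ch) (step c′ ct cc) s h i =
      lab-degree t ct (proj₁ (simple-++ (vT t) s)) (proj₁ (hyp-step ct cc s h)) i

    mutual
      valid⇒LI-T : ∀ {t inc} (ct : ColT k t) → Simple (vT t) → HypT inc ct → VT inc ct → LI (xT ct)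
      valid⇒LI-T (node col) s h v = valid⇒LI-I col s (proj₁ (hyp-node col s h)) (proj₂ (hyp-node col s h)) v

      valid⇒LI-I : ∀ {v is D} (col : ColI k is) → Simple (v ∷ vI is) → HypI v col → (∀ i → Δ v i ≡ D i) →
        VI D col → LI (xI v col)
      valid⇒LI-I [] s h e _ = []
      valid⇒LI-I (br {t} c ct r) s h e (vt , ne , vr) =
        let (s₁ , s₂) = simple-drop _ (vT t) s
            st = proj₁ (simple-++ (vT t) s₁)
            (ht , hr) = hyp-br ct r s h in
        (λ z → ne (trans (sym (e c)) (trans z (lab-degree t ct st ht c)))) ∷
        ++⁺ (valid⇒LI-T ct st ht vt) (valid⇒LI-I r s₂ hr e vr)
      valid⇒LI-I (cyc {t} {ch} c c₀ cc r) s h e (vc , ne , vr) =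
        let (s₁ , s₂) = simple-drop _ (vT t ++ vC ch) s
            sc = proj₁ (simple-++ (vT t ++ vC ch) s₁)
            (hc , hr) = hyp-cyc cc r s h
            (l , ne₀) = valid⇒LI-C cc sc hc vc in
        (λ z → ne (trans (sym (e c)) (trans z (top-degree (step t ch) cc sc hc c)))) ∷
        (λ z → ne₀ (trans (sym (e c₀)) z)) ∷ ++⁺ l (valid⇒LI-I r s₂ hr e vr)

      valid⇒LI-C : ∀ {ch d c₀ c} (cc : ColC k ch) → Simple (vC ch) → HypC c₀ c cc →
        VC d c₀ c cc → LI (xC cc) × d ≢ Δ (bot ch) c₀
      valid⇒LI-C {base t} (base ct) s h (vt , ne) =
        valid⇒LI-T ct s (hyp-base ct h) vt , λ z → ne (trans z (lab-degree t ct s (hyp-base ct h) _))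
      valid⇒LI-C {step t ch} (step c′ ct cc) s h (vt , ne , vc) =
        let (st , sc) = simple-++ (vT t) s
            (ht , hc) = hyp-step ct cc s h
            (l , ne₀) = valid⇒LI-C cc sc hc vc in
        (λ z → ne (trans (sym (lab-degree t ct st ht c′)) (trans z (top-degree ch cc sc hc c′)))) ∷
        ++⁺ (valid⇒LI-T ct st ht vt) l , ne₀

    mutual
      LI⇒valid-T : ∀ {t inc} (ct : ColT k t) → Simple (vT t) → HypT inc ct → LI (xT ct) → VT inc ct
      LI⇒valid-T (node col) s h l = LI⇒valid-I col s (proj₁ (hyp-node col s h)) (proj₂ (hyp-node col s h)) l

      LI⇒valid-I : ∀ {v is D} (col : ColI k is) → Simple (v ∷ vI is) → HypI v col → (∀ i → Δ v i ≡ D i) →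
        LI (xI v col) → VI D col
      LI⇒valid-I [] s h e _ = tt
      LI⇒valid-I (br {t} c ct r) s h e (ne ∷ l) =
        let (s₁ , s₂) = simple-drop _ (vT t) s
            st = proj₁ (simple-++ (vT t) s₁)
            (ht , hr) = hyp-br ct r s h
            (lt , lr) = ++⁻ (xT ct) l in
        LI⇒valid-T ct st ht lt ,
        (λ z → ne (trans (e c) (trans z (sym (lab-degree t ct st ht c))))) ,
        LI⇒valid-I r s₂ hr e lr
      LI⇒valid-I (cyc {t} {ch} c c₀ cc r) s h e (ne ∷ ne₀ ∷ l) =
        let (s₁ , s₂) = simple-drop _ (vT t ++ vC ch) s
            sc = proj₁ (simple-++ (vT t ++ vC ch) s₁)
            (hc , hr) = hyp-cyc cc r s h
            (lc , lr) = ++⁻ (xC cc) l in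
        LI⇒valid-C cc sc hc lc (λ z → ne₀ (trans (e c₀) z)) ,
        (λ z → ne (trans (e c) (trans z (sym (top-degree (step t ch) cc sc hc c))))) ,
        LI⇒valid-I r s₂ hr e lr

      LI⇒valid-C : ∀ {ch d c₀ c} (cc : ColC k ch) → Simple (vC ch) → HypC c₀ c cc →
        LI (xC cc) → d ≢ Δ (bot ch) c₀ → VC d c₀ c cc
      LI⇒valid-C {base t} (base ct) s h l ne =
        LI⇒valid-T ct s (hyp-base ct h) l , λ z → ne (trans z (sym (lab-degree t ct s (hyp-base ct h) _)))
      LI⇒valid-C {step t ch} (step c′ ct cc) s h (ne ∷ l) ne₀ =
        let (st , sc) = simple-++ (vT t) s
            (ht , hc) = hyp-step ct cc s h
            (lt , lc) = ++⁻ (xT ct) l in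
        LI⇒valid-T ct st ht lt ,
        (λ z → ne (trans (lab-degree t ct st ht c′) (trans z (sym (top-degree ch cc sc hc c′))))) ,
        LI⇒valid-C cc sc hc lc ne₀

  -- Colour degrees in the graph and in a list of coloured edges

  adjN : V → V → ℕ
  adjN x y = if adj G x y then 1 else 0

  adjN⇒Adj : ∀ {x y} → 1 ≤ adjN x y → Adj G x y
  adjN⇒Adj {x} {y} h with adj G x y
  ... | true = refl
  adjN⇒Adj () | false

  Σf : List V → (V → ℕ) → ℕ
  Σf [] f = 0
  Σf (x ∷ xs) f = f x + Σf xs f

  Σf-ext : ∀ xs {f g} → (∀ x → f x ≡ g x) → Σf xs f ≡ Σf xs g
  Σf-ext [] e = refl
  Σf-ext (x ∷ xs) e = cong₂ _+_ (e x) (Σf-ext xs e)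

  Σf-+ : ∀ xs f g → Σf xs (λ x → f x + g x) ≡ Σf xs f + Σf xs g
  Σf-+ [] f g = refl
  Σf-+ (x ∷ xs) f g rewrite Σf-+ xs f g = h (f x) (g x) (Σf xs f) (Σf xs g)
    where
    h : ∀ a b c d → a + b + (c + d) ≡ a + c + (b + d)
    h = solve-∀

  Σf-* : ∀ xs a f → Σf xs (λ x → a * f x) ≡ a * Σf xs f
  Σf-* [] a f = sym (*-zeroʳ a)
  Σf-* (x ∷ xs) a f rewrite Σf-* xs a f = sym (*-distribˡ-+ a (f x) (Σf xs f))


  occ-∈ : ∀ {xs x} → x ∈ xs → 1 ≤ occ xs x
  occ-∈ {y ∷ xs} {x} (here refl) rewrite δ-refl x = s≤s z≤n
  occ-∈ {y ∷ xs} {x} (there p) = ≤-trans (occ-∈ p) (m≤n+m _ (δ y x))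

  ∈-occ : ∀ xs {x} → 1 ≤ occ xs x → x ∈ xs
  ∈-occ (y ∷ xs) {x} h with y ≟ x
  ... | yes refl = here refl
  ... | no y≢x rewrite δ-≢ y≢x = there (∈-occ xs h)

  occ-∉ : ∀ {xs x} → All (x ≢_) xs → occ xs x ≡ 0
  occ-∉ [] = refl
  occ-∉ (x≢y ∷ a) rewrite δ-≢ (≢-sym x≢y) = occ-∉ a

  unique⇒simple : ∀ {xs} → Unique xs → Simple xs
  unique⇒simple [] x = z≤n
  unique⇒simple (_∷_ {y} {xs} a u) x with y ≟ x
  ... | yes refl rewrite δ-refl y | occ-∉ a = ≤-refl
  ... | no y≢x rewrite δ-≢ y≢x = unique⇒simple u x

  simple⇒unique : ∀ xs → Simple xs → Unique xs
  simple⇒unique [] s = []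
  simple⇒unique (y ∷ xs) s = All.tabulate fresh ∷ simple⇒unique xs (λ x → ≤-trans (m≤n+m _ (δ y x)) (s x))
    where
    fresh : ∀ {x} → x ∈ xs → y ≢ x
    fresh p refl = <-irrefl refl (≤-trans (+-mono-≤ (≤-reflexive (sym (δ-refl y))) (occ-∈ p)) (s y))

  Σf-δ : ∀ xs w → Σf xs (δ w) ≡ occ xs w
  Σf-δ [] w = refl
  Σf-δ (x ∷ xs) w = cong₂ _+_ (δ-sym w x) (Σf-δ xs w)

  Σf-allFin : ∀ w → Σf (allFin (n G)) (δ w) ≡ 1
  Σf-allFin w = trans (Σf-δ (allFin (n G)) w)
    (≤-antisym (unique⇒simple (allFin⁺ (n G)) w) (occ-∈ (∈-allFin w)))

  length-filter : ∀ (f : V → Bool) xs → length (filter (λ u → T? (f u)) xs) ≡ Σf xs (λ u → if f u then 1 else 0)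
  length-filter f [] = refl
  length-filter f (x ∷ xs) with f x
  ... | true = cong suc (length-filter f xs)
  ... | false = length-filter f xs

  joins-cases : ∀ u w x y → joins (u , w) x y ≡ 0 ⊎ (u ≡ x × w ≡ y) ⊎ (w ≡ x × u ≡ y)
  joins-cases u w x y with u ≟ x | w ≟ y | w ≟ x | u ≟ y
  ... | yes p | yes q | _ | _ = inj₂ (inj₁ (p , q))
  ... | _ | _ | yes p | yes q = inj₂ (inj₂ (p , q))
  ... | no p | _ | no q | _ rewrite δ-≢ p | δ-≢ q = inj₁ refl
  ... | no p | _ | yes _ | no q rewrite δ-≢ p | δ-≢ q = inj₁ (*-zeroʳ (δ w x))
  ... | yes _ | no p | no q | _ rewrite δ-≢ p | δ-≢ q | *-zeroʳ (δ u x) = inj₁ refl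
  ... | yes _ | no p | yes _ | no q rewrite δ-≢ p | δ-≢ q | *-zeroʳ (δ u x) = inj₁ (*-zeroʳ (δ w x))

  joins-self : ∀ u w → 1 ≤ joins (u , w) u w
  joins-self u w rewrite δ-refl u | δ-refl w = s≤s z≤n

  mult-∈ : ∀ {es u w} → (u , w) ∈ es → 1 ≤ mult es u w
  mult-∈ {e ∷ es} {u} {w} (here refl) = ≤-trans (joins-self u w) (m≤m+n _ _)
  mult-∈ {e ∷ es} {u} {w} (there p) = ≤-trans (mult-∈ p) (m≤n+m _ (joins e u w))

  module _ {k : ℕ} where
    Proper : EdgeColouring G k → List (Entry {k}) → Set
    Proper C = All (λ { (u , w , c) → Adj G u w × c ≡ col C u w })

    multC : List (Entry {k}) → Fin k → V → V → ℕ
    multC [] i x y = 0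
    multC ((u , w , c) ∷ E) i x y = δ c i * joins (u , w) x y + multC E i x y

    degE-Σ : ∀ E x i → degE {k} E x i ≡ Σf (allFin (n G)) (multC E i x)
    degE-Σ [] x i = sym (zeros (allFin (n G)))
      where
      zeros : ∀ xs → Σf xs (λ _ → 0) ≡ 0
      zeros [] = refl
      zeros (_ ∷ xs) = zeros xs
    degE-Σ ((u , w , c) ∷ E) x i =
      trans (cong₂ _+_ (cong (δ c i *_) (sym e)) (degE-Σ E x i))
        (sym (trans (Σf-+ all (λ y → δ c i * joins (u , w) x y) (multC E i x))
          (cong (_+ Σf all (multC E i x)) (Σf-* all (δ c i) (joins (u , w) x)))))
      where
      all : List V
      all = allFin (n G)
      e : Σf all (joins (u , w) x) ≡ δ u x + δ w x
      e = trans (Σf-+ all (λ y → δ u x * δ w y) (λ y → δ w x * δ u y))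
        (cong₂ _+_ (trans (Σf-* all (δ u x) (δ w)) (trans (cong (δ u x *_) (Σf-allFin w)) (*-identityʳ (δ u x))))
                   (trans (Σf-* all (δ w x) (δ u)) (trans (cong (δ w x *_) (Σf-allFin u)) (*-identityʳ (δ w x)))))

    multC-col : ∀ C {E} → Proper C E → ∀ i x y → multC E i x y ≡ δ (col C x y) i * mult (ends E) x y
    multC-col C [] i x y = sym (*-zeroʳ (δ (col C x y) i))
    multC-col C {(u , w , c) ∷ E} ((a , refl) ∷ p) i x y =
      trans (cong₂ _+_ h (multC-col C p i x y)) (sym (*-distribˡ-+ (δ (col C x y) i) (joins (u , w) x y) _))
      where
      h : δ c i * joins (u , w) x y ≡ δ (col C x y) i * joins (u , w) x y
      h with joins-cases u w x y
      ... | inj₁ e rewrite e | *-zeroʳ (δ c i) = sym (*-zeroʳ (δ (col C x y) i))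
      ... | inj₂ (inj₁ (refl , refl)) = refl
      ... | inj₂ (inj₂ (refl , refl)) rewrite colSym C u w a = refl

    -- One side counts neighbours and the other list entries; they agree because every edge at `x`
    -- is listed exactly once.
    colDeg-degE : ∀ C {E} → Proper C E → ∀ x → (∀ y → mult (ends E) x y ≡ adjN x y) →
      ∀ i → colDeg C i x ≡ degE E x i
    colDeg-degE C {E} p x m i = trans (length-filter _ (allFin (n G)))
      (trans (Σf-ext (allFin (n G)) pointwise) (sym (degE-Σ E x i)))
      where
      pointwise : ∀ y → (if adj G x y ∧ does (col C x y ≟ i) then 1 else 0) ≡ multC E i x y
      pointwise y rewrite multC-col C p i x y | m y | δ-def (col C x y) i with adj G x y
      ... | false = sym (*-zeroʳ (if does (col C x y ≟ i) then 1 else 0))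
      ... | true = sym (*-identityʳ (if does (col C x y ≟ i) then 1 else 0))

    lookupE : Fin k → List (Entry {k}) → V → V → Fin k
    -- The default colour is met only at non-edges, where colours do not matter.
    lookupE d [] x y = d
    lookupE d ((u , w , c) ∷ E) x y with joins (u , w) x y
    ... | zero = lookupE d E x y
    ... | suc _ = c

    lookupE-sym : ∀ d E x y → lookupE d E x y ≡ lookupE d E y x
    lookupE-sym d [] x y = refl
    lookupE-sym d ((u , w , c) ∷ E) x y rewrite joins-sym (u , w) x y with joins (u , w) y x
    ... | zero = lookupE-sym d E x y
    ... | suc _ = refl

    ends-∈ : ∀ {E u w c} → (u , w , c) ∈ E → (u , w) ∈ ends {k} E
    ends-∈ (here refl) = here refl
    ends-∈ (there p) = there (ends-∈ p)

    lookupE-∈ : ∀ d E {u w c} → (u , w , c) ∈ E → mult (ends E) u w ≤ 1 → lookupE d E u w ≡ c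
    lookupE-∈ d ((u , w , c) ∷ E) (here refl) h with joins (u , w) u w | joins-self u w
    ... | suc _ | _ = refl
    lookupE-∈ d ((a , b , c′) ∷ E) {u} {w} (there p) h with joins (a , b) u w
    ... | zero = lookupE-∈ d E p h
    ... | suc _ with ≤-trans (mult-∈ (ends-∈ p)) (≤-trans (m≤n+m _ _) (≤-pred h))
    ... | ()

    joined : ∀ E {x y} → 1 ≤ mult (ends {k} E) x y →
      ∃ λ c → (x , y , c) ∈ E ⊎ (y , x , c) ∈ E
    joined ((u , w , c) ∷ E) {x} {y} h with joins-cases u w x y
    ... | inj₂ (inj₁ (refl , refl)) = c , inj₁ (here refl)
    ... | inj₂ (inj₂ (refl , refl)) = c , inj₂ (here refl)
    ... | inj₁ e with joined E (subst (λ z → 1 ≤ z + mult (ends E) x y) e h)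
    ... | c′ , inj₁ p = c′ , inj₁ (there p)
    ... | c′ , inj₂ p = c′ , inj₂ (there p)

    LocallyIrregular : List (Entry {k}) → Set
    LocallyIrregular E = All (λ { (u , w , c) → degE E u c ≢ degE E w c }) E

    from-edges : Fin k → (E : List (Entry {k})) → (∀ x y → mult (ends E) x y ≡ adjN x y) →
      LocallyIrregular E → HasLIEC G k
    from-edges d E m li = C , liec
      where
      adjacent : ∀ {u w c} → (u , w , c) ∈ E → Adj G u w
      adjacent p = adjN⇒Adj (subst (1 ≤_) (m _ _) (mult-∈ (ends-∈ p)))
      m≤1 : ∀ x y → mult (ends E) x y ≤ 1
      m≤1 x y rewrite m x y with adj G x y
      ... | true = ≤-refl
      ... | false = z≤n
      C : EdgeColouring G k
      C = record { col = lookupE d E ; colSym = λ u v _ → lookupE-sym d E u v }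
      deg : ∀ i x → colDeg C i x ≡ degE E x i
      deg i x = colDeg-degE C (All.tabulate (λ {(u , w , c)} p → adjacent p , sym (lookupE-∈ d E p (m≤1 u w)))) x (m x) i
      liec : IsLIEC C
      liec u v a with joined E {u} {v} (subst (1 ≤_) (sym (m u v)) (≤-reflexive (sym e)))
        where
        e : adjN u v ≡ 1
        e rewrite a = refl
      ... | c , inj₁ p rewrite lookupE-∈ d E p (m≤1 u v) =
        λ z → All.lookup li p (trans (sym (deg c u)) (trans z (deg c v)))
      ... | c , inj₂ p rewrite lookupE-sym d E u v | lookupE-∈ d E p (m≤1 v u) =
        λ z → All.lookup li p (trans (sym (deg c v)) (trans (sym z) (deg c u)))

  -- Restricting a colouring of the graph to a rooted cactus

  module _ {k : ℕ} (C : EdgeColouring G k) where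

    mutual
      paintT : ∀ t → ColT k t
      paintT (node v is) = node (paintI v is)

      paintI : V → ∀ is → ColI k is
      paintI v [] = []
      paintI v (br t is) = br (col C v (lab t)) (paintT t) (paintI v is)
      paintI v (cyc t ch is) =
        cyc (col C v (lab t)) (col C v (bot ch)) (step (col C (lab t) (top ch)) (paintT t) (paintC ch)) (paintI v is)

      paintC : ∀ ch → ColC k ch
      paintC (base t) = base (paintT t)
      paintC (step t ch) = step (col C (lab t) (top ch)) (paintT t) (paintC ch)

    paintE : List (V × V) → List (Entry {k})
    paintE [] = []
    paintE ((u , w) ∷ es) = (u , w , col C u w) ∷ paintE es

    paintE-++ : ∀ es fs → paintE (es ++ fs) ≡ paintE es ++ paintE fs
    paintE-++ [] fs = refl
    paintE-++ (e ∷ es) fs = cong (_ ∷_) (paintE-++ es fs)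

    mutual
      xT-paint : ∀ t → xT (paintT t) ≡ paintE (eT t)
      xT-paint (node v is) = xI-paint v is

      xI-paint : ∀ v is → xI v (paintI v is) ≡ paintE (eI v is)
      xI-paint v [] = refl
      xI-paint v (br t is) =
        cong (_ ∷_) (trans (cong₂ _++_ (xT-paint t) (xI-paint v is)) (sym (paintE-++ (eT t) _)))
      xI-paint v (cyc t ch is)
        rewrite paintE-++ (eT t ++ eC ch) (eI v is) | paintE-++ (eT t) (eC ch)
              | xT-paint t | xC-paint ch | xI-paint v is = refl

      xC-paint : ∀ ch → xC (paintC ch) ≡ paintE (eC ch)
      xC-paint (base t) = xT-paint t
      xC-paint (step t ch) =
        cong (_ ∷_) (trans (cong₂ _++_ (xT-paint t) (xC-paint ch)) (sym (paintE-++ (eT t) _)))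

    proper-paintE : ∀ es → All (λ e → Adj G (proj₁ e) (proj₂ e)) es → Proper C (paintE es)
    proper-paintE [] [] = []
    proper-paintE (e ∷ es) (a ∷ as) = (a , refl) ∷ proper-paintE es as

  -- Since `y` may lie outside the tree, `edgesT` says that no edge leaves it: together with the
  -- listed edges being present once each, the tree is a whole component.
  record Spans (t : Tree) : Set where
    field
      simpleT : Simple (vT t)
      edgesT  : ∀ x → 1 ≤ occ (vT t) x → ∀ y → mult (eT t) x y ≡ adjN x y

  open Spans

  -- With one colour the colour degree is the ordinary degree, so the results on colour degrees
  -- apply to it.
  trivial : EdgeColouring G 1
  trivial = record { col = λ _ _ → zero ; colSym = λ _ _ _ → refl }

  degree : V → ℕ
  degree = colDeg trivial zero

  module _ {t : Tree} (sp : Spans t) where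

    spans-adjacent : All (λ e → Adj G (proj₁ e) (proj₂ e)) (eT t)
    spans-adjacent = All.tabulate λ {(u , w)} p → adjN⇒Adj (subst (1 ≤_) (edgesT sp u (inside p) w) (mult-∈ p))
      where
      inside : ∀ {u w} → (u , w) ∈ eT t → 1 ≤ occ (vT t) u
      inside {u} {w} p = n≢0⇒n>0 λ z →
        <-irrefl refl (subst (1 ≤_) (mult-avoids (avoids-T t z) w) (mult-∈ p))

    module _ {k : ℕ} (C : EdgeColouring G k) where

      private
        Δ : V → Fin k → ℕ
        Δ x i = colDeg C i x

      open Degrees Δ

      proper-paint : Proper C (xT (paintT C t))
      proper-paint = subst (Proper C) (sym (xT-paint C t)) (proper-paintE C (eT t) spans-adjacent)

      hyp-paint : HypT none (paintT C t)
      hyp-paint x i h = trans (colDeg-degE C proper-paint x (λ y → trans (cong (λ es → mult es x y) (ends-xT (paintT C t))) (edgesT sp x h y)) i)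
        (sym (trans (cong (degE (xT (paintT C t)) x i +_) (*-zeroʳ (δ (lab t) x))) (+-identityʳ _)))

      valid-paint : IsLIEC C → VT none (paintT C t)
      valid-paint liec = LI⇒valid-T Δ (paintT C t) (simpleT sp) hyp-paint
        (All.map (λ { {u , w , c} (a , refl) → liec u w a }) proper-paint)

  module _ where
    private
      Δ : V → Fin 1 → ℕ
      Δ x i = colDeg trivial i x

    open Degrees Δ

    no-items : ∀ {is} (col : ColI 1 is) → cntI col zero ≡ 0 → is ≡ []
    no-items [] _ = refl
    no-items (br zero _ _) h rewrite δ-refl {1} zero with h
    ... | ()
    no-items (cyc zero _ _ _) h rewrite δ-refl {1} zero with h
    ... | ()

    -- The two cycle edges already account for degree two, so nothing can hang from this vertex.
    bare-T : ∀ t {c c′} (ct : ColT 1 t) → Simple (vT t) → HypT (δ₂ c c′) ct → degree (lab t) ≡ 2 → Bare t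
    bare-T (node v is) {zero} {zero} (node col) s h d
      with no-items col (suc-injective (suc-injective (trans (sym e) d)))
      where
      e : degree v ≡ 2 + cntI col zero
      e = trans (proj₂ (hyp-node col s h) zero)
        (cong (_+ cntI col zero) (cong₂ _+_ (δ-refl {1} zero) (δ-refl {1} zero)))
    ... | refl = bare

    occ-lab : ∀ t → 1 ≤ occ (vT t) (lab t)
    occ-lab (node v is) rewrite δ-refl v = s≤s z≤n

    bare-C : ∀ ch {c₀ c} (cc : ColC 1 ch) → Simple (vC ch) → HypC c₀ c cc →
      (∀ x → 1 ≤ occ (vC ch) x → degree x ≡ 2) → BareC ch
    bare-C (base t) (base ct) s h d = base (bare-T t ct s (hyp-base ct h) (d _ (occ-lab t)))
    bare-C (step t ch) (step c ct cc) s h d =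
      let (st , sc) = simple-++ (vT t) s
          (ht , hc) = hyp-step ct cc s h in
      step (bare-T t ct st ht (d _ (inˡ (vT t) (occ-lab t)))) (bare-C ch cc sc hc (λ x p → d x (inʳ (vT t) p)))

    RegularIfTwo : Tree → Set
    RegularIfTwo t = degree (lab t) ≡ 2 → ∀ x → 1 ≤ occ (vT t) x → degree x ≡ 2

    -- A root with one cycle as its only item has degree two; then all degrees in the component are
    -- two.
    lone-cycle-bare : ∀ {v is} → Spans (node v is) → RegularIfTwo (node v is) → LoneCycleBare is
    lone-cycle-bare {v} sp reg {t} {ch} refl
      with hyp-node (paintI trivial v (cyc t ch [])) (simpleT sp) (hyp-paint sp trivial)
    ... | hi , hv with hyp-cyc {v} {t} {ch} {[]} (paintC trivial (step t ch)) [] (simpleT sp) hi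
    ... | hc , _ with bare-C (step t ch) (paintC trivial (step t ch)) (proj₁ (simple-++ (vT t ++ vC ch) {[]} (proj₁ (simple-drop v [] {(vT t ++ vC ch) ++ []} (simpleT sp))))) hc two
      where
      dv : degree v ≡ 2
      dv = trans (hv zero) e
        where
        e : δ {1} zero zero + δ {1} zero zero + 0 ≡ 2
        e rewrite δ-refl {1} zero = refl
      two : ∀ x → 1 ≤ occ (vT t ++ vC ch) x → degree x ≡ 2
      two x p = reg dv x (≤-trans (inˡ (vT t ++ vC ch) {[]} p) (m≤n+m _ (δ v x)))
    ... | step b bs = b , bs

  colour-tree : ∀ {t k} → Spans t → RegularIfTwo t → (C : EdgeColouring G k) → IsLIEC C → Colourable₀ 4 t
  colour-tree {node v is} sp reg C liec = four-colours (lone-cycle-bare sp reg) (paintT C (node v is) , valid-paint sp C liec)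

  -- Back edges

  -- A path l from a descendant up to v and on along the ancestors anc of v,
  -- together with an edge from its first vertex to the ancestor r.
  record Back (v : V) (anc : List V) (l : List V) (r : V) : Set where
    field
      linked : Linked (Adj G) (l ++ v ∷ anc)
      simple : Simple (l ++ v ∷ anc)
      target : r ∈ anc
      closes : Adj G (firstOr v l) r
      -- An edge from `v` itself must not be the tree edge to its parent; this also ensures that the
      -- cycle has at least three vertices.
      proper : l ≡ [] → firstOr r anc ≢ r

  module _ {v : V} {anc l : List V} {r : V} (B : Back v anc l r) where
    open Back B

    record Loop : Set where
      field
        cycle : Cycle G
        p     : V
        q pre post : List V
        anc≡  : anc ≡ (p ∷ q) ++ post
        up≡   : p ∷ q ≡ pre ++ r ∷ []
        verts≡ : verts cycle ≡ l ++ v ∷ p ∷ q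

    private
      cycle-from : ∀ p q pre post → anc ≡ (p ∷ q) ++ post → p ∷ q ≡ pre ++ r ∷ [] →
        3 ≤ length (l ++ v ∷ p ∷ q) → Loop
      cycle-from p q pre post e u len = record
        { cycle = record
          { verts = l ++ v ∷ p ∷ q
          ; long = len
          ; distinct = simple⇒unique _ (proj₁ (simple-++ (l ++ v ∷ p ∷ q) (subst Simple whole simple)))
          ; closed = λ {a} {b} m → closing-linked (firstOr v l) (l ++ v ∷ pre) r
              (subst (Linked (Adj G)) tip (linked-prefix (l ++ v ∷ p ∷ q) (subst (Linked (Adj G)) whole linked)))
              (trans (adj-sym G r (firstOr v l)) closes)
              (subst (λ xs → (a , b) ∈ closing (firstOr v l) xs) tip (subst ((a , b) ∈_) (cycPairs-from l v (p ∷ q)) m)) }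
        ; p = p ; q = q ; pre = pre ; post = post ; anc≡ = e ; up≡ = u ; verts≡ = refl }
        where
        whole : l ++ v ∷ anc ≡ (l ++ v ∷ p ∷ q) ++ post
        whole = trans (cong (λ a → l ++ v ∷ a) e) (sym (++-assoc l (v ∷ p ∷ q) post))
        tip : l ++ v ∷ p ∷ q ≡ (l ++ v ∷ pre) ++ r ∷ []
        tip = trans (cong (λ a → l ++ v ∷ a) u) (sym (++-assoc l (v ∷ pre) (r ∷ [])))

      len₁ : ∀ (l : List V) {m} → 3 ≤ length m → 3 ≤ length (l ++ m)
      len₁ l {m} h = subst (3 ≤_) (sym (length-++ l)) (≤-trans h (m≤n+m _ (length l)))

    loop : Loop
    loop with ∈-∃++ target
    ... | x ∷ pre , post , refl =
      cycle-from x (pre ++ r ∷ []) (x ∷ pre) post (cong (x ∷_) (sym (++-assoc pre (r ∷ []) post))) refl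
        (len₁ l (s≤s (s≤s (subst (1 ≤_) (sym (length-++ pre)) (m≤n+m 1 (length pre))))))
    ... | [] , post , refl = cycle-from r [] [] post refl refl (big l proper)
      where
      big : ∀ (l : List V) → (l ≡ [] → r ≢ r) → 3 ≤ length (l ++ v ∷ r ∷ [])
      big [] h = ⊥-elim (h refl refl)
      big (x ∷ l) h = s≤s (subst (2 ≤_) (sym (length-++ l)) (m≤n+m 2 (length l)))

  first-∈ : ∀ (l : List V) v → firstOr v l ∈ l ++ v ∷ []
  first-∈ [] v = here refl
  first-∈ (x ∷ l) v = here refl

  low-anc : ∀ {v anc l r x} → Back v anc l r → x ∈ l ++ v ∷ [] → x ∈ anc → ⊥
  low-anc {v} {anc} {l} {r} {x} B i j =
    <-irrefl (sym (proj₁ (simple-split (l ++ v ∷ []) (subst Simple (sym (++-assoc l (v ∷ []) anc)) (Back.simple B)) x) (occ-∈ i)))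
      (occ-∈ j)

  lone : ∀ {v l rest} → Simple (l ++ v ∷ rest) → firstOr v l ≡ v → l ≡ []
  lone {l = []} s e = refl
  lone {v} {x ∷ l} s refl = ⊥-elim (<-irrefl refl (≤-trans (+-mono-≤ (≤-reflexive (sym (δ-refl v)))
    (inʳ l (≤-trans (≤-reflexive (sym (δ-refl v))) (m≤m+n _ _)))) (s v)))

  module _ (cac : IsCactus G) where

    -- Both fundamental cycles contain the edge from `v` to its parent, so they have the same edges.
    -- The first back edge joins the lower part to an ancestor, and the only edges of the second
    -- cycle doing so are the tree edge and its own back edge.
    back-unique : ∀ {v anc l₁ l₂ r₁ r₂} → Back v anc l₁ r₁ → Back v anc l₂ r₂ →
      firstOr v l₁ ≡ firstOr v l₂ × r₁ ≡ r₂
    back-unique {v} {anc} {l₁} {l₂} {r₁} {r₂} B₁ B₂ = go edge₂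
      where
      open Loop (loop B₁) renaming (cycle to C₁; p to p₁; q to q₁; pre to pre₁; anc≡ to anc≡₁; up≡ to up≡₁; verts≡ to verts≡₁) hiding (post)
      open Loop (loop B₂) renaming (cycle to C₂; p to p₂; q to q₂; pre to pre₂; post to post₂; anc≡ to anc≡₂; up≡ to up≡₂; verts≡ to verts≡₂)
      pairs₁ : cycPairs (verts C₁) ≡ closing (firstOr v l₁) (l₁ ++ v ∷ p₁ ∷ q₁)
      pairs₁ = trans (cong cycPairs verts≡₁) (cycPairs-from l₁ v (p₁ ∷ q₁))
      pairs₂ : cycPairs (verts C₂) ≡ closing (firstOr v l₂) (l₂ ++ v ∷ p₂ ∷ q₂)
      pairs₂ = trans (cong cycPairs verts≡₂) (cycPairs-from l₂ v (p₂ ∷ q₂))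
      p≡ : p₁ ≡ p₂
      p≡ = cong (firstOr v) (trans (sym anc≡₁) anc≡₂)
      shared₁ : EdgeOf C₁ v p₁
      shared₁ = inj₁ (subst ((v , p₁) ∈_) (sym pairs₁) (closing-step _ l₁ v p₁ q₁))
      shared₂ : EdgeOf C₂ v p₁
      shared₂ = inj₁ (subst ((v , p₁) ∈_) (sym pairs₂) (subst (λ p → (v , p) ∈ closing (firstOr v l₂) (l₂ ++ v ∷ p₂ ∷ q₂)) (sym p≡) (closing-step (firstOr v l₂) l₂ v p₂ q₂)))
      w₁ : V
      w₁ = firstOr v l₁
      tip₁ : l₁ ++ v ∷ p₁ ∷ q₁ ≡ (l₁ ++ v ∷ pre₁) ++ r₁ ∷ []
      tip₁ = trans (cong (λ a → l₁ ++ v ∷ a) up≡₁) (sym (++-assoc l₁ (v ∷ pre₁) (r₁ ∷ [])))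
      edge₁ : EdgeOf C₁ w₁ r₁
      edge₁ = inj₂ (subst ((r₁ , w₁) ∈_) (sym (trans pairs₁ (cong (closing w₁) tip₁))) (closing-last w₁ (l₁ ++ v ∷ pre₁) r₁))
      edge₂ : EdgeOf C₂ w₁ r₁
      edge₂ = Equivalence.to (cac C₁ C₂ (v , p₁ , shared₁ , shared₂) w₁ r₁) edge₁
      up-anc : ∀ {x} → x ∈ p₂ ∷ q₂ → x ∈ anc
      up-anc i = subst (_ ∈_) (sym anc≡₂) (∈-++⁺ˡ i)
      w₁∉anc : w₁ ∈ anc → ⊥
      w₁∉anc = low-anc B₁ (first-∈ l₁ v)
      r₂∈anc : r₂ ∈ anc
      r₂∈anc = Back.target B₂
      r₁∉low : r₁ ∈ l₂ ++ v ∷ [] → ⊥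
      r₁∉low i = low-anc B₂ i (Back.target B₁)
      not-up : w₁ ≡ v → r₁ ≡ p₂ → ⊥
      not-up e e′ = Back.proper B₁ (lone (Back.simple B₁) e) (trans (cong (firstOr r₁) anc≡₂) (sym e′))
      go : EdgeOf C₂ w₁ r₁ → w₁ ≡ firstOr v l₂ × r₁ ≡ r₂
      go (inj₁ m) with closing-pass (firstOr v l₂) l₂ v p₂ q₂ pre₂ r₂ up≡₂ (subst ((w₁ , r₁) ∈_) pairs₂ m)
      ... | below i j = ⊥-elim (r₁∉low j)
      ... | across e e′ = ⊥-elim (not-up e e′)
      ... | above i j = ⊥-elim (w₁∉anc (up-anc i))
      ... | back e e′ = ⊥-elim (w₁∉anc (subst (_∈ anc) (sym e) r₂∈anc))
      go (inj₂ m) with closing-pass (firstOr v l₂) l₂ v p₂ q₂ pre₂ r₂ up≡₂ (subst ((r₁ , w₁) ∈_) pairs₂ m)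
      ... | below i j = ⊥-elim (r₁∉low i)
      ... | across e e′ = ⊥-elim (r₁∉low (subst (_∈ l₂ ++ v ∷ []) (sym e) (∈-++⁺ʳ l₂ (here refl))))
      ... | above i j = ⊥-elim (w₁∉anc (up-anc j))
      ... | back e e′ = e′ , e

  private
    to-c : ∀ a b c d e → a + b + (c + (d + e)) ≡ c + b + (a + (d + e))
    to-c = solve-∀
    to-d : ∀ a b c d e → a + b + (c + (d + e)) ≡ d + b + (c + (a + e))
    to-d = solve-∀
    to-e : ∀ a b c d e → a + b + (c + (d + e)) ≡ e + b + (c + (d + a))
    to-e = solve-∀

  -- Depth-first search

  -- Room for one chain is enough: a second one leading above `v` would contradict `back-unique`.
  data Hang : Set where
    intact  : Hang
    hanging : Chain → V → Hang

  vH : Hang → List V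
  vH intact = []
  vH (hanging ch r) = vC ch

  eH : V → Hang → List (V × V)
  eH v intact = []
  eH v (hanging ch r) = (v , top ch) ∷ (bot ch , r) ∷ eC ch

  -- Listed from the bottom upwards, so that the ancestors continue it to a single path.
  spine : Chain → List V
  spine (base t) = lab t ∷ []
  spine (step t ch) = spine ch ++ lab t ∷ []

  HangOK : V → List V → Hang → Set
  HangOK v anc intact = ⊤
  HangOK v anc (hanging ch r) = Linked (Adj G) (spine ch ++ v ∷ anc) × r ∈ anc × Adj G (bot ch) r

  eS : V → Items → Hang → List (V × V)
  eS v is hg = eI v is ++ eH v hg

  -- The search at v: anc are the ancestors of v, nearest first, U the vertices not yet visited,
  -- is the branches and cycles completed at v, hg the part of a cycle passing through v and its
  -- edge back to a proper ancestor.
  record State (v : V) (anc U : List V) (is : Items) (hg : Hang) : Set where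
    field
      uniq   : ∀ x → δ v x + occ (vI is) x + (occ (vH hg) x + (occ U x + occ anc x)) ≤ 1
      linked : Linked (Adj G) (v ∷ anc)
      -- The depth-first property: a finished vertex has no unvisited neighbour.
      closedU : ∀ x y → 1 ≤ occ U x → Adj G x y → 1 ≤ δ v y + (occ U y + occ anc y)
      nbrs   : ∀ y → Adj G v y → 1 ≤ δ v y + occ (vI is) y + (occ (vH hg) y + (occ U y + occ anc y))
      edges  : ∀ x → 1 ≤ occ (vI is) x + occ (vH hg) x → ∀ y → mult (eS v is hg) x y ≡ adjN x y
      noloop : mult (eS v is hg) v v ≡ 0
      hang   : HangOK v anc hg

    at-v : ∀ x → 1 ≤ δ v x → OthersZero (δ v x) (occ (vI is) x) (occ (vH hg) x) (occ U x) (occ anc x)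
    at-v x = alone (uniq x)

    at-H : ∀ x → 1 ≤ occ (vH hg) x → OthersZero (occ (vH hg) x) (occ (vI is) x) (δ v x) (occ U x) (occ anc x)
    at-H x = alone (subst (_≤ 1) (to-c (δ v x) (occ (vI is) x) (occ (vH hg) x) (occ U x) (occ anc x)) (uniq x))

    at-U : ∀ x → 1 ≤ occ U x → OthersZero (occ U x) (occ (vI is) x) (occ (vH hg) x) (δ v x) (occ anc x)
    at-U x = alone (subst (_≤ 1) (to-d (δ v x) (occ (vI is) x) (occ (vH hg) x) (occ U x) (occ anc x)) (uniq x))

    at-anc : ∀ x → 1 ≤ occ anc x → OthersZero (occ anc x) (occ (vI is) x) (occ (vH hg) x) (occ U x) (δ v x)
    at-anc x = alone (subst (_≤ 1) (to-e (δ v x) (occ (vI is) x) (occ (vH hg) x) (occ U x) (occ anc x)) (uniq x))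

  data Result : Set where
    tree  : Tree → Result
    chain : Chain → V → Result

  vR : Result → List V
  vR (tree t) = vT t
  vR (chain ch r) = vC ch

  eR : Result → List (V × V)
  eR (tree t) = eT t
  eR (chain ch r) = (bot ch , r) ∷ eC ch

  labR : Result → V
  labR (tree t) = lab t
  labR (chain ch r) = top ch

  IsStep : Chain → Set
  IsStep (base _) = ⊥
  IsStep (step _ _) = ⊤

  -- The last condition keeps a chain of one vertex from closing at its own parent, which would be a
  -- tree edge used twice and not a cycle.
  ResultOK : List V → Result → Set
  ResultOK anc (tree t) = ⊤
  ResultOK anc (chain ch r) =
    Linked (Adj G) (spine ch ++ anc) × r ∈ anc × Adj G (bot ch) r × (IsStep ch ⊎ firstOr r anc ≢ r)

  up : List V → V → List (V × V)
  up [] v = []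
  up (p ∷ _) v = (p , v) ∷ []

  record Explored (v : V) (anc : List V) (total : V → ℕ) (res : Result) (U′ : List V) : Set where
    field
      root   : labR res ≡ v
      count  : ∀ x → total x ≡ occ (vR res) x + occ U′ x
      edges  : ∀ x → 1 ≤ occ (vR res) x → ∀ y → mult (up anc v ++ eR res) x y ≡ adjN x y
      result : ResultOK anc res

  totalS : V → Items → Hang → List V → V → ℕ
  totalS v is hg U x = δ v x + occ (vI is) x + (occ (vH hg) x + occ U x)

  member-δ : ∀ {r anc} x → r ∈ anc → occ anc x ≡ 0 → δ r x ≡ 0
  member-δ {r} {a ∷ anc} x (here refl) h = m+n≡0⇒m≡0 (δ r x) h
  member-δ {r} {a ∷ anc} x (there i) h = member-δ x i (m+n≡0⇒n≡0 (δ a x) h)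

  avoids-S : ∀ {v anc} is hg {x} → HangOK v anc hg → δ v x ≡ 0 → occ (vI is) x ≡ 0 → occ (vH hg) x ≡ 0 →
    occ anc x ≡ 0 → Avoids x (eS v is hg)
  avoids-S is intact ok p i h a = ++⁺ (avoids-I is p i) []
  avoids-S is (hanging ch r) (_ , r∈ , _) p i h a =
    ++⁺ (avoids-I is p i) ((p , absent-top ch h) ∷ (absent-bot ch h , member-δ _ r∈ a) ∷ avoids-C ch h)

  avoids-R : ∀ {anc} res {x} → ResultOK anc res → occ (vR res) x ≡ 0 → occ anc x ≡ 0 → Avoids x (eR res)
  avoids-R (tree t) ok h a = avoids-T t h
  avoids-R (chain ch r) (_ , r∈ , _) h a = (absent-bot ch h , member-δ _ r∈ a) ∷ avoids-C ch h

  absent-labR : ∀ res {x} → occ (vR res) x ≡ 0 → δ (labR res) x ≡ 0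
  absent-labR (tree t) h = absent-lab t h
  absent-labR (chain ch r) h = absent-top ch h

  spine≤ : ∀ ch x → occ (spine ch) x ≤ occ (vC ch) x
  spine≤ (base (node v is)) x = +-monoʳ-≤ (δ v x) z≤n
  spine≤ (step (node v is) ch) x
    rewrite occ-++ (spine ch) (v ∷ []) x | occ-++ (vI is) (vC ch) x | +-identityʳ (δ v x) =
    ≤-trans (≤-reflexive (+-comm (occ (spine ch) x) (δ v x)))
      (≤-trans (+-monoʳ-≤ (δ v x) (≤-trans (spine≤ ch x) (m≤n+m _ (occ (vI is) x)))) ≤-refl)

  firstOr-spine : ∀ ch {v : V} → firstOr v (spine ch) ≡ bot ch
  firstOr-spine (base t) = refl
  firstOr-spine (step t ch) = trans (h (spine ch)) (firstOr-spine ch)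
    where
    h : ∀ l {v} → firstOr v (l ++ lab t ∷ []) ≡ firstOr (lab t) l
    h [] = refl
    h (x ∷ l) = refl

  spine≢[] : ∀ ch → spine ch ≢ []
  spine≢[] (base t) ()
  spine≢[] (step t ch) e with spine ch
  spine≢[] (step t ch) () | []
  spine≢[] (step t ch) () | x ∷ l

  adjN-sym : ∀ x y → adjN x y ≡ adjN y x
  adjN-sym x y = cong (λ b → if b then 1 else 0) (adj-sym G x y)

  adjN-1 : ∀ {x y} → Adj G x y → adjN x y ≡ 1
  adjN-1 {x} {y} a rewrite a = refl

  -- Shared by the three ways of adding a finished child: as a branch, as a closed cycle and as a
  -- hanging chain. These differ only in how `vs≡` and `es≡` are obtained.
  module Extend {v anc U is hg} (S : State v anc U is hg)
    {w U₁ U′ res} (v~w : Adj G v w) (U≡ : ∀ x → occ U x ≡ δ w x + occ U₁ x)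
    (X : Explored w (v ∷ anc) (totalS w [] intact U₁) res U′)
    (is′ : Items) (hg′ : Hang)
    (vs≡ : ∀ x → occ (vI is′) x + occ (vH hg′) x ≡ occ (vI is) x + occ (vH hg) x + occ (vR res) x)
    (es≡ : ∀ x y → mult (eS v is′ hg′) x y ≡ mult (eS v is hg) x y + mult ((v , w) ∷ eR res) x y)
    (ok : HangOK v anc hg′) where

    open State S
    module X = Explored X

    private
      U-split : ∀ x → occ U x ≡ occ (vR res) x + occ U′ x
      U-split x = trans (U≡ x) (trans (h (δ w x) (occ U₁ x)) (X.count x))
        where
        h : ∀ a b → a + b ≡ a + 0 + b
        h = solve-∀

      total≡ : ∀ x → δ v x + occ (vI is′) x + (occ (vH hg′) x + (occ U′ x + occ anc x))
             ≡ δ v x + occ (vI is) x + (occ (vH hg) x + (occ U x + occ anc x))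
      total≡ x rewrite U-split x = trans (h₁ (δ v x) (occ (vI is′) x) (occ (vH hg′) x) (occ U′ x) (occ anc x))
        (trans (cong (λ z → δ v x + z + (occ U′ x + occ anc x)) (vs≡ x))
          (h₂ (δ v x) (occ (vI is) x) (occ (vH hg) x) (occ (vR res) x) (occ U′ x) (occ anc x)))
        where
        h₁ : ∀ a b c d e → a + b + (c + (d + e)) ≡ a + (b + c) + (d + e)
        h₁ = solve-∀
        h₂ : ∀ a b c r d e → a + (b + c + r) + (d + e) ≡ a + b + (c + (r + d + e))
        h₂ = solve-∀

      R⊆U : ∀ {x} → 1 ≤ occ (vR res) x → 1 ≤ occ U x
      R⊆U {x} p = ≤-trans p (≤-trans (m≤m+n _ _) (≤-reflexive (sym (U-split x))))

      U′⊆U : ∀ {x} → 1 ≤ occ U′ x → 1 ≤ occ U x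
      U′⊆U {x} p = ≤-trans p (≤-trans (m≤n+m _ (occ (vR res) x)) (≤-reflexive (sym (U-split x))))

      avoids-new : ∀ {x} → δ v x ≡ 0 → occ anc x ≡ 0 → occ (vR res) x ≡ 0 → Avoids x ((v , w) ∷ eR res)
      avoids-new {x} p a r =
        (p , subst (λ z → δ z x ≡ 0) X.root (absent-labR res r)) ∷
        avoids-R res X.result r (trans (cong (_+ occ anc x) p) a)

      R-U′ : ∀ {x} → 1 ≤ occ U′ x → occ (vR res) x ≡ 0
      R-U′ {x} p = ≤1-split (≤-trans (≤-reflexive (trans (+-comm (occ U′ x) (occ (vR res) x)) (sym (U-split x)))) U≤1) p
        where
        U≤1 : occ U x ≤ 1
        U≤1 = ≤-trans (m≤m+n (occ U x) (occ anc x))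
          (≤-trans (m≤n+m _ (occ (vH hg) x)) (≤-trans (m≤n+m _ (δ v x + occ (vI is) x)) (uniq x)))

      U-zero : ∀ {x} → occ U x ≡ 0 → occ (vR res) x ≡ 0
      U-zero {x} z = m+n≡0⇒m≡0 _ (trans (sym (U-split x)) z)

      closed′ : ∀ x y → 1 ≤ occ U′ x → Adj G x y → 1 ≤ δ v y + (occ U′ y + occ anc y)
      closed′ x y p a = subst (λ z → 1 ≤ δ v y + (z + occ anc y)) (trans (U-split y) (cong (_+ occ U′ y) Ry≡0))
                          (closedU x y (U′⊆U p) a)
        where
        -- If `y` were finished, its edges would all be listed already, but none of them ends at the
        -- unvisited `x`.
        Ry≡0 : occ (vR res) y ≡ 0
        Ry≡0 with occ (vR res) y in e
        ... | 0 = refl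
        ... | suc _ with at-U x (U′⊆U p)
        ... | others-zero _ _ dv da = ⊥-elim (<-irrefl refl (subst (1 ≤_) zero-mult (≤-reflexive (sym (adjN-1 (trans (adj-sym G y x) a))))))
          where
          zero-mult : adjN y x ≡ 0
          zero-mult = trans (sym (X.edges y (subst (1 ≤_) (sym e) (s≤s z≤n)) x))
            (trans (mult-sym ((v , w) ∷ eR res) y x) (mult-avoids (avoids-new dv da (R-U′ p)) y))

      edges′ : ∀ x → 1 ≤ occ (vI is′) x + occ (vH hg′) x → ∀ y → mult (eS v is′ hg′) x y ≡ adjN x y
      edges′ x p y with occ (vR res) x in e
      ... | suc m with at-U x (R⊆U (subst (1 ≤_) (sym e) (s≤s z≤n)))
      ... | others-zero i h dv da = trans (es≡ x y)
        (cong₂ _+_ (mult-avoids (avoids-S is hg hang dv i h da) y) (X.edges x (subst (1 ≤_) (sym e) (s≤s z≤n)) y))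
      edges′ x p y | zero = trans (es≡ x y) (trans (cong₂ _+_ (edges x p′ y) (mult-avoids (avoids-new dv da e) y)) (+-identityʳ _))
        where
        p′ : 1 ≤ occ (vI is) x + occ (vH hg) x
        p′ = subst (1 ≤_) (trans (vs≡ x) (trans (cong (occ (vI is) x + occ (vH hg) x +_) e) (+-identityʳ _))) p
        h : ∀ a b c d → a + b + (c + d) ≡ b + c + (a + d)
        h = solve-∀
        rest : δ v x + (occ U x + occ anc x) ≡ 0
        rest = ≤1-split (subst (_≤ 1) (h (δ v x) (occ (vI is) x) (occ (vH hg) x) (occ U x + occ anc x)) (uniq x)) p′
        dv : δ v x ≡ 0
        dv = m+n≡0⇒m≡0 _ rest
        da : occ anc x ≡ 0
        da = m+n≡0⇒n≡0 (occ U x) (m+n≡0⇒n≡0 (δ v x) rest)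

      noloop′ : mult (eS v is′ hg′) v v ≡ 0
      noloop′ = trans (es≡ v v) (cong₂ _+_ noloop (cong₂ _+_ vw (inner res X.result Rv≡0)))
        where
        Rv≡0 : occ (vR res) v ≡ 0
        Rv≡0 with at-v v (≤-reflexive (sym (δ-refl v)))
        ... | others-zero _ _ u _ = U-zero u
        da : occ anc v ≡ 0
        da with at-v v (≤-reflexive (sym (δ-refl v)))
        ... | others-zero _ _ _ a = a
        w≢v : δ w v ≡ 0
        w≢v = subst (λ z → δ z v ≡ 0) X.root (absent-labR res Rv≡0)
        vw : joins (v , w) v v ≡ 0
        vw rewrite w≢v | *-zeroʳ (δ v v) = refl
        inner : ∀ res → ResultOK (v ∷ anc) res → occ (vR res) v ≡ 0 → mult (eR res) v v ≡ 0
        inner (tree t) _ z = mult-avoids (avoids-T t z) v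
        inner (chain ch r) _ z rewrite absent-bot ch z | *-zeroʳ (δ r v) = mult-avoids (avoids-C ch z) v

    extend : State v anc U′ is′ hg′
    extend = record
      { uniq = λ x → subst (_≤ 1) (sym (total≡ x)) (uniq x)
      ; linked = linked
      ; closedU = closed′
      ; nbrs = λ y a → subst (1 ≤_) (sym (total≡ y)) (nbrs y a)
      ; edges = edges′
      ; noloop = noloop′
      ; hang = ok }

    total-extend : ∀ x → totalS v is′ hg′ U′ x ≡ totalS v is hg U x
    total-extend x rewrite U-split x = trans (h₁ (δ v x) (occ (vI is′) x) (occ (vH hg′) x) (occ U′ x))
        (trans (cong (λ z → δ v x + z + occ U′ x) (vs≡ x))
          (h₂ (δ v x) (occ (vI is) x) (occ (vH hg) x) (occ (vR res) x) (occ U′ x)))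
      where
      h₁ : ∀ a b c d → a + b + (c + d) ≡ a + (b + c) + d
      h₁ = solve-∀
      h₂ : ∀ a b c r d → a + (b + c + r) + d ≡ a + b + (c + (r + d))
      h₂ = solve-∀

  occ-bot : ∀ ch → 1 ≤ occ (vC ch) (bot ch)
  occ-bot (base t) = occ-lab t
  occ-bot (step t ch) = inʳ (vT t) (occ-bot ch)

  spine-back : ∀ {v anc ch r} → HangOK v anc (hanging ch r) →
    (∀ x → occ (vC ch) x + (δ v x + occ anc x) ≤ 1) → Back v anc (spine ch) r
  spine-back {v} {anc} {ch} {r} (linked , r∈ , a) s = record
    { linked = linked
    ; simple = λ x → subst (_≤ 1) (sym (occ-++ (spine ch) (v ∷ anc) x))
                 (≤-trans (+-monoˡ-≤ (δ v x + occ anc x) (spine≤ ch x)) (s x))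
    ; target = r∈
    ; closes = trans (cong (λ w → adj G w r) (firstOr-spine ch)) a
    ; proper = λ e → ⊥-elim (spine≢[] ch e) }

  joins-flip : ∀ a b x y → joins (a , b) x y ≡ joins (b , a) x y
  joins-flip a b x y = +-comm (δ a x * δ b y) (δ b x * δ a y)

  module _ (cac : IsCactus G) where

    private
      g₁ : ∀ t i h → t + i + h ≡ i + h + t
      g₁ = solve-∀
      g₂ : ∀ j t i h → j + (t + i) + h ≡ i + h + (j + t)
      g₂ = solve-∀
      g₃ : ∀ a b c i h → a + (b + (c + i)) + h ≡ i + h + (a + (b + c))
      g₃ = solve-∀
      g₄ : ∀ i r → i + 0 + r ≡ i + r
      g₄ = solve-∀

    -- A chain whose back edge ends at `v` closes to a cycle; one that ends higher has to hang. If
    -- another chain hangs already, both would have the same bottom vertex by `back-unique`,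
    -- although they are disjoint.
    absorb : ∀ {v anc U is hg} → State v anc U is hg → ∀ {w U₁ U′ res} → Adj G v w →
      (∀ x → occ U x ≡ δ w x + occ U₁ x) → Explored w (v ∷ anc) (totalS w [] intact U₁) res U′ →
      ∃ λ is′ → ∃ λ hg′ → State v anc U′ is′ hg′ × (∀ x → totalS v is′ hg′ U′ x ≡ totalS v is hg U x)
    absorb {v} {anc} {U} {is} {hg} S {w} {U₁} {U′} {tree t} a U≡ X = _ , _ , E.extend , E.total-extend
      where
      es≡ : ∀ x y → mult (eS v (br t is) hg) x y ≡ mult (eS v is hg) x y + mult ((v , w) ∷ eT t) x y
      es≡ x y rewrite sym (Explored.root X) | mult-++ (eI v (br t is)) (eH v hg) x y | mult-++ (eT t) (eI v is) x y
                    | mult-++ (eI v is) (eH v hg) x y =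
        g₂ (joins (v , lab t) x y) (mult (eT t) x y) (mult (eI v is) x y) (mult (eH v hg) x y)
      vs≡ : ∀ x → occ (vI (br t is)) x + occ (vH hg) x ≡ occ (vI is) x + occ (vH hg) x + occ (vT t) x
      vs≡ x rewrite occ-++ (vT t) (vI is) x = g₁ (occ (vT t) x) (occ (vI is) x) (occ (vH hg) x)
      module E = Extend S {w} {U₁} a U≡ X (br t is) hg vs≡ es≡ (State.hang S)
    absorb {v} {anc} {U} {is} {hg} S {w} {U₁} {U′} {chain ch r} a U≡ X with r ≟ v | Explored.result X
    absorb {v} {anc} {U} {is} {hg} S {w} {U₁} {U′} {chain (base t) r} a U≡ X | yes refl | _ , _ , _ , inj₂ ne =
      ⊥-elim (ne refl)
    absorb {v} {anc} {U} {is} {hg} S {w} {U₁} {U′} {chain (step t ch) r} a U≡ X | yes refl | _ =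
      _ , _ , E.extend , E.total-extend
      where
      es≡ : ∀ x y → mult (eS v (cyc t ch is) hg) x y ≡ mult (eS v is hg) x y + mult ((v , w) ∷ (bot ch , v) ∷ eC (step t ch)) x y
      es≡ x y rewrite sym (Explored.root X) | mult-++ (eI v (cyc t ch is)) (eH v hg) x y
                    | mult-++ (eC (step t ch)) (eI v is) x y
                    | mult-++ (eI v is) (eH v hg) x y | joins-flip (bot ch) v x y =
        g₃ (joins (v , lab t) x y) (joins (v , bot ch) x y) (mult (eC (step t ch)) x y) (mult (eI v is) x y) (mult (eH v hg) x y)
      vs≡ : ∀ x → occ (vI (cyc t ch is)) x + occ (vH hg) x ≡ occ (vI is) x + occ (vH hg) x + occ (vT t ++ vC ch) x
      vs≡ x rewrite occ-++ (vT t ++ vC ch) (vI is) x = g₁ (occ (vT t ++ vC ch) x) (occ (vI is) x) (occ (vH hg) x)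
      module E = Extend S {w} {U₁} a U≡ X (cyc t ch is) hg vs≡ es≡ (State.hang S)
    absorb {v} {anc} {U} {is} {intact} S {w} {U₁} {U′} {chain ch r} a U≡ X | no r≢v | linked , r∈ , b , _ =
      _ , _ , E.extend , E.total-extend
      where
      r∈anc : r ∈ v ∷ anc → r ∈ anc
      r∈anc (here e) = ⊥-elim (r≢v e)
      r∈anc (there i) = i
      es≡ : ∀ x y → mult (eS v is (hanging ch r)) x y ≡ mult (eS v is intact) x y + mult ((v , w) ∷ (bot ch , r) ∷ eC ch) x y
      es≡ x y rewrite sym (Explored.root X) | mult-++ (eI v is) (eH v (hanging ch r)) x y | mult-++ (eI v is) [] x y =
        sym (g₄ (mult (eI v is) x y) (mult ((v , top ch) ∷ (bot ch , r) ∷ eC ch) x y))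
      vs≡ : ∀ x → occ (vI is) x + occ (vC ch) x ≡ occ (vI is) x + 0 + occ (vC ch) x
      vs≡ x = sym (g₄ (occ (vI is) x) (occ (vC ch) x))
      module E = Extend S {w} {U₁} a U≡ X is (hanging ch r) vs≡ es≡ (linked , r∈anc r∈ , b)
    absorb {v} {anc} {U} {is} {hanging ch₂ r₂} S {w} {U₁} {U′} {chain ch r} a U≡ X | no r≢v | linked , r∈ , b , _ =
      ⊥-elim (apart (State.at-H S (bot ch₂) (occ-bot ch₂)))
      where
      r∈anc : r ∈ v ∷ anc → r ∈ anc
      r∈anc (here e) = ⊥-elim (r≢v e)
      r∈anc (there i) = i
      ch≤U : ∀ x → occ (vC ch) x ≤ occ U x
      ch≤U x = ≤-trans (m≤m+n _ (occ U′ x)) (≤-reflexive (trans (sym (Explored.count X x)) (trans (h (δ w x) (occ U₁ x)) (sym (U≡ x)))))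
        where
        h : ∀ a b → a + 0 + b ≡ a + b
        h = solve-∀
      B : Back v anc (spine ch) r
      B = spine-back {ch = ch} (linked , r∈anc r∈ , b) λ x → ≤-trans (+-monoˡ-≤ (δ v x + occ anc x) (ch≤U x))
        (≤-trans (≤-trans (m≤m+n _ (occ (vI is) x + occ (vC ch₂) x)) (≤-reflexive (h (δ v x) (occ (vI is) x) (occ (vC ch₂) x) (occ U x) (occ anc x)))) (State.uniq S x))
        where
        h : ∀ a b c d e → d + (a + e) + (b + c) ≡ a + b + (c + (d + e))
        h = solve-∀
      B₂ : Back v anc (spine ch₂) r₂
      B₂ = spine-back {ch = ch₂} (State.hang S) λ x →
        ≤-trans (≤-trans (m≤m+n _ (occ (vI is) x + occ U x)) (≤-reflexive (h (δ v x) (occ (vI is) x) (occ (vC ch₂) x) (occ U x) (occ anc x)))) (State.uniq S x)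
        where
        h : ∀ a b c d e → c + (a + e) + (b + d) ≡ a + b + (c + (d + e))
        h = solve-∀
      bots : bot ch ≡ bot ch₂
      bots = trans (sym (firstOr-spine ch)) (trans (proj₁ (back-unique cac B B₂)) (firstOr-spine ch₂))
      apart : OthersZero (occ (vC ch₂) (bot ch₂)) (occ (vI is) (bot ch₂)) (δ v (bot ch₂)) (occ U (bot ch₂)) (occ anc (bot ch₂)) → ⊥
      apart (others-zero _ _ u _) = <-irrefl refl (subst (1 ≤_) u (≤-trans (subst (λ z → 1 ≤ occ (vC ch) z) bots (occ-bot ch)) (ch≤U (bot ch₂))))

  -- `extra` holds the edges from `v` to its ancestors, namely the parent edge and possibly a back
  -- edge; the state at `v` does not record them.
  record Ending (v : V) (anc : List V) (is : Items) (hg : Hang) (res : Result) (extra : List (V × V)) : Set where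
    field
      rootE  : labR res ≡ v
      vertsE : ∀ x → occ (vR res) x ≡ δ v x + occ (vI is) x + occ (vH hg) x
      edgesE : ∀ x y → mult (up anc v ++ eR res) x y ≡ mult (eS v is hg) x y + mult extra x y
      avoidE : ∀ x → δ v x ≡ 0 → occ anc x ≡ 0 → Avoids x extra
      ancE   : ∀ y → 1 ≤ occ anc y → mult extra v y ≡ adjN v y
      offE   : ∀ y → occ anc y ≡ 0 → mult extra v y ≡ 0
      okE    : ResultOK anc res

  nonadj : ∀ {x y} → ¬ Adj G x y → adjN x y ≡ 0
  nonadj {x} {y} h with adj G x y
  ... | true = ⊥-elim (h refl)
  ... | false = refl

  ending : ∀ {v anc U is hg res extra} → State v anc U is hg → (∀ y → 1 ≤ occ U y → ¬ Adj G v y) →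
    Ending v anc is hg res extra → Explored v anc (totalS v is hg U) res U
  ending {v} {anc} {U} {is} {hg} {res} {extra} S stuck E = record
    { root = rootE ; count = count ; edges = edges′ ; result = okE }
    where
    open State S
    open Ending E
    h₁ : ∀ a b c d → a + b + (c + d) ≡ a + b + c + d
    h₁ = solve-∀
    count : ∀ x → totalS v is hg U x ≡ occ (vR res) x + occ U x
    count x rewrite vertsE x = h₁ (δ v x) (occ (vI is) x) (occ (vH hg) x) (occ U x)
    v-anc : occ anc v ≡ 0
    v-anc with at-v v (≤-reflexive (sym (δ-refl v)))
    ... | others-zero _ _ _ a = a
    v-hg : occ (vH hg) v ≡ 0
    v-hg with at-v v (≤-reflexive (sym (δ-refl v)))
    ... | others-zero _ h _ _ = h
    at-root : ∀ y → mult (eS v is hg) v y + mult extra v y ≡ adjN v y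
    at-root y with y ≟ v
    ... | yes refl = trans (cong₂ _+_ noloop (offE v v-anc)) (sym (cong (λ b → if b then 1 else 0) (irref G v)))
    ... | no y≢v with occ anc y in ea
    ... | suc m with at-anc y (subst (1 ≤_) (sym ea) (s≤s z≤n))
    ... | others-zero i h u dv = trans (cong₂ _+_ (trans (mult-sym (eS v is hg) v y) (zero-at hg hang h v-hg)) (ancE y (subst (1 ≤_) (sym ea) (s≤s z≤n)))) refl
      where
      zero-at : ∀ hg → HangOK v anc hg → occ (vH hg) y ≡ 0 → occ (vH hg) v ≡ 0 → mult (eS v is hg) y v ≡ 0
      zero-at intact _ h _ rewrite mult-++ (eI v is) [] y v = trans (+-identityʳ _) (mult-avoids (avoids-I is dv i) v)
      zero-at (hanging ch r) _ h hv
        rewrite mult-++ (eI v is) ((v , top ch) ∷ (bot ch , r) ∷ eC ch) y v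
              | mult-avoids (avoids-I {v} is dv i) v | dv | absent-top ch h | absent-bot ch h
              | absent-bot ch hv | *-zeroʳ (δ r y) = mult-avoids (avoids-C ch h) v
    at-root y | no y≢v | zero with occ (vI is) y + occ (vH hg) y in eo
    ... | suc m = trans (cong₂ _+_ (trans (mult-sym (eS v is hg) v y) (edges y (subst (1 ≤_) (sym eo) (s≤s z≤n)) v)) (offE y ea))
                    (trans (+-identityʳ _) (adjN-sym y v))
    ... | zero = trans (cong₂ _+_ (trans (mult-sym (eS v is hg) v y) (mult-avoids (avoids-S is hg hang dv i h ea) v)) (offE y ea))
                   (sym (nonadj far))
      where
      dv : δ v y ≡ 0
      dv = δ-≢ (≢-sym y≢v)
      i : occ (vI is) y ≡ 0
      i = m+n≡0⇒m≡0 _ eo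
      h : occ (vH hg) y ≡ 0
      h = m+n≡0⇒n≡0 (occ (vI is) y) eo
      far : ¬ Adj G v y
      far a = stuck y (subst (1 ≤_) z (nbrs y a)) a
        where
        z : δ v y + occ (vI is) y + (occ (vH hg) y + (occ U y + occ anc y)) ≡ occ U y
        z rewrite dv | i | h | ea = +-identityʳ _
    edges′ : ∀ x → 1 ≤ occ (vR res) x → ∀ y → mult (up anc v ++ eR res) x y ≡ adjN x y
    edges′ x p y with x ≟ v
    ... | yes refl = trans (edgesE x y) (at-root y)
    ... | no x≢v = trans (edgesE x y) (trans (cong₂ _+_ (edges x p′ y) (mult-avoids (avoidE x dv da) y)) (+-identityʳ _))
      where
      dv : δ v x ≡ 0
      dv = δ-≢ (≢-sym x≢v)
      p′ : 1 ≤ occ (vI is) x + occ (vH hg) x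
      p′ = subst (1 ≤_) (trans (vertsE x) (cong (λ z → z + occ (vI is) x + occ (vH hg) x) dv)) p
      h : ∀ a b c d → a + b + (c + d) ≡ b + c + (a + d)
      h = solve-∀
      da : occ anc x ≡ 0
      da = m+n≡0⇒n≡0 (occ U x) (m+n≡0⇒n≡0 (δ v x)
        (≤1-split (subst (_≤ 1) (h (δ v x) (occ (vI is) x) (occ (vH hg) x) (occ U x + occ anc x)) (uniq x)) p′))

  Extracted : (V → Set) → List V → Set
  Extracted P U = ∃ λ w → ∃ λ U₁ → P w × (∀ x → occ U x ≡ δ w x + occ U₁ x) × length U ≡ suc (length U₁)

  extract : ∀ {P : V → Set} → (∀ x → Dec (P x)) → ∀ U → Extracted P U ⊎ (∀ x → 1 ≤ occ U x → ¬ P x)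
  extract P? [] = inj₂ λ x ()
  extract P? (u ∷ U) with P? u
  ... | yes p = inj₁ (u , U , p , (λ x → refl) , refl)
  ... | no ¬p with extract P? U
  ... | inj₁ (w , U₁ , p , e , l) = inj₁ (w , u ∷ U₁ , p , (λ x → trans (cong (δ u x +_) (e x)) (h (δ u x) (δ w x) (occ U₁ x))) , cong suc l)
    where
    h : ∀ a b c → a + (b + c) ≡ b + (a + c)
    h = solve-∀
  ... | inj₂ none-left = inj₂ λ x i p → none-left x (elsewhere x i p) p
    where
    elsewhere : ∀ x → 1 ≤ δ u x + occ U x → _ → 1 ≤ occ U x
    elsewhere x i p with u ≟ x
    ... | yes refl = ⊥-elim (¬p p)
    ... | no u≢x = subst (λ z → 1 ≤ z + occ U x) (δ-≢ u≢x) i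

  adj? : ∀ v x → Dec (Adj G v x)
  adj? v x with adj G v x
  ... | true = yes refl
  ... | false = no λ ()

  extracted-∈ : ∀ {U w U₁} → (∀ x → occ U x ≡ δ w x + occ U₁ x) → 1 ≤ occ U w
  extracted-∈ {U} {w} e = subst (1 ≤_) (sym (e w)) (≤-trans (≤-reflexive (sym (δ-refl w))) (m≤m+n _ _))

  module _ (cac : IsCactus G) where

    -- A back edge from `v` starts a chain, a hanging chain is lengthened by `v`, and otherwise `v`
    -- completes a tree. Both a hanging chain and an own back edge, or two own back edges, are
    -- excluded by `back-unique`.
    finish : ∀ {v anc U is hg} → State v anc U is hg → (∀ y → 1 ≤ occ U y → ¬ Adj G v y) →
      ∃ λ res → Explored v anc (totalS v is hg U) res U
    finish {v} {[]} {U} {is} {intact} S stuck = tree (node v is) , ending {extra = []} S stuck (record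
      { rootE = refl
      ; vertsE = λ x → sym (+-identityʳ _)
      ; edgesE = λ x y → trans (sym (trans (mult-++ (eI v is) [] x y) (+-identityʳ _))) (sym (+-identityʳ _))
      ; avoidE = λ _ _ _ → []
      ; ancE = λ _ ()
      ; offE = λ _ _ → refl
      ; okE = tt })
    finish {v} {[]} {U} {is} {hanging ch r} S stuck with State.hang S
    ... | _ , () , _
    finish {v} {p ∷ anc} {U} {is} {hg} S stuck with State.linked S
    ... | vp ∷ _ = go hg S (extract (adj? v) anc)
      where
      open State S using (uniq; linked)
      path-simple : Simple (v ∷ p ∷ anc)
      path-simple x = ≤-trans (≤-trans (m≤m+n _ (occ (vI is) x + (occ (vH hg) x + occ U x)))
        (≤-reflexive (h (δ v x) (occ (vI is) x) (occ (vH hg) x) (occ U x) (δ p x + occ anc x)))) (uniq x)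
        where
        h : ∀ a b c d e → a + e + (b + (c + d)) ≡ a + b + (c + (d + e))
        h = solve-∀
      p≢v : δ p v ≡ 0
      p≢v = m+n≡0⇒m≡0 _ (≤1-split (path-simple v) (≤-reflexive (sym (δ-refl v))))
      v∉anc : occ anc v ≡ 0
      v∉anc = m+n≡0⇒n≡0 (δ p v) (≤1-split (path-simple v) (≤-reflexive (sym (δ-refl v))))
      p∉anc : occ anc p ≡ 0
      p∉anc = ≤1-split (≤-trans (m≤n+m _ (δ v p)) (path-simple p)) (≤-reflexive (sym (δ-refl p)))
      pv : ∀ y → joins (p , v) v y ≡ δ p y
      pv y rewrite p≢v | δ-refl v = +-identityʳ (δ p y)
      own-back : ∀ {r} → r ∈ anc → Adj G v r → Back v (p ∷ anc) [] r
      own-back {r} r∈ a = record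
        { linked = linked ; simple = path-simple ; target = there r∈ ; closes = a
        ; proper = λ { _ refl → <-irrefl refl (subst (1 ≤_) p∉anc (occ-∈ r∈)) } }
      plain-avoid : ∀ x → δ v x ≡ 0 → δ p x + occ anc x ≡ 0 → Avoids x ((p , v) ∷ [])
      plain-avoid x dv da = (m+n≡0⇒m≡0 _ da , dv) ∷ []
      plain-off : ∀ y → δ p y + occ anc y ≡ 0 → mult ((p , v) ∷ []) v y ≡ 0
      plain-off y da = trans (+-identityʳ _) (trans (pv y) (m+n≡0⇒m≡0 _ da))
      plain-anc : (∀ y → 1 ≤ occ anc y → ¬ Adj G v y) → ∀ y → 1 ≤ δ p y + occ anc y → mult ((p , v) ∷ []) v y ≡ adjN v y
      plain-anc stop y i with p ≟ y
      ... | yes refl = trans (+-identityʳ _) (trans (pv p) (trans (δ-refl p) (sym (adjN-1 vp))))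
      ... | no p≢y = trans (+-identityʳ _) (trans (pv y) (trans (δ-≢ p≢y)
        (sym (nonadj (stop y (subst (λ z → 1 ≤ z + occ anc y) (δ-≢ p≢y) i))))))
      go : ∀ hg → State v (p ∷ anc) U is hg → Extracted (Adj G v) anc ⊎ (∀ y → 1 ≤ occ anc y → ¬ Adj G v y) →
        ∃ λ res → Explored v (p ∷ anc) (totalS v is hg U) res U
      go intact S (inj₂ stop) = tree (node v is) , ending {extra = (p , v) ∷ []} S stuck (record
        { rootE = refl
        ; vertsE = λ x → sym (+-identityʳ _)
        ; edgesE = λ x y → trans (h (joins (p , v) x y) (mult (eI v is) x y)) (cong (_+ (joins (p , v) x y + 0)) (sym (mult-++ (eI v is) [] x y)))
        ; avoidE = plain-avoid
        ; ancE = plain-anc stop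
        ; offE = plain-off
        ; okE = tt })
        where
        h : ∀ j e → j + e ≡ e + 0 + (j + 0)
        h = solve-∀
      go (hanging ch r) S (inj₂ stop) = chain (step (node v is) ch) r , ending {extra = (p , v) ∷ []} S stuck (record
        { rootE = refl
        ; vertsE = λ x → trans (cong (δ v x +_) (occ-++ (vI is) (vC ch) x)) (sym (+-assoc (δ v x) _ _))
        ; edgesE = edges≡
        ; avoidE = plain-avoid
        ; ancE = plain-anc stop
        ; offE = plain-off
        ; okE = subst (Linked (Adj G)) (sym (++-assoc (spine ch) (v ∷ []) (p ∷ anc))) (proj₁ (State.hang S)) ,
                proj₁ (proj₂ (State.hang S)) , proj₂ (proj₂ (State.hang S)) , inj₁ tt })
        where
        edges≡ : ∀ x y → mult ((p , v) ∷ (bot ch , r) ∷ (v , top ch) ∷ eI v is ++ eC ch) x y ≡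
          mult (eI v is ++ (v , top ch) ∷ (bot ch , r) ∷ eC ch) x y + (joins (p , v) x y + 0)
        edges≡ x y rewrite mult-++ (eI v is) (eC ch) x y | mult-++ (eI v is) ((v , top ch) ∷ (bot ch , r) ∷ eC ch) x y =
          h (joins (p , v) x y) (joins (bot ch , r) x y) (joins (v , top ch) x y) (mult (eI v is) x y) (mult (eC ch) x y)
          where
          h : ∀ j b t e c → j + (b + (t + (e + c))) ≡ e + (t + (b + c)) + (j + 0)
          h = solve-∀
      go intact S (inj₁ (r , anc₁ , vr , e , _)) = chain (base (node v is)) r , ending {extra = (p , v) ∷ (v , r) ∷ []} S stuck (record
        { rootE = refl
        ; vertsE = λ x → sym (+-identityʳ _)
        ; edgesE = λ x y → trans (h (joins (p , v) x y) (joins (v , r) x y) (mult (eI v is) x y))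
                     (cong (_+ (joins (p , v) x y + (joins (v , r) x y + 0))) (sym (mult-++ (eI v is) [] x y)))
        ; avoidE = λ x dv da → (m+n≡0⇒m≡0 _ da , dv) ∷ (dv , member-δ x r∈ (m+n≡0⇒n≡0 (δ p x) da)) ∷ []
        ; ancE = anc≡
        ; offE = λ y da → trans (cong₂ _+_ (pv y) (trans (+-identityʳ _) (vrv y)))
                   (cong₂ _+_ (m+n≡0⇒m≡0 (δ p y) da) (member-δ y r∈ (m+n≡0⇒n≡0 (δ p y) da)))
        ; okE = linked , there r∈ , vr , inj₂ (λ { refl → <-irrefl refl (subst (1 ≤_) p∉anc (occ-∈ r∈)) }) })
        where
        r∈ : r ∈ anc
        r∈ = ∈-occ anc (extracted-∈ {anc} {U₁ = anc₁} e)
        h : ∀ j b e → j + (b + e) ≡ e + 0 + (j + (b + 0))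
        h = solve-∀
        vrv : ∀ y → joins (v , r) v y ≡ δ r y
        vrv y rewrite δ-refl v | member-δ v r∈ v∉anc = trans (+-identityʳ _) (+-identityʳ _)
        anc≡ : ∀ y → 1 ≤ δ p y + occ anc y → mult ((p , v) ∷ (v , r) ∷ []) v y ≡ adjN v y
        anc≡ y i = trans (cong₂ _+_ (pv y) (trans (+-identityʳ _) (vrv y))) (cases (p ≟ y) (r ≟ y))
          where
          cases : Dec (p ≡ y) → Dec (r ≡ y) → δ p y + δ r y ≡ adjN v y
          cases (yes refl) _ = trans (cong₂ _+_ (δ-refl p) (member-δ p r∈ p∉anc)) (sym (adjN-1 vp))
          cases (no p≢y) (yes refl) = trans (cong₂ _+_ (δ-≢ p≢y) (δ-refl r)) (sym (adjN-1 vr))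
          cases (no p≢y) (no r≢y) = trans (cong₂ _+_ (δ-≢ p≢y) (δ-≢ r≢y)) (sym (nonadj λ a →
            r≢y (proj₂ (back-unique cac (own-back r∈ vr)
              (own-back (∈-occ anc (subst (λ z → 1 ≤ z + occ anc y) (δ-≢ p≢y) i)) a)))))
      go (hanging ch r₂) S (inj₁ (r , anc₁ , vr , e , _)) = ⊥-elim (apart (State.at-v S v (≤-reflexive (sym (δ-refl v)))))
        where
        r∈ : r ∈ anc
        r∈ = ∈-occ anc (extracted-∈ {anc} {U₁ = anc₁} e)
        B : Back v (p ∷ anc) (spine ch) r₂
        B = spine-back {ch = ch} (State.hang S) λ x →
          ≤-trans (≤-trans (m≤m+n _ (occ (vI is) x + occ U x)) (≤-reflexive (h (δ v x) (occ (vI is) x) (occ (vC ch) x) (occ U x) (δ p x + occ anc x)))) (State.uniq S x)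
          where
          h : ∀ a b c d e → c + (a + e) + (b + d) ≡ a + b + (c + (d + e))
          h = solve-∀
        bot≡v : bot ch ≡ v
        bot≡v = trans (sym (firstOr-spine ch)) (proj₁ (back-unique cac B (own-back r∈ vr)))
        apart : OthersZero (δ v v) (occ (vI is) v) (occ (vC ch) v) (occ U v) (δ p v + occ anc v) → ⊥
        apart (others-zero _ c _ _) = <-irrefl refl (subst (1 ≤_) c (subst (λ z → 1 ≤ occ (vC ch) z) bot≡v (occ-bot ch)))

    -- The fuel bounds the number of unvisited vertices. It drops both for the search from the child
    -- `w` and for the continuation at `v`, since `w` has left the list.
    explore : ∀ fuel {v anc U is hg} → length U ≤ fuel → State v anc U is hg →
      ∃ λ res → ∃ λ U′ → Explored v anc (totalS v is hg U) res U′ × length U′ ≤ length U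
    explore fuel {v} {anc} {U} {is} {hg} len S with extract (adj? v) U
    ... | inj₂ stuck = let (res , X) = finish S stuck in res , U , X , ≤-refl
    explore zero {v} {anc} {U} {is} {hg} len S | inj₁ (w , U₁ , a , e , l) = ⊥-elim (<-irrefl refl (≤-trans (≤-reflexive (sym l)) (≤-trans len z≤n)))
    explore (suc fuel) {v} {anc} {U} {is} {hg} len S | inj₁ (w , U₁ , a , e , l) with explore fuel {w} {v ∷ anc} {U₁} {[]} {intact} len₁ start
      where
      open State S
      len₁ : length U₁ ≤ fuel
      len₁ = ≤-pred (subst (_≤ suc fuel) l len)
      h : ∀ a b c w u e → (w + 0 + (0 + (u + (a + e)))) + (b + c) ≡ a + b + (c + ((w + u) + e))
      h = solve-∀
      h₁ : ∀ a w u e → a + (w + u + e) ≡ w + (u + (a + e))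
      h₁ = solve-∀
      h₂ : ∀ a w u e → a + (w + u + e) ≡ w + 0 + (0 + (u + (a + e)))
      h₂ = solve-∀
      U₁⊆U : ∀ {x} → 1 ≤ occ U₁ x → 1 ≤ occ U x
      U₁⊆U {x} p = subst (1 ≤_) (sym (e x)) (≤-trans p (m≤n+m _ (δ w x)))
      start : State w (v ∷ anc) U₁ [] intact
      start = record
        { uniq = λ x → ≤-trans (≤-trans (m≤m+n _ (occ (vI is) x + occ (vH hg) x))
            (≤-reflexive (trans (h (δ v x) (occ (vI is) x) (occ (vH hg) x) (δ w x) (occ U₁ x) (occ anc x))
              (cong (λ z → δ v x + occ (vI is) x + (occ (vH hg) x + (z + occ anc x))) (sym (e x)))))) (uniq x)
        ; linked = trans (adj-sym G w v) a ∷ linked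
        ; closedU = λ x y p b → subst (1 ≤_) (trans (cong (λ z → δ v y + (z + occ anc y)) (e y)) (h₁ (δ v y) (δ w y) (occ U₁ y) (occ anc y)))
            (closedU x y (U₁⊆U p) b)
        ; nbrs = λ y b → subst (1 ≤_) (trans (cong (λ z → δ v y + (z + occ anc y)) (e y)) (h₂ (δ v y) (δ w y) (occ U₁ y) (occ anc y)))
            (closedU w y (extracted-∈ {U} {U₁ = U₁} e) b)
        ; edges = λ _ ()
        ; noloop = refl
        ; hang = tt }
    ... | res , U′ , X , len′ with absorb cac S {w} {U₁} a e X
    ... | is′ , hg′ , S′ , total with explore fuel (≤-trans len′ (≤-pred (subst (_≤ suc fuel) l len))) S′
    ... | res′ , U″ , X′ , len″ = res′ , U″ ,
      record { root = X′.root ; count = λ x → trans (sym (total x)) (X′.count x) ; edges = X′.edges ; result = X′.result } ,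
      ≤-trans len″ (≤-trans len′ (≤-trans (n≤1+n _) (≤-reflexive (sym l))))
      where
      module X′ = Explored X′

    -- Colouring component after component

    record Coloured (U : List V) (E : List (Entry {4})) : Set where
      field
        separate : ∀ x y → 1 ≤ occ U x → Adj G x y → 1 ≤ occ U y
        simpleU  : Simple U
        covered  : ∀ x → occ U x ≡ 0 → ∀ y → mult (ends E) x y ≡ adjN x y
        fresh    : ∀ x → 1 ≤ occ U x → Avoids x (ends E)
        irregular : LocallyIrregular E

    module _ {k} (C : EdgeColouring G k) (liec : IsLIEC C) where

      -- No earlier edge meets the new component and no new edge meets the earlier ones, so the two
      -- lists can be joined without changing any degree that was already settled.
      next-component : ∀ {U E w U₁} → Coloured U E → (∀ x → occ U x ≡ δ w x + occ U₁ x) →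
        (degree w ≡ 2 → ∀ x → 1 ≤ occ U x → degree x ≡ 2) →
        ∃ λ U′ → ∃ λ E′ → Coloured U′ E′ × length U′ ≤ length U₁
      next-component {U} {E} {w} {U₁} K e regular
        with explore (length U₁) {w} {[]} {U₁} {[]} {intact} ≤-refl start
        where
        open Coloured K
        h : ∀ a b → a + b ≡ a + 0 + (0 + (b + 0))
        h = solve-∀
        h′ : ∀ a b → a + b ≡ a + (b + 0)
        h′ = solve-∀
        start : State w [] U₁ [] intact
        start = record
          { uniq = λ x → subst (_≤ 1) (trans (e x) (h (δ w x) (occ U₁ x))) (simpleU x)
          ; linked = [-]
          ; closedU = λ x y p a → subst (1 ≤_) (trans (e y) (h′ (δ w y) (occ U₁ y)))
              (separate x y (subst (1 ≤_) (sym (e x)) (≤-trans p (m≤n+m _ (δ w x)))) a)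
          ; nbrs = λ y a → subst (1 ≤_) (trans (e y) (h (δ w y) (occ U₁ y))) (separate w y (extracted-∈ {U} {U₁ = U₁} e) a)
          ; edges = λ _ ()
          ; noloop = refl
          ; hang = tt }
      -- At a root there is no ancestor at which a chain could close.
      ... | chain ch r , U′ , X , len with Explored.result X
      ... | _ , () , _
      next-component {U} {E} {w} {U₁} K e regular | tree t , U′ , X , len = U′ , xT ct ++ E , K′ , len
        where
        open Coloured K
        module X = Explored X
        U-split : ∀ x → occ U x ≡ occ (vT t) x + occ U′ x
        U-split x = trans (e x) (trans (h (δ w x) (occ U₁ x)) (X.count x))
          where
          h : ∀ a b → a + b ≡ a + 0 + b
          h = solve-∀
        t⊆U : ∀ {x} → 1 ≤ occ (vT t) x → 1 ≤ occ U x
        t⊆U {x} p = subst (1 ≤_) (sym (U-split x)) (≤-trans p (m≤m+n _ _))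
        U′⊆U : ∀ {x} → 1 ≤ occ U′ x → 1 ≤ occ U x
        U′⊆U {x} p = subst (1 ≤_) (sym (U-split x)) (≤-trans p (m≤n+m _ (occ (vT t) x)))
        U′∉t : ∀ {x} → 1 ≤ occ U′ x → occ (vT t) x ≡ 0
        U′∉t {x} p = ≤1-split (subst (_≤ 1) (trans (U-split x) (+-comm (occ (vT t) x) (occ U′ x))) (simpleU x)) p
        sp : Spans t
        sp = record
          { simpleT = λ x → ≤-trans (m≤m+n _ (occ U′ x)) (subst (_≤ 1) (U-split x) (simpleU x))
          ; edgesT = X.edges }
        coloured : Colourable₀ 4 t
        coloured = colour-tree sp (λ d x p → regular (subst (λ z → degree z ≡ 2) X.root d) x (t⊆U p)) C liec
        ct : ColT 4 t
        ct = proj₁ coloured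
        ends≡ : ∀ x y → mult (ends (xT ct ++ E)) x y ≡ mult (eT t) x y + mult (ends E) x y
        ends≡ x y = trans (cong (λ es → mult es x y) (trans (ends-++ (xT ct) E) (cong (_++ ends E) (ends-xT ct))))
          (mult-++ (eT t) (ends E) x y)
        hyp : Degrees.HypT (degE (xT ct)) none ct
        hyp x i _ = sym (trans (cong (degE (xT ct) x i +_) (*-zeroʳ (δ (lab t) x))) (+-identityʳ _))
        own : LocallyIrregular (xT ct)
        own = valid⇒LI-T (degE (xT ct)) ct (simpleT sp) hyp (proj₂ coloured)
        contradicts : ∀ {a x} → a ≡ x → δ a x ≡ 0 → ⊥
        contradicts {a} refl z = 0≢1+n (trans (sym z) (δ-refl a))
        inside : ∀ {u v c} → (u , v , c) ∈ xT ct → 1 ≤ occ (vT t) u × 1 ≤ occ (vT t) v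
        inside {u} {v} p =
          n≢0⇒n>0 (λ z → contradicts refl (proj₁ (All.lookup (avoids-T t z) q))) ,
          n≢0⇒n>0 (λ z → contradicts refl (proj₂ (All.lookup (avoids-T t z) q)))
          where
          q : (u , v) ∈ eT t
          q = subst ((u , v) ∈_) (ends-xT ct) (ends-∈ p)
        outside : ∀ {u v c} → (u , v , c) ∈ E → occ (vT t) u ≡ 0 × occ (vT t) v ≡ 0
        outside {u} {v} p = absent u (λ a → contradicts refl (proj₁ (All.lookup a (ends-∈ p)))) ,
                            absent v (λ a → contradicts refl (proj₂ (All.lookup a (ends-∈ p))))
          where
          absent : ∀ x → ¬ Avoids x (ends E) → occ (vT t) x ≡ 0
          absent x na with occ (vT t) x in eq
          ... | zero = refl
          ... | suc m = ⊥-elim (na (fresh x (t⊆U (subst (1 ≤_) (sym eq) (s≤s z≤n)))))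
        deg-in : ∀ {x} i → 1 ≤ occ (vT t) x → degE (xT ct ++ E) x i ≡ degE (xT ct) x i
        deg-in {x} i p = trans (degE-++ (xT ct) E x i)
          (trans (cong (degE (xT ct) x i +_) (degE-avoids E i (fresh x (t⊆U p)))) (+-identityʳ _))
        deg-out : ∀ {x} i → occ (vT t) x ≡ 0 → degE (xT ct ++ E) x i ≡ degE E x i
        deg-out {x} i z = trans (degE-++ (xT ct) E x i) (cong (_+ degE E x i) (degE-absentT ct i z))
        K′ : Coloured U′ (xT ct ++ E)
        K′ = record
          { separate = separate′
          ; simpleU = λ x → ≤-trans (m≤n+m _ (occ (vT t) x)) (subst (_≤ 1) (U-split x) (simpleU x))
          ; covered = covered′
          ; fresh = λ x p → subst (Avoids x) (sym (trans (ends-++ (xT ct) E) (cong (_++ ends E) (ends-xT ct))))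
              (++⁺ (avoids-T t (U′∉t p)) (fresh x (U′⊆U p)))
          ; irregular = ++⁺
              (All.tabulate λ {(u , v , c)} p z → All.lookup own p
                (trans (sym (deg-in c (proj₁ (inside p)))) (trans z (deg-in c (proj₂ (inside p))))))
              (All.tabulate λ {(u , v , c)} p z → All.lookup irregular p
                (trans (sym (deg-out c (proj₁ (outside p)))) (trans z (deg-out c (proj₂ (outside p)))))) }
          where
          separate′ : ∀ x y → 1 ≤ occ U′ x → Adj G x y → 1 ≤ occ U′ y
          separate′ x y p a with occ (vT t) y in eq
          ... | zero = subst (1 ≤_) (trans (U-split y) (cong (_+ occ U′ y) eq)) (separate x y (U′⊆U p) a)
          ... | suc m = ⊥-elim (0≢1+n (trans (sym z) (adjN-1 (trans (adj-sym G y x) a))))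
            where
            z : adjN y x ≡ 0
            z = trans (sym (X.edges y (subst (1 ≤_) (sym eq) (s≤s z≤n)) x))
                  (trans (mult-sym (eT t) y x) (mult-avoids (avoids-T t (U′∉t p)) y))
          covered′ : ∀ x → occ U′ x ≡ 0 → ∀ y → mult (ends (xT ct ++ E)) x y ≡ adjN x y
          covered′ x z y with occ (vT t) x in eq
          ... | zero = trans (ends≡ x y) (trans (cong (_+ mult (ends E) x y) (mult-avoids (avoids-T t eq) y))
                  (covered x (trans (U-split x) (cong₂ _+_ eq z)) y))
          ... | suc m = trans (ends≡ x y) (trans (cong (mult (eT t) x y +_) (mult-avoids (fresh x (t⊆U p)) y))
                  (trans (+-identityʳ _) (X.edges x p y)))
            where
            p : 1 ≤ occ (vT t) x
            p = subst (1 ≤_) (sym eq) (s≤s z≤n)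

      -- A component is searched from a vertex of degree other than two if it has one,
      -- so that a root with a single cycle through it occurs only in a bare cycle.
      all-components : ∀ fuel {U E} → length U ≤ fuel → Coloured U E → HasLIEC G 4
      all-components fuel {[]} {E} _ K =
        from-edges zero E (λ x y → Coloured.covered K x refl y) (Coloured.irregular K)
      all-components (suc fuel) {u ∷ U} {E} len K with extract (λ x → ¬? (degree x ≟ℕ 2)) (u ∷ U)
      ... | inj₁ (w , U₁ , d , e , l) =
        let (_ , _ , K′ , len′) = next-component {U₁ = U₁} K e (λ d₂ → ⊥-elim (d d₂)) in
        all-components fuel (≤-trans len′ (≤-pred (subst (_≤ suc fuel) l len))) K′
      ... | inj₂ two-regular =
        let (_ , _ , K′ , len′) = next-component {U₁ = U} K (λ _ → refl)
              (λ _ x p → decidable-stable (degree x ≟ℕ 2) (two-regular x p)) in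
        all-components fuel (≤-trans len′ (≤-pred len)) K′

      four : HasLIEC G 4
      four = all-components (length (allFin (n G))) {allFin (n G)} {[]} ≤-refl (record
        { separate = λ x y _ _ → occ-∈ (∈-allFin y)
        ; simpleU = unique⇒simple (allFin⁺ (n G))
        ; covered = λ x z → ⊥-elim (<-irrefl refl (subst (1 ≤_) z (occ-∈ (∈-allFin x))))
        ; fresh = λ _ _ → []
        ; irregular = [] })

theorem10 : (G : Graph) → IsCactus G → Colourable G → HasLIEC G 4
theorem10 G cac (k , C , liec) = Cactus.four G cac C liec
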